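{- Let $R$ be one of the chain rings $\mathbb{G}_4=\mathbb{Z}_4[X]/(X^2+X+1)$, $\mathbb{S}_4=\mathbb{F}_4[X]/(X^2)$, $\mathbb{T}_4=\mathbb{F}_4[X;a\mapsto a^2]/(X^2)$. Then (i) $\mathrm{m}_6(R)\le 84$, and (ii) $\mathrm{m}_6(R)<84$ if $R\ne\mathbb{G}_4$.
   Context: $\mathbb{F}_4[X;a\mapsto a^2]$ denotes the skew polynomial ring with commutation rule $Xa=a^2X$. For a finite chain ring $R$ of length $2$ with residue field $\mathbb{F}_q$, the projective Hjelmslev plane $\mathrm{PHG}(2,R)$ is the incidence structure whose points are the free rank-$1$ submodules of the right module $R_R^3$, whose lines are the free rank-$2$ submodules of $R_R^3$, with incidence given by inclusion. A projective $(k,n)$-arc is a set of $k$ points meeting every line in at most $n$ points. For $0\le n\le q^2+q$, $\mathrm{m}_n(R)$ denotes the largest $k$ such that a projective $(k,n)$-arc exists in $\mathrm{PHG}(2,R)$. -}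

module Defs where

open import Algebra.Bundles using (AbelianGroup; CommutativeRing; Ring)
open import Algebra.Construct.DirectProduct using (abelianGroup)
open import Algebra.Module.Bundles using (RightModule)
open import Algebra.Module.Construct.DirectProduct using () renaming (rightModule to _⊕_)
open import Algebra.Module.Construct.TensorUnit using () renaming (rightModule to asRightModule)
open import Algebra.Morphism.Structures using (IsRingHomomorphism)
import Algebra.Morphism.Construct.Identity as Identity
import Algebra.Properties.CommutativeMonoid.Sum as Sum
import Algebra.Solver.Ring.NaturalCoefficients.Default as Solver
open import Data.Empty using (⊥-elim)
open import Data.Fin.Base using (Fin; zero; suc; toℕ; fromℕ<)
import Data.Fin.Properties as Fin
open import Data.Fin.Subset using (Subset; _∈_; ∣_∣)
open import Data.Fin.Subset.Properties using (anySubset?) renaming (_∈?_ to _∈ˢ?_)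
open import Data.Nat.Base as ℕ using (ℕ; zero; suc; NonZero; z≤n; s≤s⁻¹)
open import Data.Nat.DivMod using (_%_; m%n<n; m%n%n≡m%n; m<n⇒m%n≡m; %-distribˡ-+; %-distribˡ-*; n%n≡0)
import Data.Nat.Properties as ℕ
open import Data.Product.Base using (Σ; ∃; _×_; _,_; proj₁; proj₂)
open import Data.Product.Function.NonDependent.Setoid using (_×-inverse_)
open import Data.Product.Relation.Binary.Pointwise.NonDependent using (_×ₛ_; Pointwise-≡↔≡)
open import Data.Vec.Base using ([])
open import Data.Vec.Functional using (_∷_)
import Data.Vec.Functional.Relation.Binary.Equality.Setoid as Vec
open import Function.Base using (id; _∘_)
open import Function.Bundles using (Inverse)
import Function.Construct.Composition as Compose
import Function.Construct.Identity as IdentityFunction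
import Function.Construct.Symmetry as Symmetry
open import Level using (0ℓ)
open import Relation.Binary.Bundles using (Setoid)
open import Relation.Binary.Definitions using (_Respects_)
open import Relation.Binary.PropositionalEquality as ≡ using (_≡_; _≢_)
open import Relation.Nullary using (¬_; Dec; yes; no)
open import Relation.Nullary.Decidable using (map′; ¬?; decidable-stable; _×-dec_; _→-dec_)
open import Relation.Unary using (Pred; Decidable; _⊆_; _≐_)

module _ (n : ℕ) .{{_ : NonZero n}} where

  private
    infix 8 [_]
    [_] : ℕ → Fin n
    [ a ] = fromℕ< (m%n<n a n)

    toℕ-[] : ∀ a → toℕ [ a ] ≡ a % n
    toℕ-[] a = Fin.toℕ-fromℕ< _

    []-cong : ∀ {a b} → a % n ≡ b % n → [ a ] ≡ [ b ]
    []-cong {a} {b} eq = Fin.toℕ-injective (≡.trans (toℕ-[] a) (≡.trans eq (≡.sym (toℕ-[] b))))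

    []-toℕ : ∀ x → [ toℕ x ] ≡ x
    []-toℕ x = Fin.toℕ-injective (≡.trans (toℕ-[] _) (m<n⇒m%n≡m (Fin.toℕ<n x)))

    toℕ-[]-% : ∀ a → toℕ [ a ] % n ≡ a % n
    toℕ-[]-% a = ≡.trans (≡.cong (_% n) (toℕ-[] a)) (m%n%n≡m%n a n)

    +-% : ∀ {a b c d} → a % n ≡ c % n → b % n ≡ d % n → (a ℕ.+ b) % n ≡ (c ℕ.+ d) % n
    +-% {a} {b} {c} {d} p q = ≡.trans (%-distribˡ-+ a b n)
      (≡.trans (≡.cong₂ (λ x y → (x ℕ.+ y) % n) p q) (≡.sym (%-distribˡ-+ c d n)))

    *-% : ∀ {a b c d} → a % n ≡ c % n → b % n ≡ d % n → (a ℕ.* b) % n ≡ (c ℕ.* d) % n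
    *-% {a} {b} {c} {d} p q = ≡.trans (%-distribˡ-* a b n)
      (≡.trans (≡.cong₂ (λ x y → (x ℕ.* y) % n) p q) (≡.sym (%-distribˡ-* c d n)))

    infixl 6 _⊞_
    infixl 7 _⊠_
    _⊞_ _⊠_ : Fin n → Fin n → Fin n
    x ⊞ y = [ toℕ x ℕ.+ toℕ y ]
    x ⊠ y = [ toℕ x ℕ.* toℕ y ]

    ⊟_ : Fin n → Fin n
    ⊟ x = [ n ℕ.∸ toℕ x ]

    ⊞-comm : ∀ x y → x ⊞ y ≡ y ⊞ x
    ⊞-comm x y = ≡.cong [_] (ℕ.+-comm (toℕ x) (toℕ y))

    ⊠-comm : ∀ x y → x ⊠ y ≡ y ⊠ x
    ⊠-comm x y = ≡.cong [_] (ℕ.*-comm (toℕ x) (toℕ y))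

    ⊞-identityˡ : ∀ x → [ 0 ] ⊞ x ≡ x
    ⊞-identityˡ x = ≡.trans ([]-cong (+-% (toℕ-[]-% 0) (≡.refl {x = toℕ x % n}))) ([]-toℕ x)

    ⊠-identityˡ : ∀ x → [ 1 ] ⊠ x ≡ x
    ⊠-identityˡ x = ≡.trans ([]-cong (*-% (toℕ-[]-% 1) (≡.refl {x = toℕ x % n})))
      (≡.trans (≡.cong [_] (ℕ.*-identityˡ (toℕ x))) ([]-toℕ x))

    ⊟-inverseˡ : ∀ x → (⊟ x) ⊞ x ≡ [ 0 ]
    ⊟-inverseˡ x = []-cong (≡.trans (+-% (toℕ-[]-% (n ℕ.∸ toℕ x)) (≡.refl {x = toℕ x % n}))
      (≡.trans (≡.cong (_% n) (ℕ.m∸n+n≡m (ℕ.<⇒≤ (Fin.toℕ<n x))))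
      (≡.trans (n%n≡0 n) (≡.sym (m<n⇒m%n≡m (ℕ.>-nonZero⁻¹ n))))))

    ⊞-assoc : ∀ x y z → (x ⊞ y) ⊞ z ≡ x ⊞ (y ⊞ z)
    ⊞-assoc x y z = []-cong (≡.trans (+-% (toℕ-[]-% _) (≡.refl {x = toℕ z % n}))
      (≡.trans (≡.cong (_% n) (ℕ.+-assoc (toℕ x) (toℕ y) (toℕ z)))
        (+-% (≡.refl {x = toℕ x % n}) (≡.sym (toℕ-[]-% _)))))

    ⊠-assoc : ∀ x y z → (x ⊠ y) ⊠ z ≡ x ⊠ (y ⊠ z)
    ⊠-assoc x y z = []-cong (≡.trans (*-% (toℕ-[]-% _) (≡.refl {x = toℕ z % n}))
      (≡.trans (≡.cong (_% n) (ℕ.*-assoc (toℕ x) (toℕ y) (toℕ z)))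
        (*-% (≡.refl {x = toℕ x % n}) (≡.sym (toℕ-[]-% _)))))

    distribˡ : ∀ x y z → x ⊠ (y ⊞ z) ≡ (x ⊠ y) ⊞ (x ⊠ z)
    distribˡ x y z = []-cong (≡.trans (*-% (≡.refl {x = toℕ x % n}) (toℕ-[]-% _))
      (≡.trans (≡.cong (_% n) (ℕ.*-distribˡ-+ (toℕ x) (toℕ y) (toℕ z)))
        (≡.sym (+-% (toℕ-[]-% _) (toℕ-[]-% _)))))

  ℤ/_ : CommutativeRing 0ℓ 0ℓ
  ℤ/_ = record
    { Carrier = Fin n
    ; _≈_ = _≡_
    ; _+_ = _⊞_
    ; _*_ = _⊠_
    ; -_  = ⊟_
    ; 0#  = [ 0 ]
    ; 1#  = [ 1 ]
    ; isCommutativeRing = record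
      { isRing = record
        { +-isAbelianGroup = record
          { isGroup = record
            { isMonoid = record
              { isSemigroup = record
                { isMagma = record
                  { isEquivalence = ≡.isEquivalence ; ∙-cong = ≡.cong₂ _⊞_ }
                ; assoc = ⊞-assoc
                }
              ; identity = ⊞-identityˡ , λ x → ≡.trans (⊞-comm x _) (⊞-identityˡ x)
              }
            ; inverse = ⊟-inverseˡ , λ x → ≡.trans (⊞-comm x _) (⊟-inverseˡ x)
            ; ⁻¹-cong = ≡.cong ⊟_
            }
          ; comm = ⊞-comm
          }
        ; *-cong = ≡.cong₂ _⊠_
        ; *-assoc = ⊠-assoc
        ; *-identity = ⊠-identityˡ , λ x → ≡.trans (⊠-comm x _) (⊠-identityˡ x)
        ; distrib = distribˡ , λ x y z → ≡.trans (⊠-comm (y ⊞ z) x)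
            (≡.trans (distribˡ x y z) (≡.cong₂ _⊞_ (⊠-comm x y) (⊠-comm x z)))
        }
      ; *-comm = ⊠-comm
      }
    }

-- In the quotient rings below the pair (a , b) is the class of a + bX, the
-- unique representative of degree less than two.

module _ (A : CommutativeRing 0ℓ 0ℓ) where

  open CommutativeRing A
  open Solver commutativeSemiring using (solve; _:=_; _:+_; _:*_)

  private
    module +² = AbelianGroup (abelianGroup +-abelianGroup +-abelianGroup)

  -- A[X]/(X² − sX − t)
  quadratic : (s t : Carrier) → CommutativeRing 0ℓ 0ℓ
  quadratic s t = record
    { Carrier = Carrier × Carrier
    ; _≈_ = +²._≈_
    ; _+_ = +²._∙_
    ; _*_ = _·_
    ; -_  = +²._⁻¹
    ; 0#  = 0# , 0#
    ; 1#  = 1# , 0#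
    ; isCommutativeRing = record
      { isRing = record
        { +-isAbelianGroup = +².isAbelianGroup
        ; *-cong = λ (p , q) (p′ , q′) →
            +-cong (*-cong p p′) (*-congˡ (*-cong q q′)) ,
            +-cong (+-cong (*-cong p q′) (*-cong q p′)) (*-congˡ (*-cong q q′))
        ; *-assoc = λ (a , b) (c , d) (e , f) →
            solve 8 (λ s t a b c d e f →
              ((a :* c :+ t :* (b :* d)) :* e :+ t :* ((a :* d :+ b :* c :+ s :* (b :* d)) :* f)) :=
              (a :* (c :* e :+ t :* (d :* f)) :+ t :* (b :* (c :* f :+ d :* e :+ s :* (d :* f)))))
              refl s t a b c d e f ,
            solve 8 (λ s t a b c d e f →
              ((a :* c :+ t :* (b :* d)) :* f :+ (a :* d :+ b :* c :+ s :* (b :* d)) :* e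
                 :+ s :* ((a :* d :+ b :* c :+ s :* (b :* d)) :* f)) :=
              (a :* (c :* f :+ d :* e :+ s :* (d :* f)) :+ b :* (c :* e :+ t :* (d :* f))
                 :+ s :* (b :* (c :* f :+ d :* e :+ s :* (d :* f)))))
              refl s t a b c d e f
        ; *-identity = identityˡ , λ x → +².trans (·-comm x _) (identityˡ x)
        ; distrib = distˡ , λ x y z → +².trans (·-comm _ x)
            (+².trans (distˡ x y z) (+².∙-cong (·-comm x y) (·-comm x z)))
        }
      ; *-comm = ·-comm
      }
    }
    where
    _·_ : Carrier × Carrier → Carrier × Carrier → Carrier × Carrier
    (a , b) · (c , d) = a * c + t * (b * d) , a * d + b * c + s * (b * d)

    ·-comm : ∀ x y → (x · y) +².≈ (y · x)
    ·-comm (a , b) (c , d) =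
      +-cong (*-comm a c) (*-congˡ (*-comm b d)) ,
      +-cong (trans (+-comm _ _) (+-cong (*-comm b c) (*-comm a d))) (*-congˡ (*-comm b d))

    0*-lemma : ∀ u d → u * (0# * d) ≈ 0#
    0*-lemma u d = trans (*-congˡ (zeroˡ d)) (zeroʳ u)

    identityˡ : ∀ x → ((1# , 0#) · x) +².≈ x
    identityˡ (c , d) =
      trans (+-cong (*-identityˡ c) (0*-lemma t d)) (+-identityʳ c) ,
      trans (+-cong (trans (+-cong (*-identityˡ d) (zeroˡ c)) (+-identityʳ d)) (0*-lemma s d)) (+-identityʳ d)

    distˡ : ∀ x y z → (x · (y +².∙ z)) +².≈ ((x · y) +².∙ (x · z))
    distˡ (a , b) (c , d) (e , f) =
      solve 7 (λ t a b c d e f →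
        (a :* (c :+ e) :+ t :* (b :* (d :+ f))) :=
        ((a :* c :+ t :* (b :* d)) :+ (a :* e :+ t :* (b :* f))))
        refl t a b c d e f ,
      solve 7 (λ s a b c d e f →
        (a :* (d :+ f) :+ b :* (c :+ e) :+ s :* (b :* (d :+ f))) :=
        ((a :* d :+ b :* c :+ s :* (b :* d)) :+ (a :* f :+ b :* e :+ s :* (b :* f))))
        refl s a b c d e f

  _[X]/⟨X²+X+1⟩ : CommutativeRing 0ℓ 0ℓ
  _[X]/⟨X²+X+1⟩ = quadratic (- 1#) (- 1#)

  Endomorphism : Set
  Endomorphism = Σ (Carrier → Carrier) (IsRingHomomorphism rawRing rawRing)

  -- The skew polynomial ring A[X;σ] has Xa = σ(a)X, so
  -- (a + bX)(c + dX) = ac + (ad + bσ(c))X modulo X².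
  _[X⨾_]/⟨X²⟩ : Endomorphism → Ring 0ℓ 0ℓ
  _[X⨾_]/⟨X²⟩ (σ , isHom) = record
    { Carrier = Carrier × Carrier
    ; _≈_ = +²._≈_
    ; _+_ = +²._∙_
    ; _*_ = λ (a , b) (c , d) → a * c , a * d + b * σ c
    ; -_  = +²._⁻¹
    ; 0#  = 0# , 0#
    ; 1#  = 1# , 0#
    ; isRing = record
      { +-isAbelianGroup = +².isAbelianGroup
      ; *-cong = λ (p , q) (p′ , q′) →
          *-cong p p′ , +-cong (*-cong p q′) (*-cong q (σ.⟦⟧-cong p′))
      ; *-assoc = λ (a , b) (c , d) (e , f) →
          *-assoc a c e ,
          trans
            (solve 7 (λ a b σc c d σe f →
              (a :* c :* f :+ (a :* d :+ b :* σc) :* σe) :=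
              (a :* (c :* f :+ d :* σe) :+ b :* (σc :* σe)))
              refl a b (σ c) c d (σ e) f)
            (+-congˡ (*-congˡ (sym (σ.*-homo c e))))
      ; *-identity =
          (λ (c , d) → *-identityˡ c ,
             trans (+-cong (*-identityˡ d) (zeroˡ (σ c))) (+-identityʳ d)) ,
          (λ (a , b) → *-identityʳ a ,
             trans (+-cong (zeroʳ a) (trans (*-congˡ σ.1#-homo) (*-identityʳ b))) (+-identityˡ b))
      ; distrib =
          (λ (a , b) (c , d) (e , f) → distribˡ a c e ,
             trans (+-congˡ (*-congˡ (σ.+-homo c e)))
               (solve 6 (λ a b d f σc σe →
                 (a :* (d :+ f) :+ b :* (σc :+ σe)) := ((a :* d :+ b :* σc) :+ (a :* f :+ b :* σe)))
                 refl a b d f (σ c) (σ e))) ,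
          (λ (a , b) (c , d) (e , f) → distribʳ a c e ,
             solve 6 (λ σa b c d e f →
               ((c :+ e) :* b :+ (d :+ f) :* σa) := ((c :* b :+ d :* σa) :+ (e :* b :+ f :* σa)))
               refl (σ a) b c d e f)
      }
    }
    where module σ = IsRingHomomorphism isHom

  identity : Endomorphism
  identity = id , Identity.isRingHomomorphism rawRing refl

  squaring : (∀ a → a + a ≈ 0#) → Endomorphism
  squaring char2 = (λ a → a * a) , record
    { isSemiringHomomorphism = record
      { isNearSemiringHomomorphism = record
        { +-isMonoidHomomorphism = record
          { isMagmaHomomorphism = record
            { isRelHomomorphism = record { cong = λ p → *-cong p p }
            ; homo = λ x y → trans
                (solve 2 (λ x y → ((x :+ y) :* (x :+ y)) := ((x :* x :+ y :* y) :+ (x :* y :+ x :* y))) refl x y)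
                (trans (+-congˡ (char2 (x * y))) (+-identityʳ _))
            }
          ; ε-homo = zeroˡ 0#
          }
        ; *-homo = λ x y → solve 2 (λ x y → ((x :* y) :* (x :* y)) := ((x :* x) :* (y :* y))) refl x y
        }
      ; 1#-homo = *-identityˡ 1#
      }
    ; -‿homo = λ x → trans (neg² x) (sym (unique (x * x)))
    }
    where
    unique : ∀ a → - a ≈ a
    unique a = trans (sym (+-identityʳ (- a)))
      (trans (+-congˡ (sym (char2 a)))
      (trans (sym (+-assoc (- a) a a))
      (trans (+-congʳ (-‿inverseˡ a)) (+-identityˡ a))))

    neg² : ∀ x → - x * - x ≈ x * x
    neg² x = *-cong (unique x) (unique x)

Finite : Setoid 0ℓ 0ℓ → Set
Finite S = ∃ λ n → Inverse S (≡.setoid (Fin n))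

Fin-finite : ∀ n → Finite (≡.setoid (Fin n))
Fin-finite n = n , IdentityFunction.inverse _

×-finite : ∀ {S T : Setoid 0ℓ 0ℓ} → Finite S → Finite T → Finite (S ×ₛ T)
×-finite (m , f) (n , g) = m ℕ.* n , Compose.inverse (f ×-inverse g)
  (Compose.inverse Pointwise-≡↔≡ (Symmetry.inverse (Fin.*↔× {m} {n})))

record FiniteRing : Set₁ where
  field
    ring   : Ring 0ℓ 0ℓ
    finite : Finite (Ring.setoid ring)

module _ (S : Setoid 0ℓ 0ℓ) where

  open Setoid S
  open Vec S using (_≋_; ≋-setoid; ≋-refl)

  private
    Searchable : Setoid 0ℓ 0ℓ → Set₁
    Searchable T = ∀ {P : Pred (Setoid.Carrier T) 0ℓ} →
      P Respects (Setoid._≈_ T) → Decidable P → Dec (∃ P)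

    vector-searchable : ∀ k → Searchable S → Searchable (≋-setoid k)
    vector-searchable zero _ resp P? =
      map′ (λ p → _ , p) (λ (f , p) → resp (λ ()) p) (P? (λ ()))
    vector-searchable (suc k) search {P} resp P? =
      map′ (λ (x , f , p) → x ∷ f , p)
           (λ (g , p) → g zero , g ∘ suc , resp (λ { zero → refl ; (suc i) → refl }) p)
           (search (λ x≈y (f , p) → f , resp (λ { zero → x≈y ; (suc i) → refl }) p)
             (λ x → vector-searchable k search
               (λ f≋g → resp (λ { zero → refl ; (suc i) → f≋g i })) (λ f → P? (x ∷ f))))

    finite-searchable : Finite S → Searchable S
    finite-searchable (n , e) resp P? =
      map′ (λ (i , p) → from i , p)
           (λ (x , p) → to x , resp (sym (strictlyInverseʳ x)) p)
           (Fin.any? (λ i → P? (from i)))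
      where open Inverse e

  any-vector? : ∀ k → Finite S → Searchable (≋-setoid k)
  any-vector? k fin = vector-searchable k (finite-searchable fin)

  all-vectors? : ∀ k → Finite S → {P : Pred (Fin k → Carrier) 0ℓ} →
    P Respects _≋_ → Decidable P → Dec (∀ v → P v)
  all-vectors? k fin resp P? =
    map′ (λ ¬∃ v → decidable-stable (P? v) (λ ¬p → ¬∃ (v , ¬p)))
         (λ all (v , ¬p) → ¬p (all v))
         (¬? (any-vector? k fin (λ v≋w ¬p p → ¬p (resp (λ i → sym (v≋w i)) p)) (λ v → ¬? (P? v))))

  finite-≟ : Finite S → ∀ x y → Dec (x ≈ y)
  finite-≟ (n , e) x y =
    map′ (λ p → trans (sym (strictlyInverseʳ x)) (trans (from-cong p) (strictlyInverseʳ y)))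
         to-cong (to x Fin.≟ to y)
    where open Inverse e

all-subsets? : ∀ {k} {P : Pred (Subset k) 0ℓ} → Decidable P → Dec (∀ S → P S)
all-subsets? P? =
  map′ (λ ¬∃ S → decidable-stable (P? S) (λ ¬p → ¬∃ (S , ¬p)))
       (λ all (S , ¬p) → ¬p (all S))
       (¬? (anySubset? (λ S → ¬? (P? S))))

module _ {R : Ring 0ℓ 0ℓ} (M : RightModule R 0ℓ 0ℓ) where

  open Ring R using (Carrier; _≈_; 0#)
  open RightModule M

  record Submodule : Set₁ where
    field
      members  : Pred Carrierᴹ 0ℓ
      resp-≈ᴹ  : members Respects _≈ᴹ_
      0-closed : members 0ᴹ
      +-closed : ∀ {x y} → members x → members y → members (x +ᴹ y)
      *-closed : ∀ {x} → members x → ∀ r → members (x *ᵣ r)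

  combination : ∀ {k} → (Fin k → Carrierᴹ) → (Fin k → Carrier) → Carrierᴹ
  combination b c = Sum.sum +ᴹ-commutativeMonoid (λ i → b i *ᵣ c i)

  Span : ∀ {k} → (Fin k → Carrierᴹ) → Pred Carrierᴹ 0ℓ
  Span b x = ∃ λ c → x ≈ᴹ combination b c

  Independent : ∀ {k} → Pred (Fin k → Carrierᴹ) 0ℓ
  Independent b = ∀ c → combination b c ≈ᴹ 0ᴹ → ∀ i → c i ≈ 0#

  FreeOfRank : ℕ → Pred Submodule 0ℓ
  FreeOfRank k N = ∃ λ (b : Fin k → Carrierᴹ) → Independent b × Submodule.members N ≐ Span b

module PHG (R : Ring 0ℓ 0ℓ) where

  R³ : RightModule R 0ℓ 0ℓ
  R³ = asRightModule ⊕ (asRightModule ⊕ asRightModule)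

  record Point : Set₁ where
    field
      submodule : Submodule R³
      free      : FreeOfRank R³ 1 submodule
    open Submodule submodule public

  record Line : Set₁ where
    field
      submodule : Submodule R³
      free      : FreeOfRank R³ 2 submodule
    open Submodule submodule public

  _≈ₚ_ : Point → Point → Set
  P ≈ₚ Q = Point.members P ≐ Point.members Q

  _on_ : Point → Line → Set
  P on L = Point.members P ⊆ Line.members L

  -- The bound on intersections with lines ranges over all sets S of
  -- points of the arc lying on L.
  record Arc (k n : ℕ) : Set₁ where
    field
      point    : Fin k → Point
      distinct : ∀ {i j} → i ≢ j → ¬ (point i ≈ₚ point j)
      bounded  : ∀ (L : Line) (S : Subset k) → (∀ {i} → i ∈ S → point i on L) → ∣ S ∣ ℕ.≤ n

IsLargest : ∀ {a} → Pred ℕ a → Pred ℕ a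
IsLargest P m = P m × (∀ k → P k → k ℕ.≤ m)

largest : ∀ {a} {P : Pred ℕ a} → Decidable P → P 0 → ∀ b → (∀ k → P k → k ℕ.≤ b) → ∃ (IsLargest P)
largest P? P0 zero    bound = 0 , P0 , bound
largest {P = P} P? P0 (suc b) bound with P? (suc b)
... | yes p = suc b , p , bound
... | no ¬p = largest P? P0 b λ k Pk → s≤s⁻¹ (ℕ.≤∧≢⇒< (bound k Pk) λ { ≡.refl → ¬p Pk })

module _ {R : Ring 0ℓ 0ℓ} (M : RightModule R 0ℓ 0ℓ) where

  open Ring R using (Carrier; _≈_; 0#; _+_; _*_)
  private module R = Ring R
  open RightModule M
  open Sum +ᴹ-commutativeMonoid using (sum; sum-cong-≋; sum-replicate-zero; ∑-distrib-+)
  open Vec ≈ᴹ-setoid using (_≋_)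

  private
    comb : ∀ {k} → (Fin k → Carrierᴹ) → (Fin k → Carrier) → Carrierᴹ
    comb = combination M

    comb-cong : ∀ {k} {b b′ : Fin k → Carrierᴹ} {c c′} → b ≋ b′ → (∀ i → c i ≈ c′ i) →
      comb b c ≈ᴹ comb b′ c′
    comb-cong p q = sum-cong-≋ (λ i → *ᵣ-cong (p i) (q i))

    sum-*ᵣ : ∀ {k} (f : Fin k → Carrierᴹ) r → sum f *ᵣ r ≈ᴹ sum (λ i → f i *ᵣ r)
    sum-*ᵣ {zero}  f r = *ᵣ-zeroˡ r
    sum-*ᵣ {suc k} f r = ≈ᴹ-trans (*ᵣ-distribʳ r (f zero) _) (+ᴹ-congˡ (sum-*ᵣ (f ∘ suc) r))

  span : ∀ {k} → (Fin k → Carrierᴹ) → Submodule M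
  span {k} b = record
    { members  = Span M b
    ; resp-≈ᴹ  = λ x≈y (c , p) → c , ≈ᴹ-trans (≈ᴹ-sym x≈y) p
    ; 0-closed = (λ _ → 0#) , ≈ᴹ-sym (≈ᴹ-trans (sum-cong-≋ (λ i → *ᵣ-zeroʳ (b i))) (sum-replicate-zero k))
    ; +-closed = λ (c , p) (d , q) → (λ i → c i + d i) ,
        ≈ᴹ-trans (+ᴹ-cong p q) (≈ᴹ-sym (≈ᴹ-trans
          (sum-cong-≋ (λ i → *ᵣ-distribˡ (b i) (c i) (d i))) (∑-distrib-+ (λ i → b i *ᵣ c i) (λ i → b i *ᵣ d i))))
    ; *-closed = λ (c , p) r → (λ i → c i * r) ,
        ≈ᴹ-trans (*ᵣ-congʳ p) (≈ᴹ-trans (sum-*ᵣ (λ i → b i *ᵣ c i) r)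
          (sum-cong-≋ (λ i → *ᵣ-assoc (b i) (c i) r)))
    }

  Span-cong : ∀ {k} {b b′ : Fin k → Carrierᴹ} → b ≋ b′ → Span M b ⊆ Span M b′
  Span-cong p (c , q) = c , ≈ᴹ-trans q (comb-cong p (λ _ → R.refl))

  Independent-resp : ∀ {k} → (Independent M {k}) Respects _≋_
  Independent-resp p ind c q = ind c (≈ᴹ-trans (comb-cong p (λ _ → R.refl)) q)

  module _ (finR : Finite R.setoid) (finM : Finite ≈ᴹ-setoid) where

    private
      _≟ᴹ_ = finite-≟ ≈ᴹ-setoid finM

    Span? : ∀ {k} (b : Fin k → Carrierᴹ) → Decidable (Span M b)
    Span? {k} b x = any-vector? R.setoid k finR
      (λ c≋d p → ≈ᴹ-trans p (comb-cong (λ _ → ≈ᴹ-refl) c≋d)) (λ c → x ≟ᴹ comb b c)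

    Independent? : ∀ {k} → Decidable (Independent M {k})
    Independent? {k} b = all-vectors? R.setoid k finR
      (λ c≋d h p i → R.trans (R.sym (c≋d i)) (h (≈ᴹ-trans (comb-cong (λ _ → ≈ᴹ-refl) c≋d) p) i))
      (λ c → (comb b c ≟ᴹ 0ᴹ) →-dec Fin.all? (λ i → finite-≟ R.setoid finR (c i) 0#))

    Span⊆? : ∀ {k l} (b : Fin k → Carrierᴹ) (b′ : Fin l → Carrierᴹ) → Dec (Span M b ⊆ Span M b′)
    Span⊆? b b′ = map′ (λ h {x} → h (λ _ → x)) (λ h v → h)
      (all-vectors? ≈ᴹ-setoid 1 finM {P = λ v → Span M b (v zero) → Span M b′ (v zero)}
        (λ v≋w h p → Submodule.resp-≈ᴹ (span b′) (v≋w zero)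
          (h (Submodule.resp-≈ᴹ (span b) (≈ᴹ-sym (v≋w zero)) p)))
        (λ v → Span? b (v zero) →-dec Span? b′ (v zero)))

module _ (R : FiniteRing) where

  open FiniteRing R
  open PHG ring
  private
    module R³ = RightModule R³
    V = R³.Carrierᴹ
    open Vec R³.≈ᴹ-setoid using (_≋_)

    finite³ : Finite R³.≈ᴹ-setoid
    finite³ = ×-finite finite (×-finite finite finite)

    gen : V → Fin 1 → V
    gen v _ = v

    gen-zero : (b : Fin 1 → V) → b ≋ gen (b zero)
    gen-zero b zero = R³.≈ᴹ-refl

    zero-gen : (b : Fin 1 → V) → gen (b zero) ≋ b
    zero-gen b zero = R³.≈ᴹ-refl

    -- An arc in terms of generators of its points and bases of the lines.
    Arc′ : ∀ k n → (Fin k → V) → Set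
    Arc′ k n g =
      (∀ i → Independent R³ (gen (g i))) ×
      (∀ i j → i ≢ j → ¬ (Span R³ (gen (g i)) ≐ Span R³ (gen (g j)))) ×
      (∀ (b : Fin 2 → V) → Independent R³ b → ∀ (S : Subset k) →
         (∀ i → i ∈ S → Span R³ (gen (g i)) ⊆ Span R³ b) → ∣ S ∣ ℕ.≤ n)

    Arc′-resp : ∀ {k n} → (Arc′ k n) Respects _≋_
    Arc′-resp p (ind , dist , bnd) =
      (λ i → Independent-resp R³ (λ _ → p i) (ind i)) ,
      (λ i j i≢j (s , t) → dist i j i≢j ((λ x → from j (s (to i x))) , (λ x → from i (t (to j x))))) ,
      (λ b indb S h → bnd b indb S (λ i i∈S x → h i i∈S (to i x)))
      where
      to : ∀ i {x} → _ → _
      to i {x} = Span-cong R³ (λ _ → p i) {x}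
      from : ∀ i {x} → _ → _
      from i {x} = Span-cong R³ (λ _ → R³.≈ᴹ-sym (p i)) {x}

    Arc′? : ∀ k n → Decidable (Arc′ k n)
    Arc′? k n g =
      Fin.all? (λ i → Independent? R³ finite finite³ (gen (g i))) ×-dec
      Fin.all? (λ i → Fin.all? (λ j → ¬? (i Fin.≟ j) →-dec
        ¬? (Span⊆? R³ finite finite³ (gen (g i)) (gen (g j)) ×-dec Span⊆? R³ finite finite³ (gen (g j)) (gen (g i))))) ×-dec
      all-vectors? R³.≈ᴹ-setoid 2 finite³
        (λ b≋b′ h ind S q → h (Independent-resp R³ (λ i → R³.≈ᴹ-sym (b≋b′ i)) ind) S
          (λ i i∈S x → Span-cong R³ (λ j → R³.≈ᴹ-sym (b≋b′ j)) (q i i∈S x)))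
        (λ b → Independent? R³ finite finite³ b →-dec
          all-subsets? (λ S →
            Fin.all? (λ i → (i ∈ˢ? S) →-dec Span⊆? R³ finite finite³ (gen (g i)) b) →-dec (∣ S ∣ ℕ.≤? n)))

    toArc : ∀ {k n} → ∃ (Arc′ k n) → Arc k n
    toArc (g , ind , dist , bnd) = record
      { point    = λ i → record
          { submodule = span R³ (gen (g i)) ; free = gen (g i) , ind i , id , id }
      ; distinct = λ i≢j (s , t) → dist _ _ i≢j (s , t)
      ; bounded  = λ L S h → let (b , indb , L⊆ , _) = Line.free L in
          bnd b indb S (λ i i∈S x → L⊆ (h i∈S x))
      }

    generator : ∀ {k n} → Arc k n → Fin k → V
    generator A i = proj₁ (Point.free (Arc.point A i)) zero

    module _ {k n} (A : Arc k n) (i : Fin k) where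
      private P = Arc.point A i

      generator-⊆ : Point.members P ⊆ Span R³ (gen (generator A i))
      generator-⊆ x = Span-cong R³ (gen-zero (proj₁ (Point.free P))) (proj₁ (proj₂ (proj₂ (Point.free P))) x)

      generator-⊇ : Span R³ (gen (generator A i)) ⊆ Point.members P
      generator-⊇ x = proj₂ (proj₂ (proj₂ (Point.free P))) (Span-cong R³ (zero-gen (proj₁ (Point.free P))) x)

    fromArc : ∀ {k n} → Arc k n → ∃ (Arc′ k n)
    fromArc A = generator A ,
      (λ i → Independent-resp R³ (gen-zero (proj₁ (Point.free (point i)))) (proj₁ (proj₂ (Point.free (point i))))) ,
      (λ i j i≢j (s , t) → distinct i≢j
        ((λ x → generator-⊇ A j (s (generator-⊆ A i x))) ,
         (λ x → generator-⊇ A i (t (generator-⊆ A j x))))) ,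
      (λ b indb S h → bounded (record { submodule = span R³ b ; free = b , indb , id , id }) S
        (λ {i} i∈S x → h i i∈S (generator-⊆ A i x)))
      where open Arc A

    Arc? : ∀ k n → Dec (Arc k n)
    Arc? k n = map′ toArc fromArc
      (any-vector? R³.≈ᴹ-setoid k finite³ Arc′-resp (Arc′? k n))

    Arc-bound : ∀ {k n} → Arc k n → k ℕ.≤ proj₁ finite³
    Arc-bound {k} A = Fin.injective⇒≤ injective
      where
      open Inverse (proj₂ finite³)
      index = λ (i : Fin k) → to (generator A i)

      same : ∀ i j → index i ≡ index j → generator A i R³.≈ᴹ generator A j
      same i j eq = R³.≈ᴹ-trans (R³.≈ᴹ-sym (strictlyInverseʳ _))
        (R³.≈ᴹ-trans (from-cong eq) (strictlyInverseʳ _))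

      injective : ∀ {i j} → index i ≡ index j → i ≡ j
      injective {i} {j} eq = decidable-stable (i Fin.≟ j) λ i≢j → Arc.distinct A i≢j
        ( (λ x → generator-⊇ A j (Span-cong R³ (λ _ → same i j eq) (generator-⊆ A i x)))
        , (λ x → generator-⊇ A i (Span-cong R³ (λ _ → same j i (≡.sym eq)) (generator-⊆ A j x))))

    emptyArc : ∀ n → Arc 0 n
    emptyArc n = record
      { point = λ () ; distinct = λ {i} → ⊥-elim (Fin.¬Fin0 i) ; bounded = λ _ → λ { [] _ → z≤n } }

  -- Finiteness of R makes the existence of arcs decidable.  The search is
  -- abstract so that the type checker never runs it; m-isLargest
  -- characterises its result.
  abstract
    largestArc : ∀ n → ∃ (IsLargest (λ k → Arc k n))
    largestArc n = largest (λ k → Arc? k n) (emptyArc n) (proj₁ finite³) (λ k → Arc-bound)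

  m : ℕ → ℕ
  m n = proj₁ (largestArc n)

  m-isLargest : ∀ n → IsLargest (λ k → Arc k n) (m n)
  m-isLargest n = proj₂ (largestArc n)

ℤ₄ : CommutativeRing 0ℓ 0ℓ
ℤ₄ = ℤ/ 4

𝔽₄ : CommutativeRing 0ℓ 0ℓ
𝔽₄ = (ℤ/ 2) [X]/⟨X²+X+1⟩

frobenius : Endomorphism 𝔽₄
frobenius = squaring 𝔽₄ λ (a , b) → double a , double b
  where
  open CommutativeRing (ℤ/ 2)
  double : ∀ a → a + a ≈ 0#
  double zero       = ≡.refl
  double (suc zero) = ≡.refl

𝔾₄ : FiniteRing
𝔾₄ = record
  { ring   = CommutativeRing.ring (ℤ₄ [X]/⟨X²+X+1⟩)
  ; finite = ×-finite (Fin-finite 4) (Fin-finite 4)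
  }

𝔽₄-finite : Finite (CommutativeRing.setoid 𝔽₄)
𝔽₄-finite = ×-finite (Fin-finite 2) (Fin-finite 2)

𝕊₄ : FiniteRing
𝕊₄ = record
  { ring   = 𝔽₄ [X⨾ identity 𝔽₄ ]/⟨X²⟩
  ; finite = ×-finite 𝔽₄-finite 𝔽₄-finite
  }

𝕋₄ : FiniteRing
𝕋₄ = record
  { ring   = 𝔽₄ [X⨾ frobenius ]/⟨X²⟩
  ; finite = ×-finite 𝔽₄-finite 𝔽₄-finite
  }

{-# OPTIONS --safe #-}
module Submission where

-- Let u(x) be the number of points of an (84,6)-arc in the neighbour class x and, for
-- a class L of neighbouring lines, let C(L) be the sum of (g - 4)² over its 16 lines,
-- g being the number of points of the arc on the line.  Double counting gives
-- Σ C(L) = 21·64 + 3 Σ (u(x) - 4)².  If 2 ≤ g ≤ 6 on all lines of L then C(L) ≤ 64.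
-- The lines of L are the points of AG(2,4), and g is a sum of five functions, each
-- constant on the lines of one parallel class; a search over such functions bounds C(L)
-- when g ≤ 1 occurs, and determines the line classes through a class with u(x) ≥ 5,
-- where counting leaves almost no freedom.  The geometry of PG(2,4) then forces u(x) = 4
-- and C(L) = 64 throughout, so that every line carries 2 or 6 points.
--
-- In an (85,6)-arc the deletion of any point would have to leave u = 4 everywhere, which
-- is absurd.  Over 𝕊₄ and 𝕋₄ the 21 lines of the subplane over 𝔽₄ carry 84 + 4t points,
-- counted with multiplicity, if t points of the arc belong to the subplane; but 21
-- numbers congruent to 2 modulo 4 add up to 2 modulo 4.

-- The aim throughout is C(L) ≤ 64 for all L, since the identity then leaves Σ (u(x) - 4)² = 0. A
-- violation needs a line with at most one point, and the line classes through a class with u(x) ≥ 5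
-- never violate the bound. So such a class x helps twice: it keeps its own five line classes light,
-- and the sizes found on them restrict the sizes on the sixteen others. For u(x) = 6 this settles
-- all sixteen. For u(x) = 5 some of them may exceed 64, and their surplus is weighed against the 28
-- by which each line class with sizes (5, 4, 4, 4, 4) falls short of 64. Consider the four line
-- classes of total size 21 through x. If none has sizes (5, 5, 5, 3, 3), all sixteen are light; if
-- one, two or three have, the balance fails; if all four have, at every x of size 5, then these x
-- form nine points of PG(2,4) that meet every line in 1 or 3 points, so that again nothing exceeds
-- 64. The search stays small because a class of 5 or 6 points splits in every direction as (2, 2,
-- 1, 0) or (2, 2, 2, 0).

module Prelude where

  open import Data.Bool.Base public using (Bool; true; false; if_then_else_; _∧_; _∨_; T)
  open import Data.Nat.Base public using (ℕ; zero; suc; _+_; _*_; _∸_; _⊔_; _≤_; _<_; z≤n; s≤s; _≡ᵇ_; _≤ᵇ_; ∣_-_∣)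
  open import Data.Fin.Base public using (Fin; zero; suc; punchIn; punchOut)
  open import Data.Product.Base public using (_×_; _,_; proj₁; proj₂; ∃; ∃₂)
  open import Data.Sum.Base public using (_⊎_; inj₁; inj₂; [_,_]′)
  open import Data.Empty public using (⊥; ⊥-elim)
  open import Function.Base public using (_∘_; id)
  open import Relation.Nullary public using (¬_; Dec; yes; no)
  open import Data.Fin.Patterns public
  open import Relation.Binary.PropositionalEquality public

-- Finite sums of natural numbers and exhaustive checks.

module Sums where

  open Prelude
  import Data.Nat.Properties as ℕ
  open import Data.Nat.Tactic.RingSolver using (solve-∀)
  open import Algebra.Properties.Semiring.Sum ℕ.+-*-semiring using (sum; sum-cong-≗; sum-replicate-zero; ∑-distrib-+; ∑-comm; *-distribˡ-sum; *-distribʳ-sum)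

  δ : ∀ {n} → Fin n → Fin n → ℕ
  δ zero    zero    = 1
  δ zero    (suc j) = 0
  δ (suc i) zero    = 0
  δ (suc i) (suc j) = δ i j

  δ-refl : ∀ {n} (i : Fin n) → δ i i ≡ 1
  δ-refl zero    = refl
  δ-refl (suc i) = δ-refl i

  δ-≢ : ∀ {n} {i j : Fin n} → i ≢ j → δ i j ≡ 0
  δ-≢ {i = zero}  {zero}  p = ⊥-elim (p refl)
  δ-≢ {i = zero}  {suc j} p = refl
  δ-≢ {i = suc i} {zero}  p = refl
  δ-≢ {i = suc i} {suc j} p = δ-≢ (p ∘ cong suc)

  δ-sym : ∀ {n} (i j : Fin n) → δ i j ≡ δ j i
  δ-sym zero    zero    = refl
  δ-sym zero    (suc j) = refl
  δ-sym (suc i) zero    = refl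
  δ-sym (suc i) (suc j) = δ-sym i j

  δ≤1 : ∀ {n} (i j : Fin n) → δ i j ≤ 1
  δ≤1 zero    zero    = s≤s z≤n
  δ≤1 zero    (suc j) = z≤n
  δ≤1 (suc i) zero    = z≤n
  δ≤1 (suc i) (suc j) = δ≤1 i j

  δ-true : ∀ {n} (i j : Fin n) → 1 ≤ δ i j → i ≡ j
  δ-true zero    zero    _ = refl
  δ-true (suc i) (suc j) p = cong suc (δ-true i j p)

  opaque

    -- Opaque, so that sums are handled by the laws below; `∑≡sum` leads back to `sum` wherever a
    -- finite check is to be evaluated.
    ∑ : ∀ {n} → (Fin n → ℕ) → ℕ
    ∑ = sum

    ∑≡sum : ∀ {n} (f : Fin n → ℕ) → ∑ f ≡ sum f
    ∑≡sum f = refl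

    ∑-suc : ∀ {n} (f : Fin (suc n) → ℕ) → ∑ f ≡ f zero + ∑ (f ∘ suc)
    ∑-suc f = refl

    ∑-cong : ∀ {n} {f g : Fin n → ℕ} → (∀ i → f i ≡ g i) → ∑ f ≡ ∑ g
    ∑-cong = sum-cong-≗

    ∑-mono : ∀ {n} {f g : Fin n → ℕ} → (∀ i → f i ≤ g i) → ∑ f ≤ ∑ g
    ∑-mono {zero}  h = z≤n
    ∑-mono {suc n} h = ℕ.+-mono-≤ (h zero) (∑-mono (h ∘ suc))

    ≤-∑ : ∀ {n} (f : Fin n → ℕ) i → f i ≤ ∑ f
    ≤-∑ f zero    = ℕ.m≤m+n _ _
    ≤-∑ f (suc i) = ℕ.≤-trans (≤-∑ (f ∘ suc) i) (ℕ.m≤n+m _ _)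

    ∑-zero : ∀ {n} {f : Fin n → ℕ} → (∀ i → f i ≡ 0) → ∑ f ≡ 0
    ∑-zero {n} h = trans (∑-cong h) (sum-replicate-zero n)

    ∑-const : ∀ n c → ∑ {n} (λ _ → c) ≡ n * c
    ∑-const zero    c = refl
    ∑-const (suc n) c = cong (c +_) (∑-const n c)

    ∑-+ : ∀ {n} (f g : Fin n → ℕ) → ∑ (λ i → f i + g i) ≡ ∑ f + ∑ g
    ∑-+ = ∑-distrib-+

    ∑-*ˡ : ∀ {n} c (f : Fin n → ℕ) → ∑ (λ i → c * f i) ≡ c * ∑ f
    ∑-*ˡ c f = sym (*-distribˡ-sum c f)

    ∑-*ʳ : ∀ {n} c (f : Fin n → ℕ) → ∑ (λ i → f i * c) ≡ ∑ f * c
    ∑-*ʳ c f = sym (*-distribʳ-sum c f)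

    ∑-swap : ∀ {m n} (f : Fin m → Fin n → ℕ) → ∑ (λ i → ∑ (f i)) ≡ ∑ (λ j → ∑ (λ i → f i j))
    ∑-swap = ∑-comm

    ∑-δ : ∀ {n} (i : Fin n) (f : Fin n → ℕ) → ∑ (λ j → δ i j * f j) ≡ f i
    ∑-δ {suc n} zero f = trans (cong₂ _+_ (ℕ.*-identityˡ (f zero)) (sum-replicate-zero n)) (ℕ.+-identityʳ _)
    ∑-δ (suc i) f = ∑-δ i (f ∘ suc)

  ∑-count : ∀ {n k} (e : Fin n → Fin k) (f : Fin k → ℕ) →
    ∑ (f ∘ e) ≡ ∑ (λ y → ∑ (λ i → δ (e i) y) * f y)
  ∑-count e f = begin
    ∑ (f ∘ e) ≡⟨ ∑-cong (λ i → sym (∑-δ (e i) f)) ⟩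
    ∑ (λ i → ∑ (λ y → δ (e i) y * f y)) ≡⟨ ∑-swap _ ⟩
    ∑ (λ y → ∑ (λ i → δ (e i) y * f y)) ≡⟨ ∑-cong (λ y → ∑-*ʳ (f y) (λ i → δ (e i) y)) ⟩
    ∑ (λ y → ∑ (λ i → δ (e i) y) * f y) ∎
    where open ≡-Reasoning

  ∑-product : ∀ {m n} (f : Fin m → ℕ) (g : Fin n → ℕ) → ∑ f * ∑ g ≡ ∑ (λ i → ∑ (λ j → f i * g j))
  ∑-product f g = trans (sym (∑-*ʳ (∑ g) f)) (∑-cong λ i → sym (∑-*ˡ (f i) g))

  ∑-cong₂ : ∀ {m n} {f g : Fin m → Fin n → ℕ} → (∀ i j → f i j ≡ g i j) →
    ∑ (λ i → ∑ (f i)) ≡ ∑ (λ i → ∑ (g i))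
  ∑-cong₂ h = ∑-cong λ i → ∑-cong (h i)

  -- Summing over L first leaves only the Gram matrix of A and B. The moments in AG(2,4), the counts
  -- in PG(2,4) and the pairs of points in a neighbour class are all obtained in this way.
  ∑-gram : ∀ {b m n} (A : Fin b → Fin m → ℕ) (B : Fin b → Fin n → ℕ) (f : Fin m → ℕ) (g : Fin n → ℕ) →
    ∑ (λ L → ∑ (λ x → A L x * f x) * ∑ (λ y → B L y * g y)) ≡
    ∑ (λ x → ∑ (λ y → ∑ (λ L → A L x * B L y) * (f x * g y)))
  ∑-gram A B f g = begin
    ∑ (λ L → ∑ (λ x → A L x * f x) * ∑ (λ y → B L y * g y))
      ≡⟨ ∑-cong (λ L → ∑-product (λ x → A L x * f x) (λ y → B L y * g y)) ⟩
    ∑ (λ L → ∑ (λ x → ∑ (λ y → (A L x * f x) * (B L y * g y))))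
      ≡⟨ ∑-swap _ ⟩
    ∑ (λ x → ∑ (λ L → ∑ (λ y → (A L x * f x) * (B L y * g y))))
      ≡⟨ ∑-cong (λ x → ∑-swap _) ⟩
    ∑ (λ x → ∑ (λ y → ∑ (λ L → (A L x * f x) * (B L y * g y))))
      ≡⟨ ∑-cong₂ (λ x y → trans (∑-cong λ L → shuffle (A L x) (f x) (B L y) (g y))
           (∑-*ʳ (f x * g y) (λ L → A L x * B L y))) ⟩
    ∑ (λ x → ∑ (λ y → ∑ (λ L → A L x * B L y) * (f x * g y))) ∎
    where
    open ≡-Reasoning
    shuffle : ∀ a b c d → (a * b) * (c * d) ≡ (a * c) * (b * d)
    shuffle = solve-∀

  -- If any two distinct points lie on exactly one common block and every point
  -- on five, then the Gram matrix of the incidence matrix is J + 4I.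
  ∑-design : ∀ {b n} (A : Fin b → Fin n → ℕ) → (∀ x y → ∑ (λ L → A L x * A L y) ≡ 1 + 4 * δ x y) →
    ∀ (f g : Fin n → ℕ) →
    ∑ (λ L → ∑ (λ x → A L x * f x) * ∑ (λ y → A L y * g y)) ≡ ∑ f * ∑ g + 4 * ∑ (λ x → f x * g x)
  ∑-design A gram f g = begin
    _ ≡⟨ ∑-gram A A f g ⟩
    ∑ (λ x → ∑ (λ y → ∑ (λ L → A L x * A L y) * (f x * g y)))
      ≡⟨ ∑-cong₂ (λ x y → trans (cong (_* (f x * g y)) (gram x y)) (expand (δ x y) (f x) (g y))) ⟩
    ∑ (λ x → ∑ (λ y → f x * g y + 4 * f x * (δ x y * g y)))
      ≡⟨ ∑-cong (λ x → trans (∑-+ _ _)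
           (cong₂ _+_ refl (trans (∑-*ˡ (4 * f x) (λ y → δ x y * g y)) (cong (4 * f x *_) (∑-δ x g))))) ⟩
    ∑ (λ x → ∑ (λ y → f x * g y) + 4 * f x * g x)
      ≡⟨ ∑-+ _ _ ⟩
    ∑ (λ x → ∑ (λ y → f x * g y)) + ∑ (λ x → 4 * f x * g x)
      ≡⟨ cong₂ _+_ (sym (∑-product f g))
           (trans (∑-cong λ x → ℕ.*-assoc 4 (f x) (g x)) (∑-*ˡ 4 (λ x → f x * g x))) ⟩
    ∑ f * ∑ g + 4 * ∑ (λ x → f x * g x) ∎
    where
    open ≡-Reasoning
    expand : ∀ d a b → (1 + 4 * d) * (a * b) ≡ a * b + 4 * a * (d * b)
    expand = solve-∀

  ∑-reindex : ∀ {n} (e : Fin n → Fin n) → (∀ y → ∑ (λ i → δ (e i) y) ≡ 1) → ∀ f → ∑ (f ∘ e) ≡ ∑ f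
  ∑-reindex e bij f = trans (∑-count e f)
    (∑-cong λ y → trans (cong (_* f y) (bij y)) (ℕ.*-identityˡ (f y)))

  allF : ∀ {n} → (Fin n → Bool) → Bool
  allF {zero}  p = true
  allF {suc n} p = if p zero then allF (p ∘ suc) else false

  allF-sound : ∀ {n} (p : Fin n → Bool) → allF p ≡ true → ∀ i → p i ≡ true
  allF-sound {suc n} p eq i with p zero in p0
  allF-sound {suc n} p eq zero    | true = p0
  allF-sound {suc n} p eq (suc i) | true = allF-sound (p ∘ suc) eq i

  ≡ᵇ-sound : ∀ m n → (m ≡ᵇ n) ≡ true → m ≡ n
  ≡ᵇ-sound m n eq = ℕ.≡ᵇ⇒≡ m n (subst T (sym eq) _)

  ≤ᵇ-sound : ∀ m n → (m ≤ᵇ n) ≡ true → m ≤ n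
  ≤ᵇ-sound m n eq = ℕ.≤ᵇ⇒≤ m n (subst T (sym eq) _)

  -- Records rather than equations, so that the predicates can be inferred.
  record Check₁ {a} (p : Fin a → Bool) : Set where
    constructor by
    field holds : allF p ≡ true

  record Check₂ {a b} (p : Fin a → Fin b → Bool) : Set where
    constructor by
    field holds : allF (λ i → allF (p i)) ≡ true

  record Check₃ {a b c} (p : Fin a → Fin b → Fin c → Bool) : Set where
    constructor by
    field holds : allF (λ i → allF λ j → allF (p i j)) ≡ true

  record Check₄ {a b c d} (p : Fin a → Fin b → Fin c → Fin d → Bool) : Set where
    constructor by
    field holds : allF (λ i → allF λ j → allF λ k → allF (p i j k)) ≡ true

  check₁ : ∀ {a} {p : Fin a → Bool} → Check₁ p → ∀ i → p i ≡ true
  check₁ (by h) = allF-sound _ h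

  check₂ : ∀ {a b} {p : Fin a → Fin b → Bool} → Check₂ p → ∀ i j → p i j ≡ true
  check₂ (by h) i = allF-sound _ (allF-sound _ h i)

  check₃ : ∀ {a b c} {p : Fin a → Fin b → Fin c → Bool} → Check₃ p → ∀ i j k → p i j k ≡ true
  check₃ {p = p} (by h) i j = allF-sound _ (allF-sound (λ j → allF (p i j)) (allF-sound (λ i → allF λ j → allF (p i j)) h i) j)

  check₄ : ∀ {a b c d} {p : Fin a → Fin b → Fin c → Fin d → Bool} → Check₄ p → ∀ i j k l → p i j k l ≡ true
  check₄ {p = p} (by h) i = check₃ {p = p i} (by (allF-sound (λ i → allF λ j → allF λ k → allF (p i j k)) h i))

  infix 4 _==_

  _==_ : ∀ {n} → Fin n → Fin n → Bool
  i == j = δ i j ≡ᵇ 1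

  ==-sound : ∀ {n} {i j : Fin n} → (i == j) ≡ true → i ≡ j
  ==-sound {i = i} {j} eq = δ-true i j (ℕ.≤-reflexive (sym (≡ᵇ-sound (δ i j) 1 eq)))

  permutes : ∀ {n} → (Fin n → Fin n) → Fin n → Bool
  permutes e y = sum (λ i → δ (e i) y) ≡ᵇ 1

  bijective : ∀ {n} (e : Fin n → Fin n) → (∀ y → permutes e y ≡ true) → ∀ y → ∑ (λ i → δ (e i) y) ≡ 1
  bijective e ok y = trans (∑≡sum _) (≡ᵇ-sound _ 1 (ok y))

-- AG(2,4) as the set of lines of a neighbour class, and its symmetries.

module AffinePlane where

  open Prelude hiding (trans)
  open Sums
  import Data.Nat.Properties as ℕ
  open import Data.Fin.Base using (combine; remQuot)
  open import Data.List.Base using (List; []; _∷_; _++_; _∷ʳ_; tabulate)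
  open import Data.List.Properties using (tabulate-cong; ∷ʳ-++)
  open import Data.List.Relation.Binary.Permutation.Propositional using (_↭_; refl; prep; swap; trans)
  import Relation.Binary.PropositionalEquality as ≡

  -- 𝔽₄ = {0, 1, ω, ω²}, numbered in this order.
  F : Set
  F = Fin 4

  infixl 6 _⊕_
  infixl 7 _⊗_

  _⊕_ : F → F → F
  0F ⊕ b  = b
  a  ⊕ 0F = a
  1F ⊕ 1F = 0F
  1F ⊕ 2F = 3F
  1F ⊕ 3F = 2F
  2F ⊕ 1F = 3F
  2F ⊕ 2F = 0F
  2F ⊕ 3F = 1F
  3F ⊕ 1F = 2F
  3F ⊕ 2F = 1F
  3F ⊕ 3F = 0F

  _⊗_ : F → F → F
  0F ⊗ b  = 0F
  1F ⊗ b  = b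
  2F ⊗ 0F = 0F
  2F ⊗ 1F = 2F
  2F ⊗ 2F = 3F
  2F ⊗ 3F = 1F
  3F ⊗ 0F = 0F
  3F ⊗ 1F = 3F
  3F ⊗ 2F = 1F
  3F ⊗ 3F = 2F

  -- As a³ = 1 for a ≠ 0, squaring is not only the Frobenius automorphism but also inversion of
  -- nonzero elements and the square root.
  frob : F → F
  frob a = a ⊗ a

  pt₁ pt₂ : Fin 16 → F
  pt₁ m = proj₁ (remQuot 4 m)
  pt₂ m = proj₂ (remQuot {4} 4 m)

  -- The five parallel classes of AG(2,4): form j m names the line of the j-th
  -- class through m.
  form : Fin 5 → F → F → F
  form 0F a b = a
  form 1F a b = b
  form 2F a b = a ⊕ b
  form 3F a b = a ⊕ 2F ⊗ b
  form 4F a b = a ⊕ 3F ⊗ b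

  std : Fin 5 → Fin 16 → F
  std j m = form j (pt₁ m) (pt₂ m)

  -- `W j s` is the number of points of the arc in the segment s of the j-th of the five point
  -- classes; the lines of the j-th parallel class of AG(2,4) stand for these segments.
  Weights : Set
  Weights = Fin 5 → F → ℕ

  load : Weights → Fin 16 → ℕ
  load W m = ∑ λ j → W j (std j m)

  squares : (F → ℕ) → ℕ
  squares r = ∑ λ s → r s * r s

  -- For entries at most 2, the sums of squares 9 and 12 single out the distributions (2, 2, 1, 0)
  -- and (2, 2, 2, 0) regardless of their order.
  record Regular (r : F → ℕ) : Set where
    field
      ≤2   : 5 ≤ ∑ r → ∀ s → r s ≤ 2
      five : ∑ r ≡ 5 → squares r ≡ 9
      six  : ∑ r ≡ 6 → squares r ≡ 12

  -- The distribution of an arc over the sixteen lines of a neighbour class: us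
  -- lists the sizes of the five point classes, and some line has at most t points.
  record Arrangement (t : ℕ) (us : List ℕ) (S : ℕ) : Set where
    field
      W       : Weights
      sizes   : tabulate (λ j → ∑ (W j)) ≡ us
      load≤6  : ∀ m → load W m ≤ 6
      regular : ∀ j → Regular (W j)
      total   : ∑ (λ j → squares (W j)) ≡ S
      line    : Fin 16
      load≤t  : load W line ≤ t

  module Symmetry
    (σ : Fin 5 → Fin 5) (τ : Fin 16 → Fin 16) (π : Fin 5 → F → F)
    (σ-bij : ∀ y → ∑ (λ j → δ (σ j) y) ≡ 1)
    (π-bij : ∀ j y → ∑ (λ s → δ (π j s) y) ≡ 1)
    (compatible : ∀ j m → std (σ j) (τ m) ≡ π j (std j m)) where

    module _ (W : Weights) where

      W′ : Weights
      W′ j s = W (σ j) (π j s)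

      load′ : ∀ m → load W′ m ≡ load W (τ m)
      load′ m = ≡.trans (∑-cong λ j → cong (W (σ j)) (sym (compatible j m)))
        (∑-reindex σ σ-bij (λ j → W j (std j (τ m))))

      row : ∀ (f : ℕ → ℕ) j → ∑ (λ s → f (W′ j s)) ≡ ∑ (λ s → f (W (σ j) s))
      row f j = ∑-reindex (π j) (π-bij j) (λ s → f (W (σ j) s))

      regular′ : ∀ j → Regular (W (σ j)) → Regular (W′ j)
      regular′ j r = record
        { ≤2   = λ h s → Regular.≤2 r (subst (5 ≤_) (row id j) h) (π j s)
        ; five = λ h → ≡.trans (row (λ x → x * x) j) (Regular.five r (≡.trans (sym (row id j)) h))
        ; six  = λ h → ≡.trans (row (λ x → x * x) j) (Regular.six r (≡.trans (sym (row id j)) h))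
        }

    transform : ∀ {t us S} (A : Arrangement t us S) m → τ m ≡ Arrangement.line A →
      Arrangement t (tabulate (λ j → ∑ (Arrangement.W A (σ j)))) S
    transform {t} {S = S} A m eq = record
      { W       = W′ W
      ; sizes   = tabulate-cong (row W id)
      ; load≤6  = λ n → subst (_≤ 6) (sym (load′ W n)) (load≤6 (τ n))
      ; regular = λ j → regular′ W j (regular (σ j))
      ; total   = ≡.trans (∑-cong (row W (λ x → x * x))) (≡.trans (∑-reindex σ σ-bij (λ j → squares (W j))) total)
      ; line    = m
      ; load≤t  = subst (_≤ t) (sym (≡.trans (load′ W m) (cong (load W) eq))) load≤t
      }
      where open Arrangement A

  module Swap (σ : Fin 5 → Fin 5) (τ : Fin 16 → Fin 16) (c : Fin 5 → F)
    (σ-ok : Check₁ (permutes σ)) (π-ok : Check₂ (λ j → permutes (λ s → c j ⊗ frob s)))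
    (compatible : Check₂ (λ j m → std (σ j) (τ m) == c j ⊗ frob (std j m)))
    (involutive : Check₁ (λ m → τ (τ m) == m)) where

    open Symmetry σ τ (λ j s → c j ⊗ frob s) (bijective σ (check₁ σ-ok))
      (λ j → bijective (λ s → c j ⊗ frob s) (check₂ π-ok j))
      (λ j m → ==-sound (check₂ compatible j m))

    apply : ∀ {t us S} (A : Arrangement t us S) →
      Arrangement t (tabulate (λ j → ∑ (Arrangement.W A (σ j)))) S
    apply A = transform A (τ (Arrangement.line A)) (==-sound (check₁ involutive _))

  -- Odd permutations of the five directions need the Frobenius automorphism:
  -- PGL(2,4) acts on them as the alternating group.
  semilinear : (p q r s : F) → Fin 16 → Fin 16
  semilinear p q r s m = combine (p ⊗ a ⊕ q ⊗ b) (r ⊗ a ⊕ s ⊗ b)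
    where
    a = frob (pt₁ m)
    b = frob (pt₂ m)

  σ₀ σ₁ σ₂ σ₃ : Fin 5 → Fin 5
  σ₀ 0F = 1F
  σ₀ 1F = 0F
  σ₀ j  = j
  σ₁ 1F = 2F
  σ₁ 2F = 1F
  σ₁ j  = j
  σ₂ 2F = 3F
  σ₂ 3F = 2F
  σ₂ j  = j
  σ₃ 3F = 4F
  σ₃ 4F = 3F
  σ₃ j  = j

  -- A semilinear map sends the normalised form of a direction to a multiple of another one; `c`
  -- records the factor.
  c₀ c₁ c₂ c₃ : Fin 5 → F
  c₀ 3F = 2F
  c₀ 4F = 3F
  c₀ _  = 1F
  c₁ 3F = 3F
  c₁ 4F = 2F
  c₁ _  = 1F
  c₂ 1F = 3F
  c₂ _  = 1F
  c₃ _  = 1F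

  module Swap₀ = Swap σ₀ (semilinear 0F 1F 1F 0F) c₀ (by refl) (by refl) (by refl) (by refl)
  module Swap₁ = Swap σ₁ (semilinear 1F 0F 1F 1F) c₁ (by refl) (by refl) (by refl) (by refl)
  module Swap₂ = Swap σ₂ (semilinear 1F 0F 0F 3F) c₂ (by refl) (by refl) (by refl) (by refl)
  module Swap₃ = Swap σ₃ (semilinear 1F 0F 0F 1F) c₃ (by refl) (by refl) (by refl) (by refl)

  -- The four transpositions of neighbouring directions generate all permutations of the five, so
  -- the search can fix one order of the sizes.
  swap-adjacent : ∀ {t S} xs {x y ys} → Arrangement t (xs ++ x ∷ y ∷ ys) S → Arrangement t (xs ++ y ∷ x ∷ ys) S
  swap-adjacent xs A = go xs A (Arrangement.sizes A)
    where
    go : ∀ {t us S} xs {x y ys} (A : Arrangement t us S) →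
      tabulate (λ j → ∑ (Arrangement.W A j)) ≡ xs ++ x ∷ y ∷ ys → Arrangement t (xs ++ y ∷ x ∷ ys) S
    go []                      A refl = Swap₀.apply A
    go (_ ∷ [])                A refl = Swap₁.apply A
    go (_ ∷ _ ∷ [])            A refl = Swap₂.apply A
    go (_ ∷ _ ∷ _ ∷ [])        A refl = Swap₃.apply A
    go (_ ∷ _ ∷ _ ∷ _ ∷ [])    A ()
    go (_ ∷ _ ∷ _ ∷ _ ∷ _ ∷ []) A ()
    go (_ ∷ _ ∷ _ ∷ _ ∷ _ ∷ _ ∷ _) A ()

  rearrange : ∀ {t S us vs} → us ↭ vs → Arrangement t us S → Arrangement t vs S
  rearrange {t} {S} = go []
    where
    go : ∀ xs {us vs} → us ↭ vs → Arrangement t (xs ++ us) S → Arrangement t (xs ++ vs) S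
    go xs refl A = A
    go xs (prep {us} {vs} x p) A = subst (λ zs → Arrangement t zs S) (∷ʳ-++ xs x vs)
      (go (xs ∷ʳ x) p (subst (λ zs → Arrangement t zs S) (sym (∷ʳ-++ xs x us)) A))
    go xs (swap {us} {vs} x y p) A = swap-adjacent xs (subst (λ zs → Arrangement t zs S) (eq vs)
      (go ((xs ∷ʳ x) ∷ʳ y) p (subst (λ zs → Arrangement t zs S) (sym (eq us)) A)))
      where
      eq : ∀ zs → ((xs ∷ʳ x) ∷ʳ y) ++ zs ≡ xs ++ x ∷ y ∷ zs
      eq zs = ≡.trans (∷ʳ-++ (xs ∷ʳ x) y zs) (∷ʳ-++ xs x (y ∷ zs))
    go xs (trans p q) A = go xs q (go xs p A)

  translate : Fin 16 → Fin 16 → Fin 16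
  translate n m = combine (pt₁ m ⊕ pt₁ n) (pt₂ m ⊕ pt₂ n)

  record Centred (t : ℕ) (us : List ℕ) (S : ℕ) : Set where
    field
      arrangement : Arrangement t us S
      centred     : Arrangement.line arrangement ≡ 0F

  -- A translation permutes the segments within each direction and preserves the sizes. With the
  -- sparse line at the origin, the search has to compare only one load with t.
  centre : ∀ {t us S} → Arrangement t us S → Centred t us S
  centre {t} {S = S} A = subst (λ us → Centred t us S) (Arrangement.sizes A)
    record { arrangement = transform A 0F (==-sound (check₁ origin n)) ; centred = refl }
    where
    n = Arrangement.line A
    origin : Check₁ (λ n → translate n 0F == n)
    origin = by refl
    shift : Check₂ (λ a → permutes (_⊕ a))
    shift = by refl
    linear : Check₃ (λ n j m → std j (translate n m) == std j m ⊕ std j n)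
    linear = by refl
    open Symmetry id (translate n) (λ j s → s ⊕ std j n) (bijective id (check₁ {p = permutes id} (by refl)))
      (λ j → bijective (λ s → s ⊕ std j n) (check₂ shift (std j n)))
      (λ j m → ==-sound (check₃ linear n j m))

-- First and second moments of the loads in a line class.

module Moments where

  open Prelude
  open Sums
  open AffinePlane
  import Data.Nat.Base as ℕ
  import Data.Nat.Properties as ℕ
  open import Data.Nat.Tactic.RingSolver using (solve-∀)
  open import Algebra.Properties.Semiring.Sum ℕ.+-*-semiring using (sum)

  -- Lines of AG(2,4) from different parallel classes meet in one point; lines from the same class
  -- share four points or none. The terms with `δ i j` on both sides avoid a subtraction.
  ∑-pair : ∀ i j (f g : F → ℕ) →
    ∑ (λ m → f (std i m) * g (std j m)) + δ i j * (∑ f * ∑ g) ≡ ∑ f * ∑ g + δ i j * (4 * ∑ (λ s → f s * g s))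
  ∑-pair i j f g = begin
    ∑ (λ m → f (std i m) * g (std j m)) + δ i j * (∑ f * ∑ g)
      ≡⟨ cong₂ _+_
           (trans (∑-cong λ m → cong₂ _*_ (sym (∑-δ (std i m) f)) (sym (∑-δ (std j m) g)))
             (∑-gram (λ m s → δ (std i m) s) (λ m s → δ (std j m) s) f g))
           (trans (cong (δ i j *_) (∑-product f g)) (trans (sym (∑-*ˡ (δ i j) _)) (∑-cong λ s → sym (∑-*ˡ (δ i j) _)))) ⟩
    ∑ (λ s → ∑ (λ s′ → N s s′ * (f s * g s′))) + ∑ (λ s → ∑ (λ s′ → δ i j * (f s * g s′)))
      ≡⟨ sym (trans (∑-cong (λ s → ∑-+ (λ s′ → N s s′ * (f s * g s′)) _)) (∑-+ (λ s → ∑ (λ s′ → N s s′ * (f s * g s′))) _)) ⟩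
    ∑ (λ s → ∑ (λ s′ → N s s′ * (f s * g s′) + δ i j * (f s * g s′)))
      ≡⟨ ∑-cong₂ (λ s s′ → trans (sym (ℕ.*-distribʳ-+ (f s * g s′) (N s s′) (δ i j)))
           (trans (cong (_* (f s * g s′)) (meets s s′)) (expand (δ i j) (δ s s′) (f s) (g s′)))) ⟩
    ∑ (λ s → ∑ (λ s′ → f s * g s′ + δ i j * (4 * f s) * (δ s s′ * g s′)))
      ≡⟨ ∑-cong (λ s → trans (∑-+ (λ s′ → f s * g s′) _)
           (cong₂ _+_ refl (trans (∑-*ˡ (δ i j * (4 * f s)) _) (cong (δ i j * (4 * f s) *_) (∑-δ s g))))) ⟩
    ∑ (λ s → ∑ (λ s′ → f s * g s′) + δ i j * (4 * f s) * g s)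
      ≡⟨ ∑-+ (λ s → ∑ (λ s′ → f s * g s′)) _ ⟩
    ∑ (λ s → ∑ (λ s′ → f s * g s′)) + ∑ (λ s → δ i j * (4 * f s) * g s)
      ≡⟨ cong₂ _+_ (sym (∑-product f g))
           (trans (∑-cong λ s → assoc (δ i j) (f s) (g s))
             (trans (∑-*ˡ (δ i j) _) (cong (δ i j *_) (∑-*ˡ 4 (λ s → f s * g s))))) ⟩
    ∑ f * ∑ g + δ i j * (4 * ∑ (λ s → f s * g s)) ∎
    where
    open ≡-Reasoning
    N : F → F → ℕ
    N s s′ = ∑ λ m → δ (std i m) s * δ (std j m) s′
    incidences : Check₄ (λ i j s s′ →
      sum {16} (λ m → δ (std i m) s * δ (std j m) s′) + δ {5} i j ≡ᵇ 1 + 4 * (δ i j * δ {4} s s′))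
    incidences = by refl
    meets : ∀ s s′ → N s s′ + δ i j ≡ 1 + 4 * (δ i j * δ s s′)
    meets s s′ = trans (cong (_+ δ i j) (∑≡sum _)) (≡ᵇ-sound _ _ (check₄ incidences i j s s′))
    expand : ∀ d e a b → (1 + 4 * (d * e)) * (a * b) ≡ a * b + d * (4 * a) * (e * b)
    expand = solve-∀
    assoc : ∀ d a b → d * (4 * a) * b ≡ d * (4 * (a * b))
    assoc = solve-∀

  ∑-pair-∑ : ∀ i (f : F → ℕ) (W : Weights) →
    ∑ (λ m → f (std i m) * load W m) + ∑ f * ∑ (W i) ≡ ∑ f * ∑ (λ j → ∑ (W j)) + 4 * ∑ (λ s → f s * W i s)
  ∑-pair-∑ i f W = begin
    ∑ (λ m → f (std i m) * load W m) + ∑ f * ∑ (W i)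
      ≡⟨ cong₂ _+_
           (trans (∑-cong λ m → sym (∑-*ˡ (f (std i m)) (λ j → W j (std j m)))) (∑-swap _))
           (sym (∑-δ i (λ j → ∑ f * ∑ (W j)))) ⟩
    ∑ (λ j → ∑ (λ m → f (std i m) * W j (std j m))) + ∑ (λ j → δ i j * (∑ f * ∑ (W j)))
      ≡⟨ sym (∑-+ (λ j → ∑ (λ m → f (std i m) * W j (std j m))) _) ⟩
    ∑ (λ j → ∑ (λ m → f (std i m) * W j (std j m)) + δ i j * (∑ f * ∑ (W j)))
      ≡⟨ ∑-cong (λ j → ∑-pair i j f (W j)) ⟩
    ∑ (λ j → ∑ f * ∑ (W j) + δ i j * (4 * ∑ (λ s → f s * W j s)))
      ≡⟨ ∑-+ (λ j → ∑ f * ∑ (W j)) _ ⟩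
    ∑ (λ j → ∑ f * ∑ (W j)) + ∑ (λ j → δ i j * (4 * ∑ (λ s → f s * W j s)))
      ≡⟨ cong₂ _+_ (∑-*ˡ (∑ f) (λ j → ∑ (W j))) (∑-δ i (λ j → 4 * ∑ (λ s → f s * W j s))) ⟩
    ∑ f * ∑ (λ j → ∑ (W j)) + 4 * ∑ (λ s → f s * W i s) ∎
    where open ≡-Reasoning

  ∑-std : ∀ i (f : F → ℕ) → ∑ (λ m → f (std i m)) ≡ 4 * ∑ f
  ∑-std i f = ℕ.+-cancelʳ-≡ (∑ f * 4) _ _ (trans (trans (cong₂ _+_ (∑-cong λ m → sym (ℕ.*-identityʳ _))
      (sym (trans (cong₂ _*_ (δ-refl i) (cong (∑ f *_) (∑-const 4 1))) (ℕ.*-identityˡ _)))) (∑-pair i i f (λ _ → 1)))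
    (trans (cong₂ _+_ (cong (∑ f *_) (∑-const 4 1))
      (trans (cong₂ _*_ (δ-refl i) (cong (4 *_) (∑-cong λ s → ℕ.*-identityʳ (f s)))) (ℕ.*-identityˡ _)))
    (ℕ.+-comm (∑ f * 4) _)))

  deviates : ℕ → ℕ
  deviates g = ∣ g - 4 ∣ * ∣ g - 4 ∣

  deviates-square : ∀ g → deviates g + 8 * g ≡ g * g + 16
  deviates-square 0 = refl
  deviates-square 1 = refl
  deviates-square 2 = refl
  deviates-square 3 = refl
  deviates-square (suc (suc (suc (suc k)))) rewrite ℕ.∣-∣-identityʳ k = large k
    where
    large : ∀ k → k * k + 8 * (4 + k) ≡ (4 + k) * (4 + k) + 16
    large = solve-∀

  module _ (W : Weights) where

    U : ℕ
    U = ∑ λ j → ∑ (W j)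

    load-sum : ∑ (load W) ≡ 4 * U
    load-sum = trans (∑-swap _) (trans (∑-cong λ j → ∑-std j (W j)) (∑-*ˡ 4 (λ j → ∑ (W j))))

    load-squares : ∑ (λ m → load W m * load W m) + ∑ (λ j → ∑ (W j) * ∑ (W j)) ≡ U * U + 4 * ∑ (λ j → squares (W j))
    load-squares = begin
      ∑ (λ m → load W m * load W m) + ∑ (λ j → ∑ (W j) * ∑ (W j))
        ≡⟨ cong (_+ ∑ (λ j → ∑ (W j) * ∑ (W j)))
             (trans (∑-cong λ m → sym (∑-*ʳ (load W m) (λ j → W j (std j m)))) (∑-swap _)) ⟩
      ∑ (λ j → ∑ (λ m → W j (std j m) * load W m)) + ∑ (λ j → ∑ (W j) * ∑ (W j))
        ≡⟨ sym (∑-+ (λ j → ∑ (λ m → W j (std j m) * load W m)) _) ⟩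
      ∑ (λ j → ∑ (λ m → W j (std j m) * load W m) + ∑ (W j) * ∑ (W j))
        ≡⟨ ∑-cong (λ j → ∑-pair-∑ j (W j) W) ⟩
      ∑ (λ j → ∑ (W j) * U + 4 * squares (W j))
        ≡⟨ ∑-+ (λ j → ∑ (W j) * U) _ ⟩
      ∑ (λ j → ∑ (W j) * U) + ∑ (λ j → 4 * squares (W j))
        ≡⟨ cong₂ _+_ (∑-*ʳ U (λ j → ∑ (W j))) (∑-*ˡ 4 (λ j → squares (W j))) ⟩
      U * U + 4 * ∑ (λ j → squares (W j)) ∎
      where open ≡-Reasoning

    module _ (light : ∀ m → load W m ≤ 6) where

      -- The four lines through the segment s all contain it, and each segment of the other four
      -- classes lies on exactly one of them. Together they carry 4 `W j s` + U - `∑ (W j)` points,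
      -- at most 24.
      segment-bound : ∀ j s → 4 * W j s + U ≤ 24 + ∑ (W j)
      segment-bound j s = begin
        4 * W j s + U
          ≡⟨ ℕ.+-comm (4 * W j s) U ⟩
        U + 4 * W j s
          ≡⟨ cong₂ _+_ (sym (trans (cong (_* U) one) (ℕ.*-identityˡ U))) (cong (4 *_) (sym (∑-δ s (W j)))) ⟩
        ∑ (δ s) * U + 4 * ∑ (λ s′ → δ s s′ * W j s′)
          ≡⟨ sym (∑-pair-∑ j (δ s) W) ⟩
        ∑ (λ m → δ s (std j m) * load W m) + ∑ (δ s) * ∑ (W j)
          ≤⟨ ℕ.+-mono-≤
               (ℕ.≤-trans (∑-mono λ m → ℕ.*-monoʳ-≤ (δ s (std j m)) (light m))
                 (ℕ.≤-reflexive (trans (∑-*ʳ 6 (λ m → δ s (std j m))) (cong (_* 6) (trans (∑-std j (δ s)) (cong (4 *_) one))))))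
               (ℕ.≤-reflexive (trans (cong (_* ∑ (W j)) one) (ℕ.*-identityˡ _))) ⟩
        24 + ∑ (W j) ∎
        where
        open ℕ.≤-Reasoning
        one : ∑ (δ s) ≡ 1
        one = trans (∑-cong λ s′ → sym (ℕ.*-identityʳ (δ s s′))) (∑-δ s (λ _ → 1))

    deviation : ℕ
    deviation = ∑ λ m → deviates (load W m)

    -- (g - 4)² is expanded with Σ g = 4U and the value of Σ g² from `load-squares`. Once the sizes
    -- of the five classes are fixed, the deviation depends only on the sum of squares of the
    -- segment counts, which is what the search bounds.
    deviation-identity : deviation + 32 * U + ∑ (λ j → ∑ (W j) * ∑ (W j)) ≡ 4 * ∑ (λ j → squares (W j)) + U * U + 256
    deviation-identity = begin
      deviation + 32 * U + ∑ (λ j → ∑ (W j) * ∑ (W j))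
        ≡⟨ cong (_+ ∑ (λ j → ∑ (W j) * ∑ (W j))) (cong (deviation +_) (trans (ℕ.*-assoc 8 4 U)
             (trans (cong (8 *_) (sym load-sum)) (sym (∑-*ˡ 8 (load W)))))) ⟩
      deviation + ∑ (λ m → 8 * load W m) + ∑ (λ j → ∑ (W j) * ∑ (W j))
        ≡⟨ cong (_+ ∑ (λ j → ∑ (W j) * ∑ (W j))) (trans (sym (∑-+ _ (λ m → 8 * load W m)))
             (trans (∑-cong λ m → deviates-square (load W m)) (trans (∑-+ _ (λ _ → 16)) (cong (∑ (λ m → load W m * load W m) +_) (∑-const 16 16))))) ⟩
      ∑ (λ m → load W m * load W m) + 256 + ∑ (λ j → ∑ (W j) * ∑ (W j))
        ≡⟨ right-comm (∑ (λ m → load W m * load W m)) 256 _ ⟩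
      ∑ (λ m → load W m * load W m) + ∑ (λ j → ∑ (W j) * ∑ (W j)) + 256
        ≡⟨ cong (_+ 256) (trans load-squares (ℕ.+-comm (U * U) _)) ⟩
      4 * ∑ (λ j → squares (W j)) + U * U + 256 ∎
      where
      open ≡-Reasoning
      right-comm : ∀ a b c → a + b + c ≡ a + c + b
      right-comm = solve-∀

-- Branch and bound over the distributions of a line class.

module Search where

  open Prelude
  open Sums
  open AffinePlane
  open Moments
  open import Data.Bool.Properties using (T?)
  import Data.Nat.Base as ℕ
  import Data.Nat.Properties as ℕ
  open import Data.Nat.Tactic.RingSolver using (solve-∀)
  open import Data.List.Base as List using (List; []; _∷_; map; filter; upTo; foldr; cartesianProduct; zipWith; allFin)
  open import Data.Nat.ListAction using () renaming (sum to listSum)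
  open import Data.List.Membership.Propositional using (_∈_)
  open import Data.List.Membership.Propositional.Properties using (∈-filter⁺; ∈-cartesianProduct⁺; ∈-upTo⁺)
  open import Data.List.Relation.Unary.Any using (here; there)
  open import Data.Unit.Base using (tt)

  ≤ᵇ-complete : ∀ {m n} → m ≤ n → (m ≤ᵇ n) ≡ true
  ≤ᵇ-complete {m} {n} p with m ≤ᵇ n in eq
  ... | true  = refl
  ... | false = ⊥-elim (subst T eq (ℕ.≤⇒≤ᵇ p))

  ≡ᵇ-complete : ∀ {m n} → m ≡ n → (m ≡ᵇ n) ≡ true
  ≡ᵇ-complete {m} {n} p with m ≡ᵇ n in eq
  ... | true  = refl
  ... | false = ⊥-elim (subst T eq (ℕ.≡⇒≡ᵇ m n p))

  infixr 3 _∧ᵗ_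
  _∧ᵗ_ : ∀ {a b} → a ≡ true → b ≡ true → a ∧ b ≡ true
  refl ∧ᵗ refl = refl

  every : ∀ {A : Set} → (A → Bool) → List A → Bool
  every p []       = true
  every p (x ∷ xs) = if p x then every p xs else false

  every-∈ : ∀ {A : Set} (p : A → Bool) {xs x} → every p xs ≡ true → x ∈ xs → p x ≡ true
  every-∈ p {y ∷ xs} eq i with p y in py
  every-∈ p {y ∷ xs} eq (here refl) | true = py
  every-∈ p {y ∷ xs} eq (there i)   | true = every-∈ p eq i

  Row : Set
  Row = (ℕ × ℕ) × (ℕ × ℕ)

  at : Row → F → ℕ
  at ((a , b) , (c , d)) 0F = a
  at ((a , b) , (c , d)) 1F = b
  at ((a , b) , (c , d)) 2F = c
  at ((a , b) , (c , d)) 3F = d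

  rowSum rowSquares : Row → ℕ
  rowSum     ((a , b) , (c , d)) = a + (b + (c + d))
  rowSquares ((a , b) , (c , d)) = a * a + (b * b + (c * c + d * d))

  row : (F → ℕ) → Row
  row r = (r 0F , r 1F) , (r 2F , r 3F)

  at-row : ∀ r s → at (row r) s ≡ r s
  at-row r 0F = refl
  at-row r 1F = refl
  at-row r 2F = refl
  at-row r 3F = refl

  ∑₄ : ∀ (r : F → ℕ) → ∑ r ≡ r 0F + (r 1F + (r 2F + r 3F))
  ∑₄ r = trans (∑≡sum r) (cong (λ x → r 0F + (r 1F + (r 2F + x))) (ℕ.+-identityʳ (r 3F)))

  isRegular : ℕ → Row → Bool
  isRegular 5 r = rowSquares r ≡ᵇ 9
  isRegular 6 r = rowSquares r ≡ᵇ 12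
  isRegular _ r = true

  isRegular-complete : ∀ u r → (u ≡ 5 → rowSquares r ≡ 9) → (u ≡ 6 → rowSquares r ≡ 12) → isRegular u r ≡ true
  isRegular-complete 0 r f s = refl
  isRegular-complete 1 r f s = refl
  isRegular-complete 2 r f s = refl
  isRegular-complete 3 r f s = refl
  isRegular-complete 4 r f s = refl
  isRegular-complete 5 r f s = ≡ᵇ-complete (f refl)
  isRegular-complete 6 r f s = ≡ᵇ-complete (s refl)
  isRegular-complete (suc (suc (suc (suc (suc (suc (suc u))))))) r f s = refl

  -- Candidates for a single segment count: the filter is `segment-bound`, the limit 2 comes from
  -- `Regular`.
  entries : ℕ → ℕ → List ℕ
  entries U u = filter (λ w → T? (4 * w + U ≤ᵇ 24 + u)) (upTo (suc (if 5 ≤ᵇ u then 2 else u)))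

  rows : ℕ → ℕ → List Row
  rows U u = filter (λ r → T? ((rowSum r ≡ᵇ u) ∧ isRegular u r))
    (cartesianProduct pairs pairs)
    where pairs = cartesianProduct (entries U u) (entries U u)

  T-true : ∀ {b} → b ≡ true → T b
  T-true refl = tt

  ∈-rows : ∀ {U u} (r : F → ℕ) → ∑ r ≡ u → (∀ s → 4 * r s + U ≤ 24 + u) → Regular r → row r ∈ rows U u
  ∈-rows {U} {u} r refl cap reg =
    ∈-filter⁺ (λ r → T? ((rowSum r ≡ᵇ u) ∧ isRegular u r))
      (∈-cartesianProduct⁺ (∈-cartesianProduct⁺ (entry 0F) (entry 1F)) (∈-cartesianProduct⁺ (entry 2F) (entry 3F)))
      (T-true (≡ᵇ-complete (sym (∑₄ r)) ∧ᵗ isRegular-complete u (row r)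
        (λ e → trans (sym (∑₄ λ s → r s * r s)) (Regular.five reg e))
        (λ e → trans (sym (∑₄ λ s → r s * r s)) (Regular.six reg e))))
    where
    small : ∀ s → r s ≤ (if 5 ≤ᵇ ∑ r then 2 else ∑ r)
    small s with 5 ≤ᵇ ∑ r in eq
    ... | true  = Regular.≤2 reg (≤ᵇ-sound 5 _ eq) s
    ... | false = ≤-∑ r s
    entry : ∀ s → r s ∈ entries U (∑ r)
    entry s = ∈-filter⁺ (λ w → T? (4 * w + U ≤ᵇ 24 + ∑ r)) (∈-upTo⁺ (s≤s (small s))) (T-true (≤ᵇ-complete (cap s)))

  record Level : Set where
    constructor level
    field
      names : List F
      rowsˡ : List Row
      -- an upper bound for the squares contributed by the levels below
      rest  : ℕ

  open Level

  addRow : Row → List F → List ℕ → List ℕ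
  addRow r = zipWith (λ s x → at r s + x)

  fits : ℕ → List ℕ → Bool
  fits t []       = true
  fits t (x ∷ xs) = (x ≤ᵇ t) ∧ every (_≤ᵇ 6) (x ∷ xs)

  -- Looks for loads of at most 6 everywhere and at most t at the first point,
  -- for which four times the sum of squares plus K exceeds N.  The value true
  -- means that there are none.
  mutual
    search : (t K N : ℕ) → List Level → (S : ℕ) → List ℕ → Bool
    -- At the last level `rest` is 0, so a branch gets here only with a complete configuration that
    -- fits and exceeds the bound.
    search t K N []       S loads = false
    search t K N (l ∷ ls) S loads = every
      (λ r → if 4 * (S + rowSquares r + rest l) + K ≤ᵇ N then true
             else search′ t K N ls (S + rowSquares r) (addRow r (names l) loads))
      (rowsˡ l)

    search′ : (t K N : ℕ) → List Level → (S : ℕ) → List ℕ → Bool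
    search′ t K N ls S loads = if fits t loads then search t K N ls S loads else true

  points : List (Fin 16)
  points = allFin 16

  namesOf : Fin 5 → List F
  namesOf j = map (std j) points

  maxSquares : List Row → ℕ
  maxSquares = foldr (λ r m → rowSquares r ⊔ m) 0

  plan : ℕ → List (Fin 5) → List ℕ → List Level
  plan U (j ∷ js) (u ∷ us) = level (namesOf j) (rows U u) (listSum (map (λ v → maxSquares (rows U v)) us)) ∷ plan U js us
  plan U _ _ = []

  excluded : (t K N : ℕ) → List ℕ → Bool
  excluded t K N us = search t K N (plan (listSum us) (allFin 5) us) 0 (map (λ _ → 0) points)

  -- 4S + 1 ≤ 0 never holds, so nothing is cut by the bound and success means that no configuration
  -- has all loads at most 6.
  impossible : List ℕ → Bool
  impossible = excluded 6 1 0

  sumSquares : List ℕ → ℕ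
  sumSquares us = listSum (map (λ u → u * u) us)

  -- K and N are chosen such that, by `deviation-identity`, 4S + K ≤ N amounts to a deviation of at
  -- most β.
  bounded : (t β : ℕ) → List ℕ → Bool
  bounded t β us = excluded t (listSum us * listSum us + 256) (β + 32 * listSum us + sumSquares us) us


  ≤-maxSquares : ∀ {r R} → r ∈ R → rowSquares r ≤ maxSquares R
  ≤-maxSquares (here refl) = ℕ.m≤m⊔n _ _
  ≤-maxSquares (there i)   = ℕ.≤-trans (≤-maxSquares i) (ℕ.m≤n⊔m _ _)

  every-map : ∀ {A B : Set} (p : B → Bool) (f : A → B) xs → (∀ x → p (f x) ≡ true) → every p (map f xs) ≡ true
  every-map p f []       h = refl
  every-map p f (x ∷ xs) h rewrite h x = every-map p f xs h

  addRow-map : ∀ r j (f : Fin 16 → ℕ) ms →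
    addRow r (map (std j) ms) (map f ms) ≡ map (λ m → at r (std j m) + f m) ms
  addRow-map r j f []       = refl
  addRow-map r j f (m ∷ ms) = cong (at r (std j m) + f m ∷_) (addRow-map r j f ms)

  module _ (W : Weights) where

    sumOver : List (Fin 5) → (Fin 5 → ℕ) → ℕ
    sumOver js f = listSum (map f js)

    rowOf : Fin 5 → Row
    rowOf j = row (W j)

    -- The branch that chooses the actual rows of W is followed; f and S are the loads and squares
    -- of the rows already passed. Either the branch is cut, and `rest` bounds the squares still to
    -- come, or it would end in the leaf `false`.
    search-sound : ∀ t K N U js S (f : Fin 16 → ℕ) → (∀ j → rowOf j ∈ rows U (∑ (W j))) →
      (∀ m → f m + sumOver js (λ j → at (rowOf j) (std j m)) ≤ 6) →
      f 0F + sumOver js (λ j → at (rowOf j) (std j 0F)) ≤ t →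
      search t K N (plan U js (map (λ j → ∑ (W j)) js)) S (map f points) ≡ true →
      4 * (S + sumOver js (rowSquares ∘ rowOf)) + K ≤ N
    search-sound t K N U [] S f ∈R ≤6 ≤t ()
    search-sound t K N U (j ∷ js) S f ∈R ≤6 ≤t eq
      with prune ← every-∈ (λ r → if 4 * (S + rowSquares r + listSum (map (λ v → maxSquares (rows U v)) (map (λ j → ∑ (W j)) js))) + K ≤ᵇ N
        then true else search′ t K N (plan U js (map (λ j → ∑ (W j)) js)) (S + rowSquares r) (addRow r (namesOf j) (map f points))) eq (∈R j)
      with 4 * (S + rowSquares (rowOf j) + listSum (map (λ v → maxSquares (rows U v)) (map (λ j → ∑ (W j)) js))) + K ≤ᵇ N in p
    ... | true  = ℕ.≤-trans (ℕ.+-monoˡ-≤ K (ℕ.*-monoʳ-≤ 4 (ℕ.≤-trans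
            (ℕ.≤-reflexive (sym (ℕ.+-assoc S (rowSquares (rowOf j)) _)))
            (ℕ.+-monoʳ-≤ (S + rowSquares (rowOf j)) (remaining js)))))
          (≤ᵇ-sound _ N p)
      where
      remaining : ∀ js → sumOver js (rowSquares ∘ rowOf) ≤ listSum (map (λ v → maxSquares (rows U v)) (map (λ j → ∑ (W j)) js))
      remaining []       = z≤n
      remaining (j ∷ js) = ℕ.+-mono-≤ (≤-maxSquares (∈R j)) (remaining js)
    ... | false = subst (λ x → 4 * x + K ≤ N) (ℕ.+-assoc S (rowSquares (rowOf j)) _)
          (search-sound t K N U js (S + rowSquares (rowOf j)) f′ ∈R
            (λ m → ℕ.≤-trans (ℕ.≤-reflexive (move m)) (≤6 m)) (ℕ.≤-trans (ℕ.≤-reflexive (move 0F)) ≤t)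
            (enter (trans (cong (search′ t K N levels (S + rowSquares (rowOf j))) (sym (addRow-map (rowOf j) j f points))) prune)))
      where
      levels : List Level
      levels = plan U js (map (λ j → ∑ (W j)) js)
      f′ : Fin 16 → ℕ
      f′ m = at (rowOf j) (std j m) + f m
      move : ∀ m → f′ m + sumOver js (λ j → at (rowOf j) (std j m)) ≡
                   f m + (at (rowOf j) (std j m) + sumOver js (λ j → at (rowOf j) (std j m)))
      move m = shuffle (at (rowOf j) (std j m)) (f m) _
        where
        shuffle : ∀ a b c → a + b + c ≡ b + (a + c)
        shuffle = solve-∀
      fitting : fits t (map f′ points) ≡ true
      fitting = ≤ᵇ-complete (ℕ.m+n≤o⇒m≤o (f′ 0F) (ℕ.≤-trans (ℕ.≤-reflexive (move 0F)) ≤t))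
        ∧ᵗ every-map (_≤ᵇ 6) f′ points (λ m → ≤ᵇ-complete (ℕ.m+n≤o⇒m≤o (f′ m) (ℕ.≤-trans (ℕ.≤-reflexive (move m)) (≤6 m))))
      enter : search′ t K N levels (S + rowSquares (rowOf j)) (map f′ points) ≡ true →
        search t K N levels (S + rowSquares (rowOf j)) (map f′ points) ≡ true
      enter eq rewrite fitting = eq

  excluded-sound : ∀ t K N us {S} → excluded t K N us ≡ true → Arrangement t us S → 4 * S + K ≤ N
  excluded-sound t K N us {S} eq A = subst (λ x → 4 * x + K ≤ N) squares≡
    (search-sound W t K N (listSum (map (λ j → ∑ (W j)) (allFin 5))) (allFin 5) 0 (λ _ → 0) member
      (λ m → subst (_≤ 6) (load≡ m) (load≤6 m)) (subst (_≤ t) (load≡ 0F) (subst (λ m → load W m ≤ t) centred load≤t))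
      (trans (cong (λ us → search t K N (plan (listSum us) (allFin 5) us) 0 (map (λ _ → 0) points)) sizes) eq))
    where
    open Centred (centre A)
    open Arrangement arrangement
    ∑₅ : ∀ (f : Fin 5 → ℕ) → ∑ f ≡ listSum (map f (allFin 5))
    ∑₅ f = ∑≡sum f
    load≡ : ∀ m → load W m ≡ sumOver W (allFin 5) (λ j → at (rowOf W j) (std j m))
    load≡ m = trans (∑-cong λ j → sym (at-row (W j) (std j m))) (∑₅ (λ j → at (rowOf W j) (std j m)))
    squares≡ : sumOver W (allFin 5) (rowSquares ∘ rowOf W) ≡ S
    squares≡ = trans (sym (∑₅ (rowSquares ∘ rowOf W))) (trans (∑-cong λ j → sym (∑₄ λ s → W j s * W j s)) total)
    member : ∀ j → rowOf W j ∈ rows (listSum (map (λ j → ∑ (W j)) (allFin 5))) (∑ (W j))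
    member j = ∈-rows (W j) refl
      (λ s → subst (λ x → 4 * W j s + x ≤ 24 + ∑ (W j)) (∑₅ λ j → ∑ (W j)) (segment-bound W load≤6 j s)) (regular j)

-- Possible sizes of the five point classes on a line class.

module LineClasses where

  open Prelude
  open Sums
  open AffinePlane
  open Search
  import Data.Nat.Base as ℕ
  import Data.Nat.Properties as ℕ
  open import Data.Nat.ListAction using () renaming (sum to listSum)
  open import Data.Nat.ListAction.Properties using (sum-↭)
  open import Data.List.Base as List using (List; []; _∷_; length)
  open import Data.List.Properties using (length-tabulate)
  open import Data.List.Sort ℕ.≤-decTotalOrder using (sort; sort-↭; sort-↗)
  open import Data.List.Relation.Binary.Permutation.Propositional using (_↭_; ↭-sym; ↭-trans)
  open import Data.List.Relation.Binary.Permutation.Propositional.Properties using (↭-length; ↭-reverse; map⁺; All-resp-↭; ∈-resp-↭)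
  open import Data.List.Relation.Unary.All using (All; []; _∷_)
  open import Data.List.Relation.Unary.Linked using (Linked; []; [-]; _∷_)
  open import Data.List.Membership.Propositional using (_∈_)
  open import Data.List.Membership.Propositional.Properties using ()
  import Data.List.Relation.Unary.All as All

  -- The line classes as seen by the counting argument: us lists the sizes of the
  -- point classes and C is the sum of (g - 4)² over the sixteen lines, where g is
  -- the number of points of the arc on the line.
  record LineClass (us : List ℕ) (C : ℕ) : Set where
    field
      {S}         : ℕ
      arrangement : Arrangement 6 us S
      law    : C + 32 * listSum us + sumSquares us ≡ 4 * S + listSum us * listSum us + 256
      near        : C ≤ 64 ⊎ Arrangement 1 us S

  resp-↭ : ∀ {us vs C} → us ↭ vs → LineClass us C → LineClass vs C
  resp-↭ {us} {vs} {C} p L = record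
    { S = S
    ; arrangement = rearrange p arrangement
    ; law = subst₂ (λ x y → C + 32 * x + y ≡ 4 * S + x * x + 256) (sum-↭ p) (sum-↭ (map⁺ (λ u → u * u) p)) law
    ; near = [ inj₁ , inj₂ ∘ rearrange p ]′ near
    }
    where open LineClass L

  impossible-sound : ∀ us {C} → impossible us ≡ true → ¬ LineClass us C
  impossible-sound us eq L = positive (LineClass.S L) (excluded-sound 6 1 0 us eq (LineClass.arrangement L))
    where
    positive : ∀ S → ¬ (4 * S + 1 ≤ 0)
    positive S p = ℕ.1+n≢0 (trans (ℕ.+-comm 1 (4 * S)) (ℕ.n≤0⇒n≡0 p))

  bounded-sound : ∀ t β us {C} (L : LineClass us C) → bounded t β us ≡ true →
    Arrangement t us (LineClass.S L) → C ≤ β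
  bounded-sound t β us {C} L eq A = ℕ.+-cancelʳ-≤ (32 * listSum us + sumSquares us) C β (begin
    C + (32 * listSum us + sumSquares us) ≡⟨ sym (ℕ.+-assoc C _ _) ⟩
    C + 32 * listSum us + sumSquares us ≡⟨ law ⟩
    4 * S + listSum us * listSum us + 256 ≡⟨ ℕ.+-assoc (4 * S) _ 256 ⟩
    4 * S + (listSum us * listSum us + 256) ≤⟨ excluded-sound t (listSum us * listSum us + 256) (β + 32 * listSum us + sumSquares us) us eq A ⟩
    β + 32 * listSum us + sumSquares us ≡⟨ ℕ.+-assoc β _ _ ⟩
    β + (32 * listSum us + sumSquares us) ∎)
    where
    open LineClass L
    open ℕ.≤-Reasoning

  -- C > 64 forces a line with at most one point, so it suffices to search with t = 1.
  deviation≤ : ∀ β us {C} → bounded 1 β us ≡ true → 64 ≤ β → LineClass us C → C ≤ β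
  deviation≤ β us eq 64≤β L with LineClass.near L
  ... | inj₁ C≤64 = ℕ.≤-trans C≤64 64≤β
  ... | inj₂ A    = bounded-sound 1 β us L eq A

  upTo? : ℕ → (ℕ → Bool) → Bool
  upTo? zero    p = p 0
  upTo? (suc n) p = if p (suc n) then upTo? n p else false

  upTo?-sound : ∀ n p → upTo? n p ≡ true → ∀ m → m ≤ n → p m ≡ true
  upTo?-sound zero    p eq .0 z≤n = eq
  upTo?-sound (suc n) p eq m m≤ with p (suc n) in q
  ... | true with ℕ.m≤n⇒m<n∨m≡n m≤
  ...   | inj₁ (s≤s m≤n) = upTo?-sound n p eq m m≤n
  ...   | inj₂ refl      = q

  Quintuple : Set → Set
  Quintuple A = (a b c d e : ℕ) → A

  infixr 2 _⇒_
  _⇒_ : Bool → Bool → Bool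
  b ⇒ c = if b then c else true

  ⇒-sound : ∀ b c → (b ⇒ c) ≡ true → b ≡ true → c ≡ true
  ⇒-sound true c eq refl = eq

  module _ (p q : Quintuple Bool) where

    below₅ : ℕ → ℕ → ℕ → ℕ → ℕ → Bool
    below₅ a b c d e = p a b c d e ⇒ q a b c d e

    below₄ : ℕ → ℕ → ℕ → ℕ → Bool
    below₄ a b c d = upTo? d (below₅ a b c d)

    below₃ : ℕ → ℕ → ℕ → Bool
    below₃ a b c = upTo? c (below₄ a b c)

    below₂ : ℕ → ℕ → Bool
    below₂ a b = upTo? b (below₃ a b)

    below₁ : ℕ → Bool
    below₁ a = upTo? a (below₂ a)

    record Implies : Set where
      constructor by
      field holds : upTo? 6 below₁ ≡ true

    implies : Implies → ∀ {a b c d e} → a ≤ 6 → b ≤ a → c ≤ b → d ≤ c → e ≤ d → p a b c d e ≡ true → q a b c d e ≡ true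
    implies (by eq) {a} {b} {c} {d} {e} a≤6 b≤a c≤b d≤c e≤d = ⇒-sound (p a b c d e) (q a b c d e)
      (upTo?-sound d (below₅ a b c d) (upTo?-sound c (below₄ a b c) (upTo?-sound b (below₃ a b)
        (upTo?-sound a (below₂ a) (upTo?-sound 6 below₁ eq a a≤6) b b≤a) c c≤b) d d≤c) e e≤d)

  total? : ℕ → Quintuple Bool
  total? n a b c d e = a + (b + (c + (d + (e + 0)))) ≡ᵇ n

  excluded? : Quintuple Bool
  excluded? a b c d e = impossible (a ∷ b ∷ c ∷ d ∷ e ∷ [])

  is? : (a b c d e : ℕ) → Quintuple Bool
  is? a b c d e a′ b′ c′ d′ e′ = (a′ ≡ᵇ a) ∧ (b′ ≡ᵇ b) ∧ (c′ ≡ᵇ c) ∧ (d′ ≡ᵇ d) ∧ (e′ ≡ᵇ e)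

  _∨ᵠ_ : Quintuple Bool → Quintuple Bool → Quintuple Bool
  (p ∨ᵠ q) a b c d e = p a b c d e ∨ q a b c d e

  headed : ℕ → ℕ → Quintuple Bool
  headed h n a b c d e = (a ≡ᵇ h) ∧ total? n a b c d e

  heavy? : Quintuple Bool
  heavy? a b c d e = (5 ≤ᵇ a) ∧ (20 ≤ᵇ listSum (a ∷ b ∷ c ∷ d ∷ e ∷ [])) ∧ (listSum (a ∷ b ∷ c ∷ d ∷ e ∷ []) ≤ᵇ 22)

  bounded? : Quintuple Bool
  bounded? a b c d e = bounded 1 64 (a ∷ b ∷ c ∷ d ∷ e ∷ [])

  positive? : Quintuple Bool
  positive? a b c d e = 1 ≤ᵇ e

  -- The totals from 20 to 22 are those that `20≤t` and `heavy` leave for a line class through a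
  -- class of at least five points.
  heavy-bounded : Implies heavy? bounded?
  heavy-bounded = by refl

  six-22 : Implies (headed 6 22) (is? 6 4 4 4 4 ∨ᵠ excluded?)
  six-22 = by refl

  six-21 : Implies (headed 6 21) (is? 6 4 4 4 3 ∨ᵠ (is? 6 6 3 3 3 ∨ᵠ excluded?))
  six-21 = by refl

  five-21 : Implies (headed 5 21) (is? 5 4 4 4 4 ∨ᵠ (is? 5 5 5 3 3 ∨ᵠ excluded?))
  five-21 = by refl

  five-20 : Implies (headed 5 20) (positive? ∨ᵠ excluded?)
  five-20 = by refl

  -- Here t = 6, so no sparse line is presupposed. The difference 64 - 36 = 28 is the saving used in
  -- `flat-cost`.
  tight-five : bounded 6 36 (5 ∷ 4 ∷ 4 ∷ 4 ∷ 4 ∷ []) ≡ true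
  tight-five = refl

  light-4444 : ∀ y → y ≤ 4 → bounded 1 64 (4 ∷ 4 ∷ 4 ∷ 4 ∷ y ∷ []) ≡ true
  light-4444 = upTo?-sound 4 (λ y → bounded 1 64 (4 ∷ 4 ∷ 4 ∷ 4 ∷ y ∷ [])) refl

  light-44433 : bounded 1 64 (4 ∷ 4 ∷ 4 ∷ 3 ∷ 3 ∷ []) ≡ true
  light-44433 = refl

  -- One less than 64: when all sizes are 4 and C = 64, no line carries fewer than two points.
  regular-line : bounded 1 63 (4 ∷ 4 ∷ 4 ∷ 4 ∷ 4 ∷ []) ≡ true
  regular-line = refl

  record Sorted (us : List ℕ) (C : ℕ) : Set where
    field
      {a b c d e} : ℕ
      perm  : us ↭ a ∷ b ∷ c ∷ d ∷ e ∷ []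
      a≤6   : a ≤ 6
      b≤a   : b ≤ a
      c≤b   : c ≤ b
      d≤c   : d ≤ c
      e≤d   : e ≤ d

    vs : List ℕ
    vs = a ∷ b ∷ c ∷ d ∷ e ∷ []

    decide : ∀ {p q} → Implies p q → p a b c d e ≡ true → q a b c d e ≡ true
    decide h = implies _ _ h a≤6 b≤a c≤b d≤c e≤d

    ≤-head : ∀ {u} → u ∈ us → u ≤ a
    ≤-head i = All.lookup bounds (∈-resp-↭ perm i)
      where
      bounds : All (_≤ a) vs
      bounds = ℕ.≤-refl ∷ b≤a ∷ ℕ.≤-trans c≤b b≤a ∷ ℕ.≤-trans d≤c (ℕ.≤-trans c≤b b≤a) ∷
        ℕ.≤-trans e≤d (ℕ.≤-trans d≤c (ℕ.≤-trans c≤b b≤a)) ∷ []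

    head-≤ : ∀ {n} → All (_≤ n) us → a ≤ n
    head-≤ h with All-resp-↭ perm h
    ... | a≤n ∷ _ = a≤n

    sum-vs : ∀ {n} → listSum us ≡ n → listSum vs ≡ n
    sum-vs = trans (sym (sum-↭ perm))

  sorted : ∀ {us C} → LineClass us C → All (_≤ 6) us → Sorted us C
  sorted {us} L bound = go (sort us) refl (sort-↗ us) (trans (↭-length (sort-↭ us)) length-us)
    where
    length-us : length us ≡ 5
    length-us = trans (cong length (sym (Arrangement.sizes (LineClass.arrangement L)))) (length-tabulate {n = 5} (λ j → ∑ (Arrangement.W (LineClass.arrangement L) j)))
    go : ∀ vs → vs ≡ sort us → Linked _≤_ vs → length vs ≡ 5 → Sorted us _
    go (e ∷ d ∷ c ∷ b ∷ a ∷ []) eq (e≤d ∷ d≤c ∷ c≤b ∷ b≤a ∷ [-]) refl = record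
      { perm = perm ; a≤6 = All.head (All-resp-↭ perm bound) ; b≤a = b≤a ; c≤b = c≤b ; d≤c = d≤c ; e≤d = e≤d }
      where
      perm : us ↭ a ∷ b ∷ c ∷ d ∷ e ∷ []
      perm = ↭-trans (↭-sym (sort-↭ us)) (subst (λ vs → vs ↭ a ∷ b ∷ c ∷ d ∷ e ∷ []) eq
        (↭-sym (↭-reverse (e ∷ d ∷ c ∷ b ∷ a ∷ []))))

  is?-sound : ∀ a b c d e a′ b′ c′ d′ e′ → is? a b c d e a′ b′ c′ d′ e′ ≡ true →
    _≡_ {A = List ℕ} (a′ ∷ b′ ∷ c′ ∷ d′ ∷ e′ ∷ []) (a ∷ b ∷ c ∷ d ∷ e ∷ [])
  is?-sound a b c d e a′ b′ c′ d′ e′ eq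
    with a′ ≡ᵇ a in p₁ | b′ ≡ᵇ b in p₂ | c′ ≡ᵇ c in p₃ | d′ ≡ᵇ d in p₄ | e′ ≡ᵇ e in p₅
  ... | true | true | true | true | true
    rewrite ≡ᵇ-sound a′ a p₁ | ≡ᵇ-sound b′ b p₂ | ≡ᵇ-sound c′ c p₃ | ≡ᵇ-sound d′ d p₄ | ≡ᵇ-sound e′ e p₅ = refl

  ∨-elim : ∀ {A : Set} b c → (b ≡ true → A) → (c ≡ true → A) → b ∨ c ≡ true → A
  ∨-elim true  c f g eq = f refl
  ∨-elim false c f g eq = g eq

  module _ {us C} (L : LineClass us C) (≤6 : All (_≤ 6) us) where

    private
      open module S = Sorted (sorted L ≤6)

      L′ : LineClass vs C
      L′ = resp-↭ perm L

      head≡ : ∀ {n} → n ∈ us → All (_≤ n) us → (a ≡ᵇ n) ≡ true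
      head≡ i h = ≡ᵇ-complete (ℕ.≤-antisym (head-≤ h) (≤-head i))

      total≡ : ∀ n → listSum us ≡ n → total? n a b c d e ≡ true
      total≡ n s = ≡ᵇ-complete {n = n} (sum-vs s)

      case : ∀ {A : Set} a′ b′ c′ d′ e′ (q : Quintuple Bool) →
        (us ↭ a′ ∷ b′ ∷ c′ ∷ d′ ∷ e′ ∷ [] → A) → (q a b c d e ≡ true → A) →
        (is? a′ b′ c′ d′ e′ ∨ᵠ q) a b c d e ≡ true → A
      case a′ b′ c′ d′ e′ q f g = ∨-elim (is? a′ b′ c′ d′ e′ a b c d e) (q a b c d e)
        (λ eq → f (subst (us ↭_) (is?-sound a′ b′ c′ d′ e′ a b c d e eq) perm)) g

      never : ∀ {A : Set} → excluded? a b c d e ≡ true → A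
      never eq = ⊥-elim (impossible-sound vs eq L′)

    heavy-line : ∀ {u} → u ∈ us → 5 ≤ u → 20 ≤ listSum us → listSum us ≤ 22 → C ≤ 64
    heavy-line i 5≤u lo hi = deviation≤ 64 vs
      (decide heavy-bounded
        (≤ᵇ-complete {5} {a} (ℕ.≤-trans 5≤u (≤-head i)) ∧ᵗ ≤ᵇ-complete {20} {listSum vs} (subst (20 ≤_) (sum-↭ perm) lo)
          ∧ᵗ ≤ᵇ-complete {listSum vs} {22} (subst (_≤ 22) (sum-↭ perm) hi)))
      ℕ.≤-refl L′

    six-line-22 : 6 ∈ us → listSum us ≡ 22 → us ↭ 6 ∷ 4 ∷ 4 ∷ 4 ∷ 4 ∷ []
    six-line-22 i s = case 6 4 4 4 4 excluded? id never
      (decide six-22 (head≡ i ≤6 ∧ᵗ total≡ 22 s))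

    six-line-21 : 6 ∈ us → listSum us ≡ 21 → us ↭ 6 ∷ 4 ∷ 4 ∷ 4 ∷ 3 ∷ [] ⊎ us ↭ 6 ∷ 6 ∷ 3 ∷ 3 ∷ 3 ∷ []
    six-line-21 i s = case 6 4 4 4 3 (is? 6 6 3 3 3 ∨ᵠ excluded?) inj₁ (case 6 6 3 3 3 excluded? inj₂ never)
      (decide six-21 (head≡ i ≤6 ∧ᵗ total≡ 21 s))

    five-line-21 : 5 ∈ us → All (_≤ 5) us → listSum us ≡ 21 →
      us ↭ 5 ∷ 4 ∷ 4 ∷ 4 ∷ 4 ∷ [] ⊎ us ↭ 5 ∷ 5 ∷ 5 ∷ 3 ∷ 3 ∷ []
    five-line-21 i ≤5 s = case 5 4 4 4 4 (is? 5 5 5 3 3 ∨ᵠ excluded?) inj₁ (case 5 5 5 3 3 excluded? inj₂ never)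
      (decide five-21 (head≡ i ≤5 ∧ᵗ total≡ 21 s))

    five-line-20 : 5 ∈ us → All (_≤ 5) us → listSum us ≡ 20 → All (1 ≤_) us
    five-line-20 i ≤5 s = ∨-elim (1 ≤ᵇ e) (excluded? a b c d e)
      (λ eq → All-resp-↭ (↭-sym perm) (positive (≤ᵇ-sound 1 e eq))) never
      (decide five-20 (head≡ i ≤5 ∧ᵗ total≡ 20 s))
      where
      positive : 1 ≤ e → All (1 ≤_) vs
      positive p = ℕ.≤-trans p (ℕ.≤-trans e≤d (ℕ.≤-trans d≤c (ℕ.≤-trans c≤b b≤a))) ∷ ℕ.≤-trans p (ℕ.≤-trans e≤d (ℕ.≤-trans d≤c c≤b)) ∷
        ℕ.≤-trans p (ℕ.≤-trans e≤d d≤c) ∷ ℕ.≤-trans p e≤d ∷ p ∷ []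

  tight-five-line : ∀ {us C} → LineClass us C → us ↭ 5 ∷ 4 ∷ 4 ∷ 4 ∷ 4 ∷ [] → C ≤ 36
  tight-five-line L p = bounded-sound 6 36 (5 ∷ 4 ∷ 4 ∷ 4 ∷ 4 ∷ []) L′ tight-five (LineClass.arrangement L′)
    where L′ = resp-↭ p L

-- Incidence and double counting in PG(2,4).

module ProjectivePlane where

  open Prelude hiding (trans)
  open Sums
  import Data.Nat.Base as ℕ
  import Data.Nat.Properties as ℕ
  open import Data.Nat.Tactic.RingSolver using (solve-∀)
  open import Data.List.Base as List using (List; []; _∷_; tabulate; map)
  open import Data.List.Relation.Binary.Permutation.Propositional using (_↭_; refl; prep; swap; trans; ↭-sym)
  import Data.Maybe.Base as Maybe
  open import Data.Maybe.Base using (Maybe; just; nothing)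
  open import Data.Vec.Base using (Vec; []; _∷_; lookup)
  import Relation.Binary.PropositionalEquality as ≡
  open import Algebra.Properties.Semiring.Sum ℕ.+-*-semiring using (sum)

  PointTable PositionTable : Set
  PointTable    = Vec (Vec (Fin 21) 5) 21
  PositionTable = Vec (Vec (Fin 5) 5) 21

  module Tables where

    open import Agda.Builtin.FromNat using (Number; fromNat)
    open import Data.Fin.Literals using (number)
    open import Data.Unit.Base using (tt)

    instance
      literals : ∀ {n} → Number (Fin n)
      literals {n} = number n

    -- Points and lines are numbered by the same homogeneous coordinates, and incidence is the
    -- vanishing of the standard bilinear form. By its symmetry the table also lists the lines
    -- through a point. Each row follows the order of the directions in `form`.
    points : PointTable
    points =
      (16 ∷ 20 ∷ 17 ∷ 18 ∷ 19 ∷ []) ∷ (16 ∷ 1 ∷ 5 ∷ 13 ∷ 9 ∷ []) ∷ (16 ∷ 3 ∷ 15 ∷ 11 ∷ 7 ∷ []) ∷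
      (16 ∷ 2 ∷ 10 ∷ 6 ∷ 14 ∷ []) ∷ (4 ∷ 20 ∷ 5 ∷ 6 ∷ 7 ∷ []) ∷ (4 ∷ 1 ∷ 17 ∷ 11 ∷ 14 ∷ []) ∷
      (4 ∷ 3 ∷ 10 ∷ 13 ∷ 19 ∷ []) ∷ (4 ∷ 2 ∷ 15 ∷ 18 ∷ 9 ∷ []) ∷ (12 ∷ 20 ∷ 15 ∷ 13 ∷ 14 ∷ []) ∷
      (12 ∷ 1 ∷ 10 ∷ 18 ∷ 7 ∷ []) ∷ (12 ∷ 3 ∷ 17 ∷ 6 ∷ 9 ∷ []) ∷ (12 ∷ 2 ∷ 5 ∷ 11 ∷ 19 ∷ []) ∷
      (8 ∷ 20 ∷ 10 ∷ 11 ∷ 9 ∷ []) ∷ (8 ∷ 1 ∷ 15 ∷ 6 ∷ 19 ∷ []) ∷ (8 ∷ 3 ∷ 5 ∷ 18 ∷ 14 ∷ []) ∷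
      (8 ∷ 2 ∷ 17 ∷ 13 ∷ 7 ∷ []) ∷ (0 ∷ 20 ∷ 1 ∷ 2 ∷ 3 ∷ []) ∷ (0 ∷ 17 ∷ 5 ∷ 10 ∷ 15 ∷ []) ∷
      (0 ∷ 19 ∷ 9 ∷ 14 ∷ 7 ∷ []) ∷ (0 ∷ 18 ∷ 13 ∷ 6 ∷ 11 ∷ []) ∷ (0 ∷ 16 ∷ 4 ∷ 8 ∷ 12 ∷ []) ∷ []

    -- The position of x on the i-th line through x.
    positions : PositionTable
    positions =
      (0 ∷ 0 ∷ 0 ∷ 0 ∷ 0 ∷ []) ∷ (2 ∷ 1 ∷ 1 ∷ 1 ∷ 1 ∷ []) ∷ (3 ∷ 1 ∷ 1 ∷ 1 ∷ 1 ∷ []) ∷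
      (4 ∷ 1 ∷ 1 ∷ 1 ∷ 1 ∷ []) ∷ (0 ∷ 2 ∷ 0 ∷ 0 ∷ 0 ∷ []) ∷ (2 ∷ 2 ∷ 2 ∷ 2 ∷ 2 ∷ []) ∷
      (3 ∷ 3 ∷ 3 ∷ 3 ∷ 3 ∷ []) ∷ (4 ∷ 4 ∷ 4 ∷ 4 ∷ 4 ∷ []) ∷ (0 ∷ 3 ∷ 0 ∷ 0 ∷ 0 ∷ []) ∷
      (4 ∷ 4 ∷ 4 ∷ 2 ∷ 4 ∷ []) ∷ (2 ∷ 2 ∷ 3 ∷ 2 ∷ 2 ∷ []) ∷ (3 ∷ 3 ∷ 3 ∷ 3 ∷ 4 ∷ []) ∷
      (0 ∷ 4 ∷ 0 ∷ 0 ∷ 0 ∷ []) ∷ (3 ∷ 3 ∷ 3 ∷ 3 ∷ 2 ∷ []) ∷ (4 ∷ 4 ∷ 4 ∷ 3 ∷ 4 ∷ []) ∷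
      (2 ∷ 2 ∷ 4 ∷ 2 ∷ 2 ∷ []) ∷ (0 ∷ 1 ∷ 0 ∷ 0 ∷ 0 ∷ []) ∷ (2 ∷ 1 ∷ 2 ∷ 2 ∷ 2 ∷ []) ∷
      (3 ∷ 1 ∷ 3 ∷ 3 ∷ 3 ∷ []) ∷ (4 ∷ 1 ∷ 4 ∷ 4 ∷ 4 ∷ []) ∷ (1 ∷ 1 ∷ 1 ∷ 1 ∷ 1 ∷ []) ∷ []

  open Tables using (points; positions)

  locate : ∀ {n} → (Fin (suc n) → Bool) → Fin (suc n)
  locate {zero}  p = zero
  locate {suc n} p = if p zero then zero else suc (locate (p ∘ suc))

  tabulate-punchIn : ∀ {A : Set} {n} (f : Fin (suc n) → A) i → tabulate f ↭ f i ∷ tabulate (f ∘ punchIn i)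
  tabulate-punchIn f zero = refl
  tabulate-punchIn {n = suc n} f (suc i) = trans (prep (f zero) (tabulate-punchIn (f ∘ suc) i)) (swap (f zero) (f (suc i)) refl)

  remove : ∀ {n} → Fin n → List (Fin n) → Maybe (List (Fin n))
  remove x []       = nothing
  remove x (y ∷ ys) = if x == y then just ys else Maybe.map (y ∷_) (remove x ys)

  perm? : ∀ {n} → List (Fin n) → List (Fin n) → Bool
  perm? []       []       = true
  perm? []       (_ ∷ _)  = false
  perm? (x ∷ xs) ys with remove x ys
  ... | nothing = false
  ... | just zs = perm? xs zs

  remove-sound : ∀ {n} (x : Fin n) ys {zs} → remove x ys ≡ just zs → ys ↭ x ∷ zs
  remove-sound x (y ∷ ys) eq with x == y in e
  remove-sound x (y ∷ ys) refl | true with refl ← ==-sound {i = x} {y} e = refl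
  remove-sound x (y ∷ ys) eq   | false with remove x ys in r
  remove-sound x (y ∷ ys) refl | false | just zs = trans (prep y (remove-sound x ys r)) (swap y x refl)

  perm?-sound : ∀ {n} (xs ys : List (Fin n)) → perm? xs ys ≡ true → xs ↭ ys
  perm?-sound []       []       eq = refl
  perm?-sound (x ∷ xs) ys       eq with remove x ys in r
  ... | just zs = trans (prep x (perm?-sound xs zs eq)) (↭-sym (remove-sound x ys r))

  ∑-δˡ : ∀ {n} (x : Fin n) → ∑ (δ x) ≡ 1
  ∑-δˡ x = ≡.trans (∑-cong λ y → sym (ℕ.*-identityʳ (δ x y))) (∑-δ x (λ _ → 1))

  -- Opaque, since unfolding these tables at variables is expensive.
  opaque

    -- The five points on a line and, dually, the five lines through a point.
    pt : Fin 21 → Fin 5 → Fin 21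
    pt L j = lookup (lookup points L) j

    pos : Fin 21 → Fin 5 → Fin 5
    pos x i = lookup (lookup positions x) i

    pos-correct : ∀ x i → pt (pt x i) (pos x i) ≡ x
    pos-correct x i = ==-sound (check₂ ok x i)
      where
      ok : Check₂ (λ x i → pt (pt x i) (pos x i) == x)
      ok = by refl

    others : Fin 21 → Fin 5 → Fin 4 → Fin 21
    others x i c = pt (pt x i) (punchIn (pos x i) c)

    tabulate-through : ∀ {A : Set} (u : Fin 21 → A) x i →
      tabulate (u ∘ pt (pt x i)) ↭ u x ∷ tabulate (u ∘ others x i)
    tabulate-through u x i = subst (λ y → tabulate (u ∘ pt (pt x i)) ↭ u y ∷ tabulate (u ∘ others x i)) (pos-correct x i)
      (tabulate-punchIn (u ∘ pt (pt x i)) (pos x i))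

    incidence : Fin 21 → Fin 21 → ℕ
    incidence L x = sum λ j → δ (pt L j) x

    meet : Fin 21 → Fin 21 → Fin 5 → Fin 4
    meet x M i = locate (λ c → incidence M (others x i c) ≡ᵇ 1)

    meets-ok : Check₂ (λ x M → if incidence M x ≡ᵇ 0
      then perm? (tabulate (pt M)) (tabulate (λ i → others x i (meet x M i)))
      else (M == pt x (locate (λ i → M == pt x i))))
    meets-ok = by refl

    -- A line M off x meets each of the five lines through x once. The sizes on M can therefore be
    -- read off from what is known about the lines through x.
    meets : ∀ x M → (∃ λ i → M ≡ pt x i) ⊎ (tabulate (pt M) ↭ tabulate (λ i → others x i (meet x M i)))
    meets x M = go (incidence M x ≡ᵇ 0) (check₂ meets-ok x M)
      where
      go : ∀ b → (if b then perm? (tabulate (pt M)) (tabulate (λ i → others x i (meet x M i)))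
                       else (M == pt x (locate (λ i → M == pt x i)))) ≡ true →
        (∃ λ i → M ≡ pt x i) ⊎ (tabulate (pt M) ↭ tabulate (λ i → others x i (meet x M i)))
      go true  eq = inj₂ (perm?-sound (tabulate (pt M)) (tabulate (λ i → others x i (meet x M i))) eq)
      go false eq = inj₁ (locate (λ i → M == pt x i) , ==-sound eq)

  lineSum : (Fin 21 → ℕ) → Fin 21 → ℕ
  lineSum f L = ∑ λ j → f (pt L j)

  opaque
    unfolding pt pos others incidence meet

    lineSum≡ : ∀ f L → lineSum f L ≡ ∑ (λ x → incidence L x * f x)
    lineSum≡ f L = ≡.trans (∑-count (pt L) f) (∑-cong λ x → cong (_* f x) (∑≡sum (λ j → δ (pt L j) x)))

    incidence-sym : ∀ L x → incidence L x ≡ incidence x L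
    incidence-sym L x = ≡ᵇ-sound _ _ (check₂ ok L x)
      where
      ok : Check₂ (λ L x → incidence L x ≡ᵇ incidence x L)
      ok = by refl

    incidence-gram : ∀ x y → ∑ (λ L → incidence L x * incidence L y) ≡ 1 + 4 * δ x y
    incidence-gram x y = ≡.trans (∑≡sum _) (≡ᵇ-sound _ _ (check₂ ok x y))
      where
      ok : Check₂ (λ x y → sum (λ L → incidence L x * incidence L y) ≡ᵇ 1 + 4 * δ x y)
      ok = by refl

    ∑-lineSum-product : ∀ f g → ∑ (λ L → lineSum f L * lineSum g L) ≡ ∑ f * ∑ g + 4 * ∑ (λ x → f x * g x)
    ∑-lineSum-product f g = ≡.trans (∑-cong λ L → cong₂ _*_ (lineSum≡ f L) (lineSum≡ g L))
      (∑-design incidence incidence-gram f g)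

    -- The five lines through x cover every other point once and x five times.
    ∑-through : ∀ f x → ∑ (λ i → lineSum f (pt x i)) ≡ ∑ f + 4 * f x
    ∑-through f x = begin
      ∑ (λ i → lineSum f (pt x i)) ≡⟨ lineSum≡ (lineSum f) x ⟩
      ∑ (λ L → incidence x L * lineSum f L) ≡⟨ ∑-cong (λ L → cong (_* lineSum f L) (≡.trans (sym (incidence-sym L x)) (sym (pointSum L)))) ⟩
      ∑ (λ L → lineSum (δ x) L * lineSum f L) ≡⟨ ∑-lineSum-product (δ x) f ⟩
      ∑ (δ x) * ∑ f + 4 * ∑ (λ y → δ x y * f y) ≡⟨ cong₂ _+_ (≡.trans (cong (_* ∑ f) (∑-δˡ x)) (ℕ.*-identityˡ _)) (cong (4 *_) (∑-δ x f)) ⟩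
      ∑ f + 4 * f x ∎
      where
      open ≡-Reasoning
      pointSum : ∀ L → lineSum (δ x) L ≡ incidence L x
      pointSum L = ≡.trans (∑-cong λ j → δ-sym x (pt L j)) (∑≡sum (λ j → δ (pt L j) x))

    ∑-flags : ∀ (φ : Fin 21 → ℕ) f → ∑ (λ L → φ L * lineSum f L) ≡ ∑ (λ x → f x * lineSum φ x)
    ∑-flags φ f = begin
      ∑ (λ L → φ L * lineSum f L) ≡⟨ ∑-cong (λ L → ≡.trans (cong (φ L *_) (lineSum≡ f L)) (sym (∑-*ˡ (φ L) (λ x → incidence L x * f x)))) ⟩
      ∑ (λ L → ∑ (λ x → φ L * (incidence L x * f x))) ≡⟨ ∑-swap _ ⟩
      ∑ (λ x → ∑ (λ L → φ L * (incidence L x * f x))) ≡⟨ ∑-cong (λ x → ≡.trans (∑-cong λ L → ≡.trans (cong (λ n → φ L * (n * f x)) (incidence-sym L x)) (shuffle (φ L) (incidence x L) (f x))) (∑-*ˡ (f x) (λ L → incidence x L * φ L))) ⟩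
      ∑ (λ x → f x * ∑ (λ L → incidence x L * φ L)) ≡⟨ ∑-cong (λ x → cong (f x *_) (sym (lineSum≡ φ x))) ⟩
      ∑ (λ x → f x * lineSum φ x) ∎
      where
      open ≡-Reasoning
      shuffle : ∀ a b c → a * (b * c) ≡ c * (b * a)
      shuffle = solve-∀

    ∑-lineSum : ∀ f → ∑ (lineSum f) ≡ 5 * ∑ f
    ∑-lineSum f = begin
      ∑ (lineSum f) ≡⟨ ∑-cong (λ L → sym (ℕ.*-identityˡ (lineSum f L))) ⟩
      ∑ (λ L → 1 * lineSum f L) ≡⟨ ∑-flags (λ _ → 1) f ⟩
      ∑ (λ x → f x * lineSum (λ _ → 1) x) ≡⟨ ∑-cong (λ x → ≡.trans (cong (f x *_) (∑-const 5 1)) (ℕ.*-comm (f x) 5)) ⟩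
      ∑ (λ x → 5 * f x) ≡⟨ ∑-*ˡ 5 f ⟩
      5 * ∑ f ∎
      where open ≡-Reasoning

    -- Membership in the i-th line through x without x.
    beyond : Fin 21 → Fin 5 → Fin 21 → ℕ
    beyond x i y = sum λ c → δ (others x i c) y

    beyond-others : ∀ x i c → 1 ≤ beyond x i (others x i c)
    beyond-others x i c = subst (1 ≤_) (∑≡sum (λ d → δ (others x i d) (others x i c)))
      (ℕ.≤-trans (ℕ.≤-reflexive (sym (δ-refl (others x i c)))) (≤-∑ (λ d → δ (others x i d) (others x i c)) c))

    ∑-beyond : ∀ x i (g : Fin 21 → ℕ) → ∑ (λ y → beyond x i y * g y) ≡ ∑ (λ c → g (others x i c))
    ∑-beyond x i g = sym (≡.trans (∑-count (others x i) g) (∑-cong λ y → cong (_* g y) (∑≡sum (λ c → δ (others x i c) y))))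

    beyond-ok : Check₄ (λ x y i i′ → if i == i′ then true else (beyond x i y * beyond x i′ y ≡ᵇ 0))
    beyond-ok = by refl

    beyond-disjoint : ∀ x {i i′} → i ≢ i′ → ∀ y → beyond x i y * beyond x i′ y ≡ 0
    beyond-disjoint x {i} {i′} i≢i′ y = ≡ᵇ-sound (beyond x i y * beyond x i′ y) 0
      (go (i == i′) refl (check₄ beyond-ok x y i i′))
      where
      go : ∀ b → (i == i′) ≡ b → (if b then true else (beyond x i y * beyond x i′ y ≡ᵇ 0)) ≡ true →
        (beyond x i y * beyond x i′ y ≡ᵇ 0) ≡ true
      go true  e eq = ⊥-elim (i≢i′ (==-sound e))
      go false e eq = eq

    pt-δ : ∀ x i i′ → δ (pt x i) (pt x i′) ≡ δ i i′
    pt-δ x i i′ = ≡ᵇ-sound _ _ (check₃ ok x i i′)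
      where
      ok : Check₃ (λ x i i′ → δ (pt x i) (pt x i′) ≡ᵇ δ i i′)
      ok = by refl

    -- Together with `pos-correct`, the map from (L , j) to (`pt L j` , `pos L j`) is an involution:
    -- it passes between naming a flag from its line and from its point.
    pos-pos : ∀ L j → pos (pt L j) (pos L j) ≡ j
    pos-pos L j = ==-sound (check₂ ok L j)
      where
      ok : Check₂ (λ L j → pos (pt L j) (pos L j) == j)
      ok = by refl

    flag-count : ∀ x i → ∑ (λ L → ∑ (λ j → δ (pt L j) x * δ (pos L j) i)) ≡ 1
    flag-count x i = ≡.trans (≡.trans (∑-cong λ L → ∑≡sum _) (∑≡sum _)) (≡ᵇ-sound _ 1 (check₂ ok x i))
      where
      ok : Check₂ (λ x i → sum (λ L → sum (λ j → δ (pt L j) x * δ (pos L j) i)) ≡ᵇ 1)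
      ok = by refl

    incidence≤1 : ∀ L x → ∑ (λ j → δ x (pt L j)) ≤ 1
    incidence≤1 L x = ℕ.≤-trans (ℕ.≤-reflexive (∑≡sum _)) (≤ᵇ-sound _ 1 (check₂ ok L x))
      where
      ok : Check₂ (λ L x → sum (λ j → δ x (pt L j)) ≤ᵇ 1)
      ok = by refl

  ∑-flags² : ∀ (φ : Fin 21 → Fin 5 → ℕ) → ∑ (λ L → ∑ (φ L)) ≡ ∑ (λ x → ∑ (λ i → φ (pt x i) (pos x i)))
  ∑-flags² φ = begin
    ∑ (λ L → ∑ (φ L))
      ≡⟨ ∑-cong₂ (λ L j → ≡.trans (cong₂ φ (sym (pos-correct L j)) (sym (pos-pos L j))) (expand (pt L j) (pos L j))) ⟩
    ∑ (λ L → ∑ (λ j → ∑ (λ x → ∑ (λ i → (δ (pt L j) x * δ (pos L j) i) * ψ x i))))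
      ≡⟨ ∑-cong (λ L → ≡.trans (∑-swap _) (∑-cong λ x → ∑-swap _)) ⟩
    ∑ (λ L → ∑ (λ x → ∑ (λ i → ∑ (λ j → (δ (pt L j) x * δ (pos L j) i) * ψ x i))))
      ≡⟨ ≡.trans (∑-swap _) (∑-cong λ x → ∑-swap _) ⟩
    ∑ (λ x → ∑ (λ i → ∑ (λ L → ∑ (λ j → (δ (pt L j) x * δ (pos L j) i) * ψ x i))))
      ≡⟨ ∑-cong₂ (λ x i → ≡.trans (≡.trans (∑-cong λ L → ∑-*ʳ (ψ x i) (λ j → δ (pt L j) x * δ (pos L j) i))
           (∑-*ʳ (ψ x i) (λ L → ∑ (λ j → δ (pt L j) x * δ (pos L j) i)))) (≡.trans (cong (_* ψ x i) (flag-count x i)) (ℕ.*-identityˡ (ψ x i)))) ⟩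
    ∑ (λ x → ∑ (ψ x)) ∎
    where
    open ≡-Reasoning
    ψ : Fin 21 → Fin 5 → ℕ
    ψ x i = φ (pt x i) (pos x i)
    expand : ∀ a b → ψ a b ≡ ∑ (λ x → ∑ (λ i → (δ a x * δ b i) * ψ x i))
    expand a b = sym (≡.trans (∑-cong λ x → ≡.trans (∑-cong λ i → ℕ.*-assoc (δ a x) (δ b i) (ψ x i))
      (≡.trans (∑-*ˡ (δ a x) (λ i → δ b i * ψ x i)) (cong (δ a x *_) (∑-δ b (ψ x))))) (∑-δ a (λ x → ψ x b)))

  ∑-flags-at : ∀ x (φ : Fin 21 → Fin 5 → ℕ) → ∑ (λ L → ∑ (λ j → δ x (pt L j) * φ L j)) ≡ ∑ (λ i → φ (pt x i) (pos x i))
  ∑-flags-at x φ = begin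
    ∑ (λ L → ∑ (λ j → δ x (pt L j) * φ L j))
      ≡⟨ ∑-flags² (λ L j → δ x (pt L j) * φ L j) ⟩
    ∑ (λ y → ∑ (λ i → δ x (pt (pt y i) (pos y i)) * φ (pt y i) (pos y i)))
      ≡⟨ ∑-cong (λ y → ≡.trans (∑-cong λ i → cong (λ z → δ x z * φ (pt y i) (pos y i)) (pos-correct y i)) (∑-*ˡ (δ x y) (λ i → φ (pt y i) (pos y i)))) ⟩
    ∑ (λ y → δ x y * ∑ (λ i → φ (pt y i) (pos y i)))
      ≡⟨ ∑-δ x (λ y → ∑ (λ i → φ (pt y i) (pos y i))) ⟩
    ∑ (λ i → φ (pt x i) (pos x i)) ∎
    where open ≡-Reasoning

-- Counting around a class of at least five points; the case of six.

module Balance where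

  open Prelude
  open Sums
  open Moments using (deviates)
  open LineClasses
  open ProjectivePlane
  import Data.Nat.Base as ℕ
  import Data.Nat.Properties as ℕ
  open import Data.Nat.Tactic.RingSolver using (solve-∀)
  open import Data.Nat.ListAction using () renaming (sum to listSum)
  open import Data.Nat.ListAction.Properties using (sum-↭)
  import Data.Fin.Properties as Fin
  open import Data.List.Base as List using (List; []; _∷_; _++_; tabulate)
  open import Data.List.Properties using (map-tabulate; tabulate-cong)
  open import Data.List.Membership.Propositional using (_∈_)
  open import Data.List.Membership.Propositional.Properties using (∈-tabulate⁺; ∈-tabulate⁻)
  open import Data.List.Relation.Unary.Any using (here; there)
  open import Data.List.Relation.Unary.All as All using (All; []; _∷_)
  import Data.List.Relation.Unary.All.Properties as All
  open import Data.List.Relation.Binary.Permutation.Propositional using (_↭_; refl; prep; swap; ↭-sym; ↭-trans)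
  open import Data.List.Relation.Binary.Permutation.Propositional.Properties using (∈-resp-↭; All-resp-↭; drop-∷; map⁺; shift)

  ∑-list : ∀ {n} (f : Fin n → ℕ) → ∑ f ≡ listSum (tabulate f)
  ∑-list {zero}  f = ∑-zero {f = f} λ ()
  ∑-list {suc n} f = trans (∑-suc f) (cong (f zero +_) (∑-list (f ∘ suc)))

  ∑-punchIn : ∀ {n} (f : Fin (suc n) → ℕ) i → ∑ f ≡ f i + ∑ (f ∘ punchIn i)
  ∑-punchIn f i = trans (∑-list f) (trans (sum-↭ (tabulate-punchIn f i)) (cong (f i +_) (sym (∑-list (f ∘ punchIn i)))))

  ∑≡0 : ∀ {n} {f : Fin n → ℕ} → ∑ f ≡ 0 → ∀ i → f i ≡ 0
  ∑≡0 {f = f} eq i = ℕ.n≤0⇒n≡0 (subst (f i ≤_) eq (≤-∑ f i))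

  ∑-positive : ∀ {n} (f : Fin n → ℕ) → ¬ (∑ f ≡ 0) → ∃ λ i → 1 ≤ f i
  ∑-positive f ≢0 with Fin.any? (λ i → 1 ℕ.≤? f i)
  ... | yes p = p
  ... | no ¬p = ⊥-elim (≢0 (∑-zero λ i → ℕ.n<1⇒n≡0 (ℕ.≰⇒> (λ q → ¬p (i , q)))))

  ∑≡1 : ∀ {n} {f : Fin (suc n) → ℕ} → ∑ f ≡ 1 → ∃ λ i → f i ≡ 1 × ∀ k → f (punchIn i k) ≡ 0
  ∑≡1 {f = f} eq with ∑-positive f (λ z → case (trans (sym eq) z))
    where
    case : ¬ (1 ≡ 0)
    case ()
  ... | i , 1≤fi = i , fi≡1 , ∑≡0 (ℕ.+-cancelˡ-≡ (f i) _ 0 (trans (sym (∑-punchIn f i)) (trans eq (trans (sym fi≡1) (sym (ℕ.+-identityʳ (f i)))))))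
    where
    fi≡1 : f i ≡ 1
    fi≡1 = ℕ.≤-antisym (subst (f i ≤_) eq (≤-∑ f i)) 1≤fi

  Total2 : ∀ {n} → (Fin (suc (suc n)) → ℕ) → Set
  Total2 f = (∃ λ i → f i ≡ 2 × ∀ k → f (punchIn i k) ≡ 0) ⊎
    (∃₂ λ i k → f i ≡ 1 × f (punchIn i k) ≡ 1 × ∀ l → f (punchIn i (punchIn k l)) ≡ 0)

  ∑≡2 : ∀ {n} {f : Fin (suc (suc n)) → ℕ} → ∑ f ≡ 2 → Total2 f
  ∑≡2 {f = f} eq with ∑-positive f (λ z → case (trans (sym eq) z))
    where
    case : ¬ (2 ≡ 0)
    case ()
  ... | i , 1≤fi = go (f i) refl (subst (f i ≤_) eq (≤-∑ f i)) 1≤fi (trans (sym (∑-punchIn f i)) eq)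
    where
    go : ∀ n → f i ≡ n → n ≤ 2 → 1 ≤ n → f i + ∑ (f ∘ punchIn i) ≡ 2 → Total2 f
    go 1 fi _ _ rest with ∑≡1 {f = f ∘ punchIn i} (ℕ.suc-injective (subst (λ n → n + ∑ (f ∘ punchIn i) ≡ 2) fi rest))
    ... | k , fk , zeros = inj₂ (i , k , fi , fk , zeros)
    go 2 fi _ _ rest = inj₁ (i , fi , ∑≡0 (ℕ.suc-injective (ℕ.suc-injective (subst (λ n → n + ∑ (f ∘ punchIn i) ≡ 2) fi rest))))
    go (suc (suc (suc n))) _ (s≤s (s≤s ())) _ _

  ∑-tight : ∀ {n} {f g : Fin n → ℕ} → (∀ i → f i ≤ g i) → ∑ g ≤ ∑ f → ∀ i → f i ≡ g i
  ∑-tight {suc n} {f} {g} f≤g h i = ℕ.≤-antisym (f≤g i) (ℕ.+-cancelʳ-≤ (∑ (f ∘ punchIn i)) (g i) (f i) (begin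
    g i + ∑ (f ∘ punchIn i) ≤⟨ ℕ.+-monoʳ-≤ (g i) (∑-mono (λ k → f≤g (punchIn i k))) ⟩
    g i + ∑ (g ∘ punchIn i) ≡⟨ sym (∑-punchIn g i) ⟩
    ∑ g ≤⟨ h ⟩
    ∑ f ≡⟨ ∑-punchIn f i ⟩
    f i + ∑ (f ∘ punchIn i) ∎))
    where open ℕ.≤-Reasoning

  module Classes (u C : Fin 21 → ℕ)
    (line : ∀ L → LineClass (tabulate (u ∘ pt L)) (C L))
    (sum-u : ∑ u ≡ 84) (sum-C : ∑ C ≡ 1344 + 3 * ∑ (deviates ∘ u))
    (u≤6 : ∀ x → u x ≤ 6) (heavy : ∀ x i → 5 ≤ u x → lineSum u (pt x i) ≤ u x + 16) where

    us : Fin 21 → List ℕ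
    us L = tabulate (u ∘ pt L)

    vs : Fin 21 → Fin 5 → List ℕ
    vs x i = tabulate (u ∘ others x i)

    through : ∀ x i → us (pt x i) ↭ u x ∷ vs x i
    through = tabulate-through u

    through-∈ : ∀ x i → u x ∈ us (pt x i)
    through-∈ x i = ∈-resp-↭ (↭-sym (through x i)) (here refl)

    us≤6 : ∀ L → All (_≤ 6) (us L)
    us≤6 L = All.tabulate⁺ (λ j → u≤6 (pt L j))

    t : Fin 21 → Fin 5 → ℕ
    t x i = lineSum u (pt x i)

    t≡ : ∀ x i → listSum (us (pt x i)) ≡ t x i
    t≡ x i = sym (∑-list (u ∘ pt (pt x i)))

    -- The shortfall against the bound `heavy`. By `∑-deficit` the five shortfalls at x add up to
    -- u(x) - 4, hence to 2 or 1.
    deficit : Fin 21 → Fin 5 → ℕ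
    deficit x i = u x + 16 ∸ t x i

    module _ {x} (5≤u : 5 ≤ u x) where

      t+deficit : ∀ i → t x i + deficit x i ≡ u x + 16
      t+deficit i = ℕ.m+[n∸m]≡n (heavy x i 5≤u)

      ∑-t : 84 + 4 * u x ≡ ∑ (t x)
      ∑-t = sym (trans (∑-through u x) (cong (_+ 4 * u x) {x = ∑ u} {y = 84} sum-u))

      ∑-deficit : ∑ (deficit x) + 4 ≡ u x
      ∑-deficit = ℕ.+-cancelʳ-≡ (80 + 4 * u x) (∑ (deficit x) + 4) (u x) (begin
        ∑ (deficit x) + 4 + (80 + 4 * u x) ≡⟨ shuffle (∑ (deficit x)) (u x) ⟩
        84 + 4 * u x + ∑ (deficit x) ≡⟨ cong (_+ ∑ (deficit x)) {x = 84 + 4 * u x} ∑-t ⟩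
        ∑ (t x) + ∑ (deficit x) ≡⟨ sym (∑-+ (t x) (deficit x)) ⟩
        ∑ (λ i → t x i + deficit x i) ≡⟨ ∑-cong t+deficit ⟩
        ∑ {5} (λ _ → u x + 16) ≡⟨ ∑-const 5 (u x + 16) ⟩
        5 * (u x + 16) ≡⟨ shuffle′ (u x) ⟩
        u x + (80 + 4 * u x) ∎)
        where
        open ≡-Reasoning
        shuffle : ∀ a b → a + 4 + (80 + 4 * b) ≡ 84 + 4 * b + a
        shuffle = solve-∀
        shuffle′ : ∀ a → 5 * (a + 16) ≡ a + (80 + 4 * a)
        shuffle′ = solve-∀

      20≤t : ∀ i → 20 ≤ t x i
      20≤t i = ℕ.+-cancelʳ-≤ (deficit x i) 20 (t x i) (begin
        20 + deficit x i ≡⟨ ℕ.+-comm 20 (deficit x i) ⟩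
        deficit x i + 20 ≤⟨ ℕ.+-monoˡ-≤ 20 (≤-∑ (deficit x) i) ⟩
        ∑ (deficit x) + 20 ≡⟨ sym (ℕ.+-assoc (∑ (deficit x)) 4 16) ⟩
        ∑ (deficit x) + 4 + 16 ≡⟨ cong (_+ 16) ∑-deficit ⟩
        u x + 16 ≡⟨ sym (t+deficit i) ⟩
        t x i + deficit x i ∎)
        where open ℕ.≤-Reasoning

      heavy≤64 : ∀ i → C (pt x i) ≤ 64
      heavy≤64 i = heavy-line (line (pt x i)) (us≤6 (pt x i)) (through-∈ x i) 5≤u
        (subst (20 ≤_) (sym (t≡ x i)) (20≤t i))
        (subst (_≤ 22) (sym (t≡ x i)) (ℕ.≤-trans (heavy x i 5≤u) (ℕ.+-monoˡ-≤ 16 (u≤6 x))))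

      t-value : ∀ {i d} → deficit x i ≡ d → t x i + d ≡ u x + 16
      t-value {i} refl = t+deficit i

    heavy∈ : ∀ M {v} → v ∈ us M → 5 ≤ v → C M ≤ 64
    heavy∈ M i 5≤v with ∈-tabulate⁻ {f = u ∘ pt M} i
    ... | j , refl = subst (λ L → C L ≤ 64) (pos-correct M j) (heavy≤64 5≤v (pos M j))

    deviates≡0 : ∀ v → deviates v ≡ 0 → v ≡ 4
    deviates≡0 v = ℕ.∣m-n∣≡0⇒m≡n ∘ square≡0 ∣ v - 4 ∣
      where
      square≡0 : ∀ n → n * n ≡ 0 → n ≡ 0
      square≡0 zero eq = refl

    light⇒4 : (∀ M → C M ≤ 64) → ∀ x → u x ≡ 4
    light⇒4 light x = deviates≡0 (u x) (∑≡0 {f = deviates ∘ u}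
      (ℕ.m*n≡0⇒m≡0 (∑ (deviates ∘ u)) 3 (trans (ℕ.*-comm (∑ (deviates ∘ u)) 3) (ℕ.n≤0⇒n≡0 (ℕ.+-cancelˡ-≤ 1344 (3 * ∑ (deviates ∘ u)) 0 (begin
        1344 + 3 * ∑ (deviates ∘ u) ≡⟨ sym sum-C ⟩
        ∑ C ≤⟨ ∑-mono light ⟩
        ∑ {21} (λ _ → 64) ≡⟨ ∑-const 21 64 ⟩
        1344 ∎))))) x)
      where open ℕ.≤-Reasoning

    -- For y ≤ 4 this is a result of the search; for y ≥ 5 the line class M passes through a heavy
    -- class.
    one-off : ∀ M {y} → us M ↭ y ∷ 4 ∷ 4 ∷ 4 ∷ 4 ∷ [] → C M ≤ 64
    one-off M {y} p with ℕ.≤-<-connex y 4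
    ... | inj₁ y≤4 = deviation≤ 64 _ (light-4444 y y≤4) ℕ.≤-refl
            (resp-↭ (↭-trans p (↭-sym (shift y (4 ∷ 4 ∷ 4 ∷ 4 ∷ []) []))) (line M))
    ... | inj₂ 4<y = heavy∈ M (∈-resp-↭ (↭-sym p) (here refl)) 4<y

    values : Fin 21 → Fin 21 → Fin 5 → ℕ
    values x M i = u (others x i (meet x M i))

    data Position (x M : Fin 21) : Set where
      on  : ∀ i → M ≡ pt x i → Position x M
      off : (∀ i → M ≢ pt x i) → us M ↭ tabulate (values x M) →
            (∀ i → others x i (meet x M i) ∈ tabulate (pt M)) → Position x M

    position : ∀ x M → Position x M
    position x M = [ (λ (i , eq) → on i eq) , outside ]′ (meets x M)
      where
      outside : tabulate (pt M) ↭ tabulate (λ i → others x i (meet x M i)) → Position x M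
      outside p with Fin.any? (λ i → M Fin.≟ pt x i)
      ... | yes (i , eq) = on i eq
      ... | no ¬on = off (λ i eq → ¬on (i , eq))
            (subst₂ _↭_ (map-tabulate (pt M) u) (map-tabulate (λ i → others x i (meet x M i)) u) (map⁺ u p))
            (λ i → ∈-resp-↭ (↭-sym p) (∈-tabulate⁺ {f = λ i → others x i (meet x M i)} i))

    All-vs : ∀ {P : ℕ → Set} x i → All P (vs x i) → ∀ c → P (u (others x i c))
    All-vs {P} x i h c = All.tabulate⁻ {P = P} {f = u ∘ others x i} h c

    module Six {x} (u≡6 : u x ≡ 6) where

      5≤u : 5 ≤ u x
      5≤u = subst (5 ≤_) (sym u≡6) (ℕ.n≤1+n 5)

      through₆ : ∀ i → us (pt x i) ↭ 6 ∷ vs x i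
      through₆ i = subst (λ n → us (pt x i) ↭ n ∷ vs x i) u≡6 (through x i)

      6∈ : ∀ i → 6 ∈ us (pt x i)
      6∈ i = ∈-resp-↭ (↭-sym (through₆ i)) (here refl)

      tight : ∀ i → deficit x i ≡ 0 → ∀ c → u (others x i c) ≡ 4
      tight i d = All-vs {_≡ 4} x i (All-resp-↭ {P = _≡ 4} (↭-sym (drop-∷ (↭-trans (↭-sym (through₆ i))
          (six-line-22 (line (pt x i)) (us≤6 (pt x i)) (6∈ i) (trans (t≡ x i) t≡22)))))
        (refl ∷ refl ∷ refl ∷ refl ∷ []))
        where
        t≡22 : t x i ≡ 22
        t≡22 = trans (sym (ℕ.+-identityʳ (t x i))) (trans (t-value 5≤u d) (cong (_+ 16) u≡6))

      Allowed : ℕ → Set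
      Allowed v = v ≡ 3 ⊎ v ≡ 4 ⊎ v ≡ 6

      near-tight : ∀ i → deficit x i ≡ 1 → ∀ c → Allowed (u (others x i c))
      near-tight i d = All-vs {Allowed} x i ([ (λ p → All-resp-↭ {P = Allowed} (↭-sym (drop-∷ (↭-trans (↭-sym (through₆ i)) p))) (four ∷ four ∷ four ∷ three ∷ []))
                                   , (λ p → All-resp-↭ {P = Allowed} (↭-sym (drop-∷ (↭-trans (↭-sym (through₆ i)) p))) (six ∷ three ∷ three ∷ three ∷ [])) ]′
        (six-line-21 (line (pt x i)) (us≤6 (pt x i)) (6∈ i) (trans (t≡ x i) t≡21)))
        where
        three : Allowed 3
        three = inj₁ refl
        four : Allowed 4
        four = inj₂ (inj₁ refl)
        six : Allowed 6
        six = inj₂ (inj₂ refl)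
        t≡21 : t x i ≡ 21
        t≡21 = ℕ.+-cancelʳ-≡ 1 (t x i) 21 (trans (t-value 5≤u d) (cong (_+ 16) u≡6))

      two-off : ∀ M {a b} → us M ↭ a ∷ b ∷ 4 ∷ 4 ∷ 4 ∷ [] → Allowed a → Allowed b → C M ≤ 64
      two-off M p (inj₂ (inj₁ refl)) _ = one-off M (↭-trans p (swap 4 _ refl))
      two-off M p _ (inj₂ (inj₁ refl)) = one-off M p
      two-off M p (inj₂ (inj₂ refl)) _ = heavy∈ M (∈-resp-↭ (↭-sym p) (here refl)) (ℕ.n≤1+n 5)
      two-off M p _ (inj₂ (inj₂ refl)) = heavy∈ M (∈-resp-↭ (↭-sym p) (there (here refl))) (ℕ.n≤1+n 5)
      two-off M p (inj₁ refl) (inj₁ refl) = deviation≤ 64 _ light-44433 ℕ.≤-refl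
        (resp-↭ (↭-trans p (↭-sym (++-swap (4 ∷ 4 ∷ 4 ∷ [])))) (line M))
        where
        ++-swap : ∀ xs → xs ++ 3 ∷ 3 ∷ [] ↭ 3 ∷ 3 ∷ xs
        ++-swap []       = refl
        ++-swap (y ∷ ys) = ↭-trans (prep y (++-swap ys)) (↭-trans (swap y 3 refl) (prep 3 (swap y 3 refl)))

      private
        others-tight : ∀ M (i : Fin 5) → (∀ k → deficit x (punchIn i k) ≡ 0) →
          tabulate (values x M) ↭ values x M i ∷ 4 ∷ 4 ∷ 4 ∷ 4 ∷ []
        others-tight M i zeros = subst (λ ws → tabulate (values x M) ↭ values x M i ∷ ws)
          (tabulate-cong {f = values x M ∘ punchIn i} {g = λ _ → 4} (λ k → tight (punchIn i k) (zeros k) (meet x M (punchIn i k))))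
          (tabulate-punchIn (values x M) i)

        others-tight₂ : ∀ M (i : Fin 5) (k : Fin 4) → (∀ l → deficit x (punchIn i (punchIn k l)) ≡ 0) →
          tabulate (values x M) ↭ values x M i ∷ values x M (punchIn i k) ∷ 4 ∷ 4 ∷ 4 ∷ []
        others-tight₂ M i k zeros = ↭-trans (tabulate-punchIn (values x M) i) (prep (values x M i)
          (subst (λ ws → tabulate (values x M ∘ punchIn i) ↭ values x M (punchIn i k) ∷ ws)
            (tabulate-cong {f = values x M ∘ punchIn i ∘ punchIn k} {g = λ _ → 4}
              (λ l → tight (punchIn i (punchIn k l)) (zeros l) (meet x M (punchIn i (punchIn k l)))))
            (tabulate-punchIn (values x M ∘ punchIn i) k)))

      -- The shortfalls add up to 2, so at least three of the line classes through x have none and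
      -- consist of classes of size 4 apart from x. A line class M off x meets them in size 4. Its
      -- remaining one or two sizes fall under `one-off` and `two-off`.
      all-light : ∀ M → C M ≤ 64
      all-light M = go (position x M) (∑≡2 {f = deficit x} (ℕ.+-cancelʳ-≡ 4 (∑ (deficit x)) 2 (trans (∑-deficit 5≤u) u≡6)))
        where
        go : Position x M → Total2 (deficit x) → C M ≤ 64
        go (on i refl)   _ = heavy≤64 5≤u i
        go (off _ p _) (inj₁ (i , _ , zeros)) = one-off M {values x M i} (↭-trans p (others-tight M i zeros))
        go (off _ p _) (inj₂ (i , k , di , dk , zeros)) = two-off M {values x M i} {values x M (punchIn i k)}
          (↭-trans p (others-tight₂ M i k zeros))
          (near-tight i di (meet x M i)) (near-tight (punchIn i k) dk (meet x M (punchIn i k)))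

      contradiction : ⊥
      contradiction = 6≢4 (trans (sym u≡6) (light⇒4 all-light x))
        where
        6≢4 : 6 ≢ 4
        6≢4 ()

-- Special, flat and rich line classes through a class of five points.

module FivePoints where

  open Prelude
  open Sums
  open Moments using (deviates)
  open Search using (bounded)
  open LineClasses
  open ProjectivePlane
  open Balance
  import Data.Nat.Base as ℕ
  import Data.Nat.Properties as ℕ
  open import Data.Nat.Tactic.RingSolver using (solve-∀)
  open import Data.Nat.ListAction using () renaming (sum to listSum)
  open import Data.Nat.ListAction.Properties using (sum-↭)
  import Data.Fin.Properties as Fin
  open import Data.List.Base as List using (List; []; _∷_; _++_; tabulate; map; length)
  open import Data.List.Properties using (∷-injectiveˡ; ∷-injectiveʳ; map-tabulate; ++-identityʳ; map-++; length-++; tabulate-cong)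
  open import Data.List.Membership.Propositional using (_∈_)
  open import Data.List.Membership.Propositional.Properties using (∈-++⁺ˡ; ∈-tabulate⁺; ∈-tabulate⁻)
  open import Data.List.Relation.Unary.Any using (here; there)
  open import Data.List.Relation.Unary.All as All using (All; []; _∷_)
  import Data.List.Relation.Unary.All.Properties as All
  import Data.List.Relation.Unary.AllPairs as AllPairs
  import Data.List.Relation.Binary.Permutation.Setoid.Properties as Setoid
  open import Data.List.Relation.Unary.Unique.Propositional using (Unique; []; _∷_)
  open import Data.List.Relation.Unary.Unique.Propositional.Properties using (tabulate⁺)
  open import Data.List.Relation.Binary.Permutation.Propositional using (_↭_; refl; prep; ↭-sym; ↭-trans; ↭-reflexive; ↭⇒↭ₛ)
  open import Data.List.Relation.Binary.Permutation.Propositional.Properties using (∈-resp-↭; All-resp-↭; drop-∷; map⁺; ↭-length; ↭-reverse; shift)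

  ≡3 ≡5 ≤2 : ℕ → ℕ
  ≡3 3 = 1
  ≡3 _ = 0
  ≡5 5 = 1
  ≡5 _ = 0
  ≤2 0 = 1
  ≤2 1 = 1
  ≤2 2 = 1
  ≤2 _ = 0

  partition : ∀ {A : Set} {P Q : A → Set} {xs : List A} → All (λ x → P x ⊎ Q x) xs →
    ∃₂ λ ys zs → xs ↭ ys ++ zs × All P ys × All Q zs
  partition [] = [] , [] , refl , [] , []
  partition (h ∷ hs) with partition hs
  partition {xs = x ∷ _} (inj₁ p ∷ hs) | ys , zs , perm , ps , qs = x ∷ ys , zs , prep x perm , p ∷ ps , qs
  partition {xs = x ∷ _} (inj₂ q ∷ hs) | ys , zs , perm , ps , qs =
    ys , x ∷ zs , ↭-trans (prep x perm) (↭-sym (shift x ys zs)) , ps , q ∷ qs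

  ≥-∑-map : ∀ {A : Set} (f : A → ℕ) {m n} ys zs → All (λ y → m ≤ f y) ys → All (λ z → n ≤ f z) zs →
    m * length ys + n * length zs ≤ listSum (map f (ys ++ zs))
  ≥-∑-map f {m} {n} [] zs _ hs = subst (_≤ listSum (map f zs)) (sym (cong (_+ n * length zs) (ℕ.*-zeroʳ m))) (go zs hs)
    where
    go : ∀ zs → All (λ z → n ≤ f z) zs → n * length zs ≤ listSum (map f zs)
    go [] [] = ℕ.≤-reflexive (ℕ.*-zeroʳ n)
    go (z ∷ zs) (h ∷ hs) = ℕ.≤-trans (ℕ.≤-reflexive (ℕ.*-suc n (length zs))) (ℕ.+-mono-≤ h (go zs hs))
  ≥-∑-map f {m} {n} (y ∷ ys) zs (h ∷ hs) hs′ = ℕ.≤-trans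
    (ℕ.≤-reflexive (trans (cong (_+ n * length zs) (ℕ.*-suc m (length ys))) (ℕ.+-assoc m (m * length ys) (n * length zs))))
    (ℕ.+-mono-≤ h (≥-∑-map f ys zs hs hs′))

  -- Bounds for a line class that meets a rich lines through x in classes of size 3,
  -- the flat ones in classes of size 4 and the special one in a class of size z.
  excess : (a z : ℕ) → ℕ
  excess 1 z = if z ≤ᵇ 2 then 82 else 64
  excess _ z = if z ≤ᵇ 2 then 86 else 68

  exterior : (a z : ℕ) → List ℕ
  exterior 1 z = z ∷ 3 ∷ 4 ∷ 4 ∷ 4 ∷ []
  exterior 2 z = z ∷ 3 ∷ 3 ∷ 4 ∷ 4 ∷ []
  exterior _ z = z ∷ 3 ∷ 3 ∷ 3 ∷ 4 ∷ []

  record ExteriorBounded : Set where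
    constructor by
    field
      holds : upTo? 2 (λ a → upTo? 3 λ z → bounded 1 (excess (suc a) (suc z)) (List.reverse (exterior (suc a) (suc z)))) ≡ true

  exterior-bounded : ExteriorBounded
  exterior-bounded = by refl

  module Fives (u C : Fin 21 → ℕ)
    (line : ∀ L → LineClass (tabulate (u ∘ pt L)) (C L))
    (sum-u : ∑ u ≡ 84) (sum-C : ∑ C ≡ 1344 + 3 * ∑ (deviates ∘ u))
    (u≤6 : ∀ x → u x ≤ 6) (heavy : ∀ x i → 5 ≤ u x → lineSum u (pt x i) ≤ u x + 16)
    (u≤5 : ∀ x → u x ≤ 5) where

    open Classes u C line sum-u sum-C u≤6 heavy

    us≤5 : ∀ L → All (_≤ 5) (us L)
    us≤5 L = All.tabulate⁺ (λ j → u≤5 (pt L j))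

    lineSum-list : ∀ (f : ℕ → ℕ) L {ws} → us L ↭ ws → lineSum (f ∘ u) L ≡ listSum (map f ws)
    lineSum-list f L p = trans (∑-list (f ∘ u ∘ pt L))
      (trans (cong listSum (sym (map-tabulate (u ∘ pt L) f))) (sum-↭ (map⁺ f p)))

    vs-list : ∀ (f : ℕ → ℕ) x i {ws} → vs x i ↭ ws → ∑ (λ c → f (u (others x i c))) ≡ listSum (map f ws)
    vs-list f x i p = trans (∑-list (f ∘ u ∘ others x i))
      (trans (cong listSum (sym (map-tabulate (u ∘ others x i) f))) (sum-↭ (map⁺ f p)))

    -- Through a class x of size 5 there is one special line class of total size 20,
    -- and four of total size 21 with sizes (5, 4, 4, 4, 4) or (5, 5, 5, 3, 3).
    Flat Rich : Fin 21 → Fin 5 → Set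
    Flat x i = vs x i ↭ 4 ∷ 4 ∷ 4 ∷ 4 ∷ []
    Rich x i = vs x i ↭ 5 ∷ 5 ∷ 3 ∷ 3 ∷ []

    module _ {x} (u≡5 : u x ≡ 5) where

      5≤u : 5 ≤ u x
      5≤u = ℕ.≤-reflexive (sym u≡5)

      through₅ : ∀ i {ws} → vs x i ↭ ws → us (pt x i) ↭ 5 ∷ ws
      through₅ i p = ↭-trans (subst (λ n → us (pt x i) ↭ n ∷ vs x i) u≡5 (through x i)) (prep 5 p)

      5∈ : ∀ i → 5 ∈ us (pt x i)
      5∈ i = ∈-resp-↭ (↭-sym (through₅ i refl)) (here refl)

      private opaque
        special : ∃ λ i → deficit x i ≡ 1 × ∀ k → deficit x (punchIn i k) ≡ 0
        special = ∑≡1 {f = deficit x} (ℕ.+-cancelʳ-≡ 4 (∑ (deficit x)) 1 (trans (∑-deficit 5≤u) u≡5))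

      i₀ : Fin 5
      i₀ = proj₁ special

      t₀ : t x i₀ ≡ 20
      t₀ = ℕ.+-cancelʳ-≡ 1 (t x i₀) 20 (trans (t-value 5≤u (proj₁ (proj₂ special))) (cong (_+ 16) u≡5))

      t₁ : ∀ k → t x (punchIn i₀ k) ≡ 21
      t₁ k = trans (sym (ℕ.+-identityʳ _)) (trans (t-value 5≤u (proj₂ (proj₂ special) k)) (cong (_+ 16) u≡5))

      flat⊎rich : ∀ k → Rich x (punchIn i₀ k) ⊎ Flat x (punchIn i₀ k)
      flat⊎rich k = [ (λ p → inj₂ (drop-∷ (↭-trans (↭-sym (through₅ i refl)) p)))
                    , (λ p → inj₁ (drop-∷ (↭-trans (↭-sym (through₅ i refl)) p))) ]′
        (five-line-21 (line (pt x i)) (us≤6 (pt x i)) (5∈ i) (us≤5 (pt x i)) (trans (t≡ x i) (t₁ k)))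
        where i = punchIn i₀ k

      special-≥1 : ∀ c → 1 ≤ u (others x i₀ c)
      special-≥1 = All-vs x i₀ (All.tail (All-resp-↭ (through₅ i₀ refl)
        (five-line-20 (line (pt x i₀)) (us≤6 (pt x i₀)) (5∈ i₀) (us≤5 (pt x i₀)) (trans (t≡ x i₀) t₀))))

      special-sum : ∑ (λ c → u (others x i₀ c)) ≡ 15
      special-sum = ℕ.+-cancelˡ-≡ 5 _ 15 (trans (cong (5 +_) (∑-list (u ∘ others x i₀)))
        (trans (sym (sum-↭ (through₅ i₀ refl))) (trans (t≡ x i₀) t₀)))

      -- Four sizes of at most 5 have to add up to 15. Each size of at most 2 costs at least 3 of
      -- the available 20, and two would cost 6.
      special-≤2 : ∑ (λ c → ≤2 (u (others x i₀ c))) ≤ 1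
      special-≤2 = bound (∑ (λ c → ≤2 (u (others x i₀ c)))) (begin
        3 * ∑ (λ c → ≤2 (u (others x i₀ c))) + 15
          ≡⟨ cong₂ _+_ (sym (∑-*ˡ 3 (λ c → ≤2 (u (others x i₀ c))))) (sym special-sum) ⟩
        ∑ (λ c → 3 * ≤2 (u (others x i₀ c))) + ∑ (λ c → u (others x i₀ c))
          ≡⟨ sym (∑-+ (λ c → 3 * ≤2 (u (others x i₀ c))) (λ c → u (others x i₀ c))) ⟩
        ∑ (λ c → 3 * ≤2 (u (others x i₀ c)) + u (others x i₀ c))
          ≤⟨ ∑-mono (λ c → pointwise (u (others x i₀ c)) (u≤5 _)) ⟩
        ∑ {4} (λ _ → 5) ≡⟨ ∑-const 4 5 ⟩
        20 ∎)
        where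
        open ℕ.≤-Reasoning
        pointwise : ∀ v → v ≤ 5 → 3 * ≤2 v + v ≤ 5
        pointwise 0 _ = ≤ᵇ-sound 3 5 refl
        pointwise 1 _ = ≤ᵇ-sound 4 5 refl
        pointwise 2 _ = ≤ᵇ-sound 5 5 refl
        pointwise (suc (suc (suc v))) h = h
        bound : ∀ n → 3 * n + 15 ≤ 20 → n ≤ 1
        bound 0 _ = z≤n
        bound 1 _ = ℕ.≤-refl
        bound (suc (suc n)) h = ⊥-elim (ℕ.<⇒≱ (≤ᵇ-sound 21 21 refl)
          (ℕ.≤-trans (ℕ.+-monoˡ-≤ 15 (ℕ.*-monoʳ-≤ 3 (s≤s (s≤s (z≤n {n}))))) h))

      -- By `special-≥1`, three further classes of size 5 would bring the sum to at least 16.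
      special-≡5 : ∑ (λ c → ≡5 (u (others x i₀ c))) ≤ 2
      special-≡5 = bound (∑ (λ c → ≡5 (u (others x i₀ c)))) (begin
        4 * ∑ (λ c → ≡5 (u (others x i₀ c))) + 4
          ≡⟨ cong₂ _+_ (sym (∑-*ˡ 4 (λ c → ≡5 (u (others x i₀ c))))) (sym (∑-const 4 1)) ⟩
        ∑ (λ c → 4 * ≡5 (u (others x i₀ c))) + ∑ {4} (λ _ → 1)
          ≡⟨ sym (∑-+ (λ c → 4 * ≡5 (u (others x i₀ c))) (λ _ → 1)) ⟩
        ∑ (λ c → 4 * ≡5 (u (others x i₀ c)) + 1)
          ≤⟨ ∑-mono (λ c → pointwise (u (others x i₀ c)) (special-≥1 c)) ⟩
        ∑ (λ c → u (others x i₀ c)) ≡⟨ special-sum ⟩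
        15 ∎)
        where
        open ℕ.≤-Reasoning
        pointwise : ∀ v → 1 ≤ v → 4 * ≡5 v + 1 ≤ v
        pointwise 1 h = h
        pointwise 2 h = s≤s z≤n
        pointwise 3 h = s≤s z≤n
        pointwise 4 h = s≤s z≤n
        pointwise 5 h = ℕ.≤-refl
        pointwise (suc (suc (suc (suc (suc (suc v)))))) h = s≤s z≤n
        bound : ∀ n → 4 * n + 4 ≤ 15 → n ≤ 2
        bound 0 _ = z≤n
        bound 1 _ = s≤s z≤n
        bound 2 _ = ℕ.≤-refl
        bound (suc (suc (suc n))) h = ⊥-elim (ℕ.<⇒≱ (≤ᵇ-sound 16 16 refl)
          (ℕ.≤-trans (ℕ.+-monoˡ-≤ 4 (ℕ.*-monoʳ-≤ 4 (s≤s (s≤s (s≤s (z≤n {n})))))) h))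

      special-deviates : 1 ≤ ∑ (λ c → deviates (u (others x i₀ c)))
      special-deviates = ℕ.n≢0⇒n>0 λ z → case (trans (sym special-sum)
        (trans (∑-cong λ c → deviates≡0 (u (others x i₀ c)) (∑≡0 {f = λ c → deviates (u (others x i₀ c))} z c)) (∑-const 4 4)))
        where
        case : ¬ (15 ≡ 16)
        case ()

      side : Fin 5 → (ℕ → ℕ) → Fin 21 → ℕ
      side i f y = beyond x i y * f (u y)

      ∑-side : ∀ i f → ∑ (side i f) ≡ ∑ (λ c → f (u (others x i c)))
      ∑-side i f = ∑-beyond x i (f ∘ u)

      ∑-side-disjoint : ∀ {i i′} → i ≢ i′ → ∀ f f′ → ∑ (λ y → side i f y * side i′ f′ y) ≡ 0
      ∑-side-disjoint {i} {i′} i≢i′ f f′ = ∑-zero λ y → trans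
        (shuffle (beyond x i y) (f (u y)) (beyond x i′ y) (f′ (u y)))
        (cong (_* (f (u y) * f′ (u y))) (beyond-disjoint x i≢i′ y))
        where
        shuffle : ∀ a b c d → (a * b) * (c * d) ≡ (a * c) * (b * d)
        shuffle = solve-∀

      ∑-rich : ∀ {i} → Rich x i → ∑ (side i ≡3) ≤ 2
      ∑-rich {i} p = ℕ.≤-reflexive (trans (∑-side i ≡3) (vs-list ≡3 x i p))

      lineSum-side : ∀ M i f → others x i (meet x M i) ∈ tabulate (pt M) → 1 ≤ f (values x M i) → 1 ≤ lineSum (side i f) M
      lineSum-side M i f m 1≤f = go (∈-tabulate⁻ {f = pt M} m)
        where
        go : (∃ λ j → others x i (meet x M i) ≡ pt M j) → 1 ≤ lineSum (side i f) M
        go (j , eq) = ℕ.≤-trans (subst (λ y → 1 ≤ side i f y) eq (ℕ.*-mono-≤ (beyond-others x i (meet x M i)) 1≤f))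
          (≤-∑ (λ j → side i f (pt M j)) j)

      irregularity : Fin 5 → ℕ
      irregularity i = ∑ λ c → deviates (u (others x i c))

      isZero : ℕ → ℕ
      isZero zero    = 1
      isZero (suc n) = 0

      flat : Fin 5 → ℕ
      flat i = isZero (irregularity i)

      flat-1 : ∀ {i} → Flat x i → 1 ≤ flat i
      flat-1 {i} p = ℕ.≤-reflexive (sym (cong isZero (vs-list deviates x i p)))

      -- Vanishing irregularity means that the four classes other than x have size 4, so
      -- `tight-five-line` gives 36 in place of 64.
      flat-cost : ∀ i → C (pt x i) + 28 * flat i ≤ 64
      flat-cost i = go (irregularity i) refl
        where
        go : ∀ n → irregularity i ≡ n → C (pt x i) + 28 * isZero n ≤ 64
        go (suc n) _  = ℕ.≤-trans (ℕ.≤-reflexive (ℕ.+-identityʳ _)) (heavy≤64 5≤u i)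
        go zero    eq = ℕ.+-monoˡ-≤ 28 (tight-five-line (line (pt x i)) (through₅ i (↭-reflexive
          (tabulate-cong {f = u ∘ others x i} {g = λ _ → 4} (λ c → deviates≡0 (u (others x i c)) (∑≡0 {f = λ c → deviates (u (others x i c))} eq c))))))

      flatOn : Fin 21 → ℕ
      flatOn M = ∑ λ i → flat i * δ (pt x i) M

      flatOn-pt : ∀ i → flatOn (pt x i) ≡ flat i
      flatOn-pt i = trans (∑-cong λ i′ → trans (cong (flat i′ *_) (trans (pt-δ x i′ i) (δ-sym i′ i))) (ℕ.*-comm (flat i′) (δ i i′))) (∑-δ i flat)

      flatOn-off : ∀ {M} → (∀ i → M ≢ pt x i) → flatOn M ≡ 0
      flatOn-off h = ∑-zero λ i → trans (cong (flat i *_) (δ-≢ (λ eq → h i (sym eq)))) (ℕ.*-zeroʳ (flat i))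

      ∑-flatOn : ∑ flatOn ≡ ∑ flat
      ∑-flatOn = trans (∑-swap (λ M i → flat i * δ (pt x i) M))
        (∑-cong λ i → trans (∑-*ˡ (flat i) (δ (pt x i))) (trans (cong (flat i *_) (∑-δˡ (pt x i))) (ℕ.*-identityʳ (flat i))))

      -- The surplus over 64 is charged to pairs of marked classes on M: f and g mark classes of
      -- size 3 on two rich lines through x, l those of size at most 2 on the special one. The rates
      -- 4 and 18 cover the values 68, 82 and 86 of `excess`.
      Bound : (f g l : Fin 21 → ℕ) → Fin 21 → Set
      Bound f g l M = C M ≤ 64 + 4 * (lineSum f M * lineSum g M) + 18 * (lineSum f M * lineSum l M)

      -- Two distinct marked classes lie on just one common line, so there are at most 2 · 2 pairs
      -- at rate 4 and 2 · 1 at rate 18; the two vanishing sums exclude coincidences. This gives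
      -- 1396 = 21 · 64 + 4 · 4 + 18 · 2, and the term with 28 collects the savings of the flat line
      -- classes.
      weigh : ∀ f g l → ∑ f ≤ 2 → ∑ g ≤ 2 → ∑ l ≤ 1 →
        ∑ (λ y → f y * g y) ≡ 0 → ∑ (λ y → f y * l y) ≡ 0 →
        (∀ M → (∀ i → M ≢ pt x i) → us M ↭ tabulate (values x M) →
          (∀ i → others x i (meet x M i) ∈ tabulate (pt M)) → Bound f g l M) →
        ∑ C + 28 * ∑ flat ≤ 1396
      weigh f g l f≤2 g≤2 l≤1 fg fl outside = begin
        ∑ C + 28 * ∑ flat
          ≡⟨ cong (∑ C +_) (trans (cong (28 *_) (sym ∑-flatOn)) (sym (∑-*ˡ 28 flatOn))) ⟩
        ∑ C + ∑ (λ M → 28 * flatOn M)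
          ≡⟨ sym (∑-+ C (λ M → 28 * flatOn M)) ⟩
        ∑ (λ M → C M + 28 * flatOn M)
          ≤⟨ ∑-mono (λ M → pointwise M (position x M)) ⟩
        ∑ (λ M → 64 + 4 * (lineSum f M * lineSum g M) + 18 * (lineSum f M * lineSum l M))
          ≡⟨ trans (∑-+ (λ M → 64 + 4 * (lineSum f M * lineSum g M)) (λ M → 18 * (lineSum f M * lineSum l M)))
               (cong₂ _+_ (trans (∑-+ (λ _ → 64) (λ M → 4 * (lineSum f M * lineSum g M)))
                 (cong₂ _+_ (∑-const 21 64) (trans (∑-*ˡ 4 (λ M → lineSum f M * lineSum g M)) (cong (4 *_) (∑-lineSum-product f g)))))
                 (trans (∑-*ˡ 18 (λ M → lineSum f M * lineSum l M)) (cong (18 *_) (∑-lineSum-product f l)))) ⟩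
        1344 + 4 * (∑ f * ∑ g + 4 * ∑ (λ y → f y * g y)) + 18 * (∑ f * ∑ l + 4 * ∑ (λ y → f y * l y))
          ≡⟨ cong₂ (λ a b → 1344 + 4 * (∑ f * ∑ g + 4 * a) + 18 * (∑ f * ∑ l + 4 * b)) fg fl ⟩
        1344 + 4 * (∑ f * ∑ g + 0) + 18 * (∑ f * ∑ l + 0)
          ≤⟨ ℕ.+-mono-≤ (ℕ.+-monoʳ-≤ 1344 (ℕ.*-monoʳ-≤ 4 (ℕ.+-monoˡ-≤ 0 (ℕ.*-mono-≤ f≤2 g≤2))))
               (ℕ.*-monoʳ-≤ 18 (ℕ.+-monoˡ-≤ 0 (ℕ.*-mono-≤ f≤2 l≤1))) ⟩
        1396 ∎
        where
        open ℕ.≤-Reasoning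
        pointwise : ∀ M → Position x M →
          C M + 28 * flatOn M ≤ 64 + 4 * (lineSum f M * lineSum g M) + 18 * (lineSum f M * lineSum l M)
        pointwise M (on i refl) = ℕ.≤-trans (subst (λ n → C (pt x i) + 28 * n ≤ 64) (sym (flatOn-pt i)) (flat-cost i))
          (ℕ.≤-trans (ℕ.m≤m+n 64 (4 * (lineSum f M * lineSum g M))) (ℕ.m≤m+n _ (18 * (lineSum f M * lineSum l M))))
        pointwise M (off h p m) = ℕ.≤-trans (ℕ.≤-reflexive (trans (cong (λ n → C M + 28 * n) (flatOn-off h)) (ℕ.+-identityʳ (C M)))) (outside M h p m)

      rich-value : ∀ {i} → Rich x i → ∀ c → u (others x i c) ≡ 5 ⊎ u (others x i c) ≡ 3
      rich-value {i} p = All-vs {λ v → v ≡ 5 ⊎ v ≡ 3} x i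
        (All-resp-↭ {P = λ v → v ≡ 5 ⊎ v ≡ 3} (↭-sym p) (inj₁ refl ∷ inj₁ refl ∷ inj₂ refl ∷ inj₂ refl ∷ []))

      flat-value : ∀ {i} → Flat x i → ∀ c → u (others x i c) ≡ 4
      flat-value {i} p = All-vs {_≡ 4} x i (All-resp-↭ {P = _≡ 4} (↭-sym p) (refl ∷ refl ∷ refl ∷ refl ∷ []))

      map-flat : ∀ M {is} → All (Flat x) is → map (values x M) is ≡ List.replicate (length is) 4
      map-flat M []       = refl
      map-flat M {i ∷ _} (p ∷ ps) = cong₂ _∷_ (flat-value p (meet x M i)) (map-flat M ps)

      module Split {bs as : List (Fin 5)} (perm : tabulate (punchIn i₀) ↭ bs ++ as)
        (rich : All (Rich x) bs) (flats : All (Flat x) as) where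

        us-off : ∀ M → us M ↭ tabulate (values x M) →
          us M ↭ values x M i₀ ∷ (map (values x M) bs ++ List.replicate (length as) 4)
        us-off M p = ↭-trans p (↭-trans (tabulate-punchIn (values x M) i₀) (prep (values x M i₀)
          (subst₂ _↭_ (map-tabulate (punchIn i₀) (values x M))
            (trans (map-++ (values x M) bs as) (cong (map (values x M) bs ++_) (map-flat M flats)))
            (map⁺ (values x M) perm))))

        distinct : Unique (bs ++ as)
        distinct = Setoid.Unique-resp-↭ (setoid (Fin 5)) (↭⇒↭ₛ perm)
          (tabulate⁺ {f = punchIn i₀} (λ {k} {l} → Fin.punchIn-injective i₀ k l))

        not-special : All (λ i → i ≢ i₀) (bs ++ as)
        not-special = All-resp-↭ {P = λ i → i ≢ i₀} perm (All.tabulate⁺ {f = punchIn i₀} (Fin.punchInᵢ≢i i₀))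

        -- The sum over the five line classes through x counts x itself, with (5 - 4)² = 1, four
        -- times too often. A rich line class contributes 5, a flat one 1, and the special one at
        -- least 2, since its other four sizes add up to 15 and cannot all be 4.
        few-deviate : 2 + (5 * length bs + 1 * length as) ≤ ∑ (deviates ∘ u) + 4
        few-deviate = begin
          2 + (5 * length bs + 1 * length as)
            ≤⟨ ℕ.+-mono-≤ special-line (≥-∑-map e bs as (All.map heavyline rich) (All.map lightline flats)) ⟩
          e i₀ + listSum (map e (bs ++ as))
            ≡⟨ cong (e i₀ +_) (trans (sym (sum-↭ (map⁺ e perm)))
                 (trans (cong listSum (map-tabulate (punchIn i₀) e)) (sym (∑-list (e ∘ punchIn i₀))))) ⟩
          e i₀ + ∑ (e ∘ punchIn i₀)
            ≡⟨ sym (∑-punchIn e i₀) ⟩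
          ∑ e
            ≡⟨ ∑-through (deviates ∘ u) x ⟩
          ∑ (deviates ∘ u) + 4 * deviates (u x)
            ≡⟨ cong (λ n → ∑ (deviates ∘ u) + 4 * deviates n) u≡5 ⟩
          ∑ (deviates ∘ u) + 4 ∎
          where
          open ℕ.≤-Reasoning
          e : Fin 5 → ℕ
          e i = lineSum (deviates ∘ u) (pt x i)
          heavyline : ∀ {i} → Rich x i → 5 ≤ e i
          heavyline {i} p = ℕ.≤-reflexive (sym (lineSum-list deviates (pt x i) (through₅ i p)))
          lightline : ∀ {i} → Flat x i → 1 ≤ e i
          lightline {i} p = ℕ.≤-reflexive (sym (lineSum-list deviates (pt x i) (through₅ i p)))
          special-line : 2 ≤ e i₀
          special-line = ℕ.≤-trans (s≤s special-deviates) (ℕ.≤-reflexive (sym (trans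
            (lineSum-list deviates (pt x i₀) (through₅ i₀ refl))
            (cong suc (trans (cong listSum (map-tabulate (u ∘ others x i₀) deviates)) (sym (∑-list (deviates ∘ u ∘ others x i₀))))))))

        enough-flat : length as ≤ ∑ flat
        enough-flat = begin
          length as ≡⟨ sym (ℕ.*-identityˡ (length as)) ⟩
          0 * length bs + 1 * length as ≤⟨ ≥-∑-map flat bs as (All.map (λ _ → z≤n) rich) (All.map flat-1 flats) ⟩
          listSum (map flat (bs ++ as)) ≡⟨ trans (sym (sum-↭ (map⁺ flat perm)))
                                                    (trans (cong listSum (map-tabulate (punchIn i₀) flat)) (sym (∑-list (flat ∘ punchIn i₀)))) ⟩
          ∑ (flat ∘ punchIn i₀) ≤⟨ ℕ.m≤n+m _ (flat i₀) ⟩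
          flat i₀ + ∑ (flat ∘ punchIn i₀) ≡⟨ sym (∑-punchIn flat i₀) ⟩
          ∑ flat ∎
          where open ℕ.≤-Reasoning

        -- The identity for Σ C(L) turns the upper bound of `weigh` against the lower bound of
        -- `few-deviate`. The gap 1408 - 1396 is 3 · 4, for the repeated count of x.
        balance : ∑ C + 28 * ∑ flat ≤ 1396 → 1344 + 3 * (2 + (5 * length bs + 1 * length as)) + 28 * length as ≤ 1408
        balance h = begin
          1344 + 3 * (2 + (5 * length bs + 1 * length as)) + 28 * length as
            ≤⟨ ℕ.+-mono-≤ (ℕ.+-monoʳ-≤ 1344 (ℕ.*-monoʳ-≤ 3 few-deviate)) (ℕ.*-monoʳ-≤ 28 enough-flat) ⟩
          1344 + 3 * (∑ (deviates ∘ u) + 4) + 28 * ∑ flat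
            ≡⟨ shuffle (∑ (deviates ∘ u)) (∑ flat) ⟩
          (1344 + 3 * ∑ (deviates ∘ u)) + 28 * ∑ flat + 12
            ≡⟨ cong (λ n → n + 28 * ∑ flat + 12) (sym sum-C) ⟩
          ∑ C + 28 * ∑ flat + 12
            ≤⟨ ℕ.+-monoˡ-≤ 12 h ⟩
          1408 ∎
          where
          open ℕ.≤-Reasoning
          shuffle : ∀ d n → 1344 + 3 * (d + 4) + 28 * n ≡ (1344 + 3 * d) + 28 * n + 12
          shuffle = solve-∀

      exterior-light : ∀ a z M → a ≤ 2 → z ≤ 3 → us M ↭ exterior (suc a) (suc z) → C M ≤ excess (suc a) (suc z)
      exterior-light a z M a≤2 z≤3 p = deviation≤ (excess (suc a) (suc z)) (List.reverse (exterior (suc a) (suc z)))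
        (upTo?-sound 3 (λ z → bounded 1 (excess (suc a) (suc z)) (List.reverse (exterior (suc a) (suc z))))
          (upTo?-sound 2 (λ a → upTo? 3 λ z → bounded 1 (excess (suc a) (suc z)) (List.reverse (exterior (suc a) (suc z))))
            (ExteriorBounded.holds exterior-bounded) a a≤2) z z≤3)
        (64≤excess a z) (resp-↭ (↭-trans p (↭-sym (↭-reverse (exterior (suc a) (suc z))))) (line M))
        where
        64≤if : ∀ b {m n} → 64 ≤ m → 64 ≤ n → 64 ≤ (if b then m else n)
        64≤if true  h h′ = h
        64≤if false h h′ = h′
        64≤excess : ∀ a z → 64 ≤ excess (suc a) (suc z)
        64≤excess zero    z = 64≤if (suc z ≤ᵇ 2) (≤ᵇ-sound 64 82 refl) ℕ.≤-refl
        64≤excess (suc a) z = 64≤if (suc z ≤ᵇ 2) (≤ᵇ-sound 64 86 refl) (≤ᵇ-sound 64 68 refl)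

      low : Fin 21 → ℕ
      low = side i₀ ≤2

      ∑-low : ∑ low ≤ 1
      ∑-low = ℕ.≤-trans (ℕ.≤-reflexive (∑-side i₀ ≤2)) special-≤2

      module Exterior (M : Fin 21) (on-M : ∀ i → others x i (meet x M i) ∈ tabulate (pt M)) where

        light : ∀ f g l → C M ≤ 64 → Bound f g l M
        light f g l h = ℕ.≤-trans h (ℕ.≤-trans (ℕ.m≤m+n 64 (4 * (lineSum f M * lineSum g M))) (ℕ.m≤m+n _ (18 * (lineSum f M * lineSum l M))))

        meets-rich : ∀ {i} → values x M i ≡ 3 → 1 ≤ lineSum (side i ≡3) M
        meets-rich {i} eq = lineSum-side M i ≡3 (on-M i) (ℕ.≤-reflexive (sym (cong ≡3 eq)))

        meets-low : ∀ {v} → 1 ≤ ≤2 v → values x M i₀ ≡ v → 1 ≤ lineSum low M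
        meets-low h eq = lineSum-side M i₀ ≤2 (on-M i₀) (subst (λ v → 1 ≤ ≤2 v) (sym eq) h)

        few : ∀ {F L} v → C M ≤ excess 1 v → (1 ≤ ≤2 v → 1 ≤ L) → 1 ≤ F → C M ≤ 64 + 4 * (F * L) + 18 * (F * L)
        few {F} {L} v h low≥ F≥1 = go v h low≥
          where
          small : C M ≤ 82 → 1 ≤ L → C M ≤ 64 + 4 * (F * L) + 18 * (F * L)
          small h L≥1 = ℕ.≤-trans h (ℕ.+-mono-≤ {64} {64 + 4 * (F * L)} {18} {18 * (F * L)} (ℕ.m≤m+n 64 (4 * (F * L)))
            (ℕ.*-monoʳ-≤ 18 {1} {F * L} (ℕ.*-mono-≤ {1} {F} {1} {L} F≥1 L≥1)))
          go : ∀ v → C M ≤ excess 1 v → (1 ≤ ≤2 v → 1 ≤ L) → C M ≤ 64 + 4 * (F * L) + 18 * (F * L)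
          go 0 h l = small h (l ℕ.≤-refl)
          go 1 h l = small h (l ℕ.≤-refl)
          go 2 h l = small h (l ℕ.≤-refl)
          go (suc (suc (suc v))) h l = ℕ.≤-trans h (ℕ.≤-trans (ℕ.m≤m+n 64 (4 * (F * L))) (ℕ.m≤m+n _ (18 * (F * L))))

        many : ∀ {F G L} a v → C M ≤ excess (suc (suc a)) v → (1 ≤ ≤2 v → 1 ≤ L) → 1 ≤ F → 1 ≤ G →
          C M ≤ 64 + 4 * (F * G) + 18 * (F * L)
        many {F} {G} {L} a v h low≥ F≥1 G≥1 = go v h low≥
          where
          68≤ : 68 ≤ 64 + 4 * (F * G)
          68≤ = ℕ.+-monoʳ-≤ 64 {4} {4 * (F * G)} (ℕ.*-monoʳ-≤ 4 {1} {F * G} (ℕ.*-mono-≤ {1} {F} {1} {G} F≥1 G≥1))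
          small : C M ≤ 86 → 1 ≤ L → C M ≤ 64 + 4 * (F * G) + 18 * (F * L)
          small h L≥1 = ℕ.≤-trans h (ℕ.+-mono-≤ {68} {64 + 4 * (F * G)} {18} {18 * (F * L)} 68≤
            (ℕ.*-monoʳ-≤ 18 {1} {F * L} (ℕ.*-mono-≤ {1} {F} {1} {L} F≥1 L≥1)))
          go : ∀ v → C M ≤ excess (suc (suc a)) v → (1 ≤ ≤2 v → 1 ≤ L) → C M ≤ 64 + 4 * (F * G) + 18 * (F * L)
          go 0 h l = small h (l ℕ.≤-refl)
          go 1 h l = small h (l ℕ.≤-refl)
          go 2 h l = small h (l ℕ.≤-refl)
          go (suc (suc (suc v))) h l = ℕ.≤-trans h (ℕ.≤-trans 68≤ (ℕ.m≤m+n _ (18 * (F * L))))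

        special-cases : ∀ {v ws f g l} → v ≡ values x M i₀ → us M ↭ v ∷ ws →
          (∀ z → z ≤ 3 → v ≡ suc z → Bound f g l M) → Bound f g l M
        special-cases {v} {f = f} {g} {l} eq p k = go v refl (subst (1 ≤_) (sym eq) (special-≥1 (meet x M i₀))) (subst (_≤ 5) (sym eq) (u≤5 _))
          where
          go : ∀ w → v ≡ w → 1 ≤ w → w ≤ 5 → Bound f g l M
          go (suc z) e _ (s≤s w≤4) = [ (λ { (s≤s z≤3) → k z z≤3 e })
            , (λ z≡4 → light f g l (heavy∈ M (∈-resp-↭ (↭-sym p) (here (sym e))) (ℕ.≤-reflexive (cong suc (sym z≡4))))) ]′
            (ℕ.m≤n⇒m<n∨m≡n w≤4)

        rich-cases : ∀ {i f g l} → Rich x i → values x M i ∈ us M → (values x M i ≡ 3 → Bound f g l M) → Bound f g l M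
        rich-cases {i} {f} {g} {l} p v∈ k =
          [ (λ eq → light f g l (heavy∈ M v∈ (ℕ.≤-reflexive (sym eq)))) , k ]′ (rich-value p (meet x M i))

      module Outside {bs as : List (Fin 5)} (perm : tabulate (punchIn i₀) ↭ bs ++ as)
        (rich : All (Rich x) bs) (flats : All (Flat x) as) (M : Fin 21)
        (p : us M ↭ tabulate (values x M)) (on-M : ∀ i → others x i (meet x M i) ∈ tabulate (pt M)) where

        open Split perm rich flats using (us-off)
        open Exterior M on-M public

        -- If M meets a rich or the special line class in size 5, it is light. What remains is size
        -- 3 on every rich one, 4 on every flat one and 1 to 4 on the special one.
        bound : ∀ f g l → (∀ z → z ≤ 3 → values x M i₀ ≡ suc z → map (values x M) bs ≡ List.replicate (length bs) 3 →
          us M ↭ suc z ∷ (List.replicate (length bs) 3 ++ List.replicate (length as) 4) → Bound f g l M) → Bound f g l M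
        bound f g l k = all-3 bs rich (λ i → ∈-resp-↭ (↭-sym (us-off M p)) (there (∈-++⁺ˡ i))) λ eq →
          special-cases {f = f} {g} {l} refl (us-off M p) λ z z≤3 eq′ → k z z≤3 eq′ eq
            (subst₂ (λ v ws → us M ↭ v ∷ (ws ++ List.replicate (length as) 4)) eq′ eq (us-off M p))
          where
          all-3 : ∀ is → All (Rich x) is → (∀ {v} → v ∈ map (values x M) is → v ∈ us M) →
            (map (values x M) is ≡ List.replicate (length is) 3 → Bound f g l M) → Bound f g l M
          all-3 []       []       _ k = k refl
          all-3 (i ∷ is) (r ∷ rs) h k = rich-cases {f = f} {g} {l} r (h (here refl))
            λ eq → all-3 is rs (h ∘ there) λ eqs → k (cong₂ _∷_ eq eqs)

      -- The balance would read 1458 ≤ 1408. In the absence of a second rich line class, `low`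
      -- stands in for g as well as for l.
      not-one : ∀ {b a₁ a₂ a₃} → tabulate (punchIn i₀) ↭ (b ∷ []) ++ (a₁ ∷ a₂ ∷ a₃ ∷ []) →
        All (Rich x) (b ∷ []) → All (Flat x) (a₁ ∷ a₂ ∷ a₃ ∷ []) → ⊥
      not-one {b} perm rich flats = ℕ.<⇒≱ (≤ᵇ-sound 1409 1458 refl) (balance (weigh f low low
          (∑-rich (All.head rich)) (ℕ.≤-trans ∑-low (s≤s z≤n)) ∑-low orth orth
          λ M _ p on-M → let open Outside perm rich flats M p on-M in
            bound f low low λ z z≤3 eq eqs q → few {lineSum f M} {lineSum low M} (suc z)
              (exterior-light 0 z M z≤n z≤3 q) (λ h → meets-low h eq) (meets-rich {b} (∷-injectiveˡ eqs))))
        where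
        open Split perm rich flats
        f = side b ≡3
        orth : ∑ (λ y → f y * low y) ≡ 0
        orth = ∑-side-disjoint (All.head not-special) ≡3 ≤2

      -- A line class off x that exceeds 64 meets every rich one in size 3, so marking two of them
      -- catches it.
      not-several : ∀ k {b₁ b₂ bs as} → suc k ≤ 2 →
        (∀ z → suc z ∷ (List.replicate (length (b₁ ∷ b₂ ∷ bs)) 3 ++ List.replicate (length as) 4) ≡ exterior (suc (suc k)) (suc z)) →
        1409 ≤ 1344 + 3 * (2 + (5 * length (b₁ ∷ b₂ ∷ bs) + 1 * length as)) + 28 * length as →
        tabulate (punchIn i₀) ↭ (b₁ ∷ b₂ ∷ bs) ++ as → All (Rich x) (b₁ ∷ b₂ ∷ bs) → All (Flat x) as → ⊥
      not-several k {b₁} {b₂} k≤2 shape count perm rich flats = ℕ.<⇒≱ count (balance (weigh f g low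
          (∑-rich (All.head rich)) (∑-rich (All.head (All.tail rich))) ∑-low
          (∑-side-disjoint (All.head (AllPairs.head distinct)) ≡3 ≡3) (∑-side-disjoint (All.head not-special) ≡3 ≤2)
          λ M _ p on-M → let open Outside perm rich flats M p on-M in
            bound f g low λ z z≤3 eq eqs q → many {lineSum f M} {lineSum g M} {lineSum low M} k (suc z)
              (exterior-light (suc k) z M k≤2 z≤3 (subst (us M ↭_) (shape z) q)) (λ h → meets-low h eq)
              (meets-rich {b₁} (∷-injectiveˡ eqs)) (meets-rich {b₂} (∷-injectiveˡ (∷-injectiveʳ eqs)))))
        where
        open Split perm rich flats
        f = side b₁ ≡3
        g = side b₂ ≡3

      5≢4 : 5 ≢ 4
      5≢4 ()

      -- A line class off x then has four sizes equal to 4, so `one-off` makes every line class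
      -- light and forces u(x) = 4.
      not-zero : ∀ {as} → length as ≡ 4 → tabulate (punchIn i₀) ↭ as → All (Flat x) as → ⊥
      not-zero {as} len perm flats = 5≢4 (trans (sym u≡5) (light⇒4 (λ M → go M (position x M)) x))
        where
        open Split {[]} {as} perm [] flats
        go : ∀ M → Position x M → C M ≤ 64
        go M (on i refl)  = heavy≤64 5≤u i
        go M (off _ p _) = one-off M {values x M i₀} (subst (λ n → us M ↭ values x M i₀ ∷ List.replicate n 4) len (us-off M p))

      all-rich : ∀ k → Rich x (punchIn i₀ k)
      all-rich = from-partition (partition {P = Rich x} {Q = Flat x} (All.tabulate⁺ {f = punchIn i₀} flat⊎rich))
        where
        go : ∀ bs as → length bs + length as ≡ 4 → tabulate (punchIn i₀) ↭ bs ++ as →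
          All (Rich x) bs → All (Flat x) as → ∀ k → Rich x (punchIn i₀ k)
        go bs [] _ p rs fs k = All.lookup rs (∈-resp-↭ (↭-trans p (↭-reflexive (++-identityʳ bs))) (∈-tabulate⁺ {f = punchIn i₀} k))
        go [] as@(_ ∷ _) e p rs fs = ⊥-elim (not-zero e p fs)
        go (_ ∷ []) (_ ∷ _ ∷ _ ∷ []) e p rs fs = ⊥-elim (not-one p rs fs)
        go (_ ∷ _ ∷ []) (_ ∷ _ ∷ []) e p rs fs = ⊥-elim (not-several 0 (s≤s z≤n) (λ _ → refl) (≤ᵇ-sound 1409 1442 refl) p rs fs)
        go (_ ∷ _ ∷ _ ∷ []) (_ ∷ []) e p rs fs = ⊥-elim (not-several 1 ℕ.≤-refl (λ _ → refl) (≤ᵇ-sound 1409 1426 refl) p rs fs)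
        go (_ ∷ []) (_ ∷ []) ()
        go (_ ∷ []) (_ ∷ _ ∷ []) ()
        go (_ ∷ []) (_ ∷ _ ∷ _ ∷ _ ∷ _) ()
        go (_ ∷ _ ∷ []) (_ ∷ []) ()
        go (_ ∷ _ ∷ []) (_ ∷ _ ∷ _ ∷ _) ()
        go (_ ∷ _ ∷ _ ∷ []) (_ ∷ _ ∷ _) ()
        go (_ ∷ _ ∷ _ ∷ _ ∷ bs) (_ ∷ as) e = ⊥-elim (ℕ.m+1+n≢0 (length bs) (ℕ.+-cancelˡ-≡ 4 (length bs + suc (length as)) 0 e))
        from-partition : (∃₂ λ bs as → tabulate (punchIn i₀) ↭ bs ++ as × All (Rich x) bs × All (Flat x) as) →
          ∀ k → Rich x (punchIn i₀ k)
        from-partition (bs , as , p , rs , fs) = go bs as (trans (sym (length-++ bs)) (sym (↭-length p))) p rs fs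

-- The classes of size five as a unital, and the conclusion that all sizes are four.

module FourPoints where

  open Prelude
  open Sums
  open Moments using (deviates)
  open LineClasses
  open ProjectivePlane
  open Balance
  open FivePoints
  import Data.Nat.Base as ℕ
  import Data.Nat.Properties as ℕ
  open import Data.Nat.Divisibility using (_∣_; _∣?_; divides)
  open import Data.Nat.Tactic.RingSolver using (solve-∀)
  import Data.Fin.Properties as Fin
  open import Data.List.Base as List using ([]; _∷_; tabulate)
  open import Data.List.Properties using (tabulate-cong)
  open import Data.List.Membership.Propositional.Properties using (∈-tabulate⁺)
  open import Data.List.Relation.Binary.Permutation.Propositional using (refl; ↭-reflexive)
  open import Relation.Nullary.Decidable using (from-no)

  ≡5-≢ : ∀ v → v ≢ 5 → ≡5 v ≡ 0
  ≡5-≢ 0 h = refl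
  ≡5-≢ 1 h = refl
  ≡5-≢ 2 h = refl
  ≡5-≢ 3 h = refl
  ≡5-≢ 4 h = refl
  ≡5-≢ 5 h = ⊥-elim (h refl)
  ≡5-≢ (suc (suc (suc (suc (suc (suc v)))))) h = refl

  ≡5-positive : ∀ v → 1 ≤ ≡5 v → v ≡ 5
  ≡5-positive 5 _ = refl
  ≡5-positive (suc (suc (suc (suc (suc (suc v)))))) ()

  module NoSix (u C : Fin 21 → ℕ)
    (line : ∀ L → LineClass (tabulate (u ∘ pt L)) (C L))
    (sum-u : ∑ u ≡ 84) (sum-C : ∑ C ≡ 1344 + 3 * ∑ (deviates ∘ u))
    (u≤6 : ∀ x → u x ≤ 6) (heavy : ∀ x i → 5 ≤ u x → lineSum u (pt x i) ≤ u x + 16)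
    (u≤5 : ∀ x → u x ≤ 5) where

    open Classes u C line sum-u sum-C u≤6 heavy
    open Fives u C line sum-u sum-C u≤6 heavy u≤5

    τ : Fin 21 → ℕ
    τ = ≡5 ∘ u

    n : ℕ
    n = ∑ τ

    module _ {x} (e : u x ≡ 5) where

      fivesAt : ℕ
      fivesAt = ∑ λ c → ≡5 (u (others x (i₀ e) c))

      fives-special : lineSum τ (pt x (i₀ e)) ≡ 1 + fivesAt
      fives-special = trans (lineSum-list ≡5 (pt x (i₀ e)) (through₅ e (i₀ e) refl))
        (cong suc (sym (vs-list ≡5 x (i₀ e) refl)))

      fives-rich : ∀ k → lineSum τ (pt x (punchIn (i₀ e) k)) ≡ 3
      fives-rich k = lineSum-list ≡5 (pt x (punchIn (i₀ e) k)) (through₅ e (punchIn (i₀ e) k) (all-rich e k))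

      -- Besides x itself, each of the four rich line classes contributes two classes of size 5.
      n≡ : n ≡ 9 + fivesAt
      n≡ = ℕ.+-cancelʳ-≡ 4 n (9 + fivesAt) (begin
        n + 4 ≡⟨ cong (λ v → n + 4 * ≡5 v) (sym e) ⟩
        n + 4 * τ x ≡⟨ sym (∑-through τ x) ⟩
        ∑ (λ i → lineSum τ (pt x i)) ≡⟨ ∑-punchIn (λ i → lineSum τ (pt x i)) (i₀ e) ⟩
        lineSum τ (pt x (i₀ e)) + ∑ (λ k → lineSum τ (pt x (punchIn (i₀ e) k)))
                                                                    ≡⟨ cong₂ _+_ fives-special (trans (∑-cong fives-rich) (∑-const 4 3)) ⟩
        1 + fivesAt + 12 ≡⟨ shuffle fivesAt ⟩
        9 + fivesAt + 4 ∎)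
        where
        open ≡-Reasoning
        shuffle : ∀ a → 1 + a + 12 ≡ 9 + a + 4
        shuffle = solve-∀

    tight : Fin 21 → ℕ
    tight L = if lineSum u L ≡ᵇ 21 then 1 else 0

    tight-special : ∀ {x} (e : u x ≡ 5) → tight (pt x (i₀ e)) ≡ 0
    tight-special e = cong (λ s → if s ≡ᵇ 21 then 1 else 0) (t₀ e)

    tight-rich : ∀ {x} (e : u x ≡ 5) k → tight (pt x (punchIn (i₀ e) k)) ≡ 1
    tight-rich e k = cong (λ s → if s ≡ᵇ 21 then 1 else 0) (t₁ e k)

    data Fivefold (L : Fin 21) : Set where
      none    : lineSum τ L ≡ 0 → Fivefold L
      special : ∀ x (e : u x ≡ 5) → L ≡ pt x (i₀ e) → Fivefold L
      rich    : ∀ x (e : u x ≡ 5) k → L ≡ pt x (punchIn (i₀ e) k) → Fivefold L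

    fivefold : ∀ L → Fivefold L
    fivefold L = [ none , (λ (j , h) → at j (≡5-positive (u (pt L j)) h)) ]′ (vanishes? (lineSum τ L) refl)
      where
      vanishes? : ∀ s → lineSum τ L ≡ s → lineSum τ L ≡ 0 ⊎ ∃ λ j → 1 ≤ τ (pt L j)
      vanishes? zero    eq = inj₁ eq
      vanishes? (suc s) eq = inj₂ (∑-positive (τ ∘ pt L) (λ z → ℕ.1+n≢0 (trans (sym eq) z)))
      at : ∀ j → u (pt L j) ≡ 5 → Fivefold L
      at j e = compare (pos L j Fin.≟ i₀ e)
        where
        compare : Dec (pos L j ≡ i₀ e) → Fivefold L
        compare (yes eq) = special (pt L j) e (trans (sym (pos-correct L j)) (cong (pt (pt L j)) eq))
        compare (no ¬eq) = rich (pt L j) e (punchOut (¬eq ∘ sym))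
          (trans (sym (pos-correct L j)) (cong (pt (pt L j)) (sym (Fin.punchIn-punchOut (¬eq ∘ sym)))))

    sign : ℕ → ℕ
    sign zero    = 0
    sign (suc n) = 1

    triple : ∀ L → tight L * lineSum τ L ≡ 3 * (tight L * sign (lineSum τ L))
    triple L = go (fivefold L)
      where
      go : Fivefold L → tight L * lineSum τ L ≡ 3 * (tight L * sign (lineSum τ L))
      go (none eq) = subst (λ s → tight L * s ≡ 3 * (tight L * sign s)) (sym eq) (trans (ℕ.*-zeroʳ (tight L)) (cong (3 *_) (sym (ℕ.*-zeroʳ (tight L)))))
      go (special x e refl) = subst (λ r → r * lineSum τ (pt x (i₀ e)) ≡ 3 * (r * sign (lineSum τ (pt x (i₀ e))))) (sym (tight-special e)) refl
      go (rich x e k refl) = subst₂ (λ r s → r * s ≡ 3 * (r * sign s)) (sym (tight-rich e k)) (sym (fives-rich e k)) refl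

    -- Incident pairs of a class of size 5 and a rich line class are counted twice: each such class
    -- lies on four rich line classes, and each rich line class contains three such classes.
    3∣4n : 4 * n ≡ 3 * ∑ (λ L → tight L * sign (lineSum τ L))
    3∣4n = begin
      4 * n ≡⟨ sym (∑-*ˡ 4 τ) ⟩
      ∑ (λ x → 4 * τ x) ≡⟨ ∑-cong (λ x → four x (u x ℕ.≟ 5)) ⟩
      ∑ (λ x → τ x * lineSum tight x) ≡⟨ sym (∑-flags tight τ) ⟩
      ∑ (λ L → tight L * lineSum τ L) ≡⟨ ∑-cong triple ⟩
      ∑ (λ L → 3 * (tight L * sign (lineSum τ L))) ≡⟨ ∑-*ˡ 3 (λ L → tight L * sign (lineSum τ L)) ⟩
      3 * ∑ (λ L → tight L * sign (lineSum τ L)) ∎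
      where
      open ≡-Reasoning
      four : ∀ x → Dec (u x ≡ 5) → 4 * τ x ≡ τ x * lineSum tight x
      four x (no ¬e) = trans (cong (4 *_) (≡5-≢ (u x) ¬e)) (sym (cong (_* lineSum tight x) (≡5-≢ (u x) ¬e)))
      four x (yes e) = trans (ℕ.*-comm 4 (τ x)) (cong (τ x *_) (sym (trans (∑-punchIn (tight ∘ pt x) (i₀ e))
        (cong₂ _+_ (tight-special e) (trans (∑-cong (tight-rich e)) (∑-const 4 1))))))

    module _ {x₀} (e₀ : u x₀ ≡ 5) where

      n≡9 : n ≡ 9
      n≡9 = go (fivesAt e₀) refl (special-≡5 e₀)
        where
        quotient : ℕ
        quotient = ∑ λ L → tight L * sign (lineSum τ L)
        divisible : ∀ {k} → n ≡ k → 3 ∣ 4 * k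
        divisible eq = divides quotient (trans (cong (4 *_) (sym eq)) (trans 3∣4n (ℕ.*-comm 3 quotient)))
        go : ∀ k → fivesAt e₀ ≡ k → k ≤ 2 → n ≡ 9
        go 0 eq _ = trans (n≡ e₀) (cong (9 +_) eq)
        go 1 eq _ = ⊥-elim (from-no (3 ∣? 40) (divisible (trans (n≡ e₀) (cong (9 +_) eq))))
        go 2 eq _ = ⊥-elim (from-no (3 ∣? 44) (divisible (trans (n≡ e₀) (cong (9 +_) eq))))
        go (suc (suc (suc k))) _ (s≤s (s≤s ()))

      one-or-three : ∀ L → lineSum τ L ≡ 0 ⊎ lineSum τ L ≡ 1 ⊎ lineSum τ L ≡ 3
      one-or-three L = go (fivefold L)
        where
        go : Fivefold L → lineSum τ L ≡ 0 ⊎ lineSum τ L ≡ 1 ⊎ lineSum τ L ≡ 3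
        go (none eq) = inj₁ eq
        go (special x e refl) = inj₂ (inj₁ (trans (fives-special e) (cong suc (ℕ.+-cancelˡ-≡ 9 (fivesAt e) 0 (trans (sym (n≡ e)) n≡9)))))
        go (rich x e k refl) = inj₂ (inj₂ (fives-rich e k))

      -- The classes of size 5 form a unital: Σ (t - 1)(t - 3) = 0 over the line classes.
      on-every-line : ∀ L → lineSum τ L ≢ 0
      on-every-line L z = 0≢3 (trans (cong (4 *_) (sym z)) (trans tight-at (cong (λ s → s * s + 3) z)))
        where
        0≢3 : 0 ≢ 3
        0≢3 ()
        below : ∀ L → 4 * lineSum τ L ≤ lineSum τ L * lineSum τ L + 3
        below L = [ (λ eq → subst (λ s → 4 * s ≤ s * s + 3) (sym eq) z≤n)
                  , [ (λ eq → subst (λ s → 4 * s ≤ s * s + 3) (sym eq) ℕ.≤-refl)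
                    , (λ eq → subst (λ s → 4 * s ≤ s * s + 3) (sym eq) ℕ.≤-refl) ]′ ]′ (one-or-three L)
        idempotent : ∀ v → ≡5 v * ≡5 v ≡ ≡5 v
        idempotent v with v ℕ.≟ 5
        ... | yes refl = refl
        ... | no ¬eq = trans (cong (λ d → d * d) (≡5-≢ v ¬eq)) (sym (≡5-≢ v ¬eq))
        ∑-left : ∑ (λ L → 4 * lineSum τ L) ≡ 180
        ∑-left = trans (∑-*ˡ 4 (lineSum τ)) (cong (4 *_) (trans (∑-lineSum τ) (cong (5 *_) n≡9)))
        ∑-right : ∑ (λ L → lineSum τ L * lineSum τ L + 3) ≡ 180
        ∑-right = trans (∑-+ (λ L → lineSum τ L * lineSum τ L) (λ _ → 3)) (cong₂ _+_
          (trans (∑-lineSum-product τ τ) (cong₂ (λ a b → a * a + 4 * b) n≡9 (trans (∑-cong (λ x → idempotent (u x))) n≡9)))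
          (∑-const 21 3))
        tight-at : 4 * lineSum τ L ≡ lineSum τ L * lineSum τ L + 3
        tight-at = ∑-tight {f = λ L → 4 * lineSum τ L} {g = λ L → lineSum τ L * lineSum τ L + 3} below
          (ℕ.≤-reflexive (trans ∑-right (sym ∑-left))) L

      contradiction : ⊥
      contradiction = 5≢4 e₀ (trans (sym e₀) (light⇒4 light x₀))
        where
        light : ∀ M → C M ≤ 64
        light M = at (∑-positive (τ ∘ pt M) (on-every-line M))
          where
          at : (∃ λ j → 1 ≤ τ (pt M j)) → C M ≤ 64
          at (j , h) = heavy∈ M (∈-tabulate⁺ {f = u ∘ pt M} j) (ℕ.≤-reflexive (sym (≡5-positive (u (pt M j)) h)))

  module Conclusion (u C : Fin 21 → ℕ)
    (line : ∀ L → LineClass (tabulate (u ∘ pt L)) (C L))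
    (sum-u : ∑ u ≡ 84) (sum-C : ∑ C ≡ 1344 + 3 * ∑ (deviates ∘ u))
    (u≤6 : ∀ x → u x ≤ 6) (heavy : ∀ x i → 5 ≤ u x → lineSum u (pt x i) ≤ u x + 16) where

    open Classes u C line sum-u sum-C u≤6 heavy

    all-four : ∀ x → u x ≡ 4
    all-four = ∑-tight {f = u} {g = λ _ → 4} (λ x → below x (u x) refl) (ℕ.≤-reflexive (trans (∑-const 21 4) (sym sum-u)))
      where
      u≤5 : ∀ x → u x ≤ 5
      u≤5 x = [ ℕ.s≤s⁻¹ , (λ e → ⊥-elim (Six.contradiction e)) ]′ (ℕ.m≤n⇒m<n∨m≡n (u≤6 x))
      below : ∀ x n → u x ≡ n → n ≤ 4
      below x n refl = [ ℕ.s≤s⁻¹ , (λ e → ⊥-elim (NoSix.contradiction u C line sum-u sum-C u≤6 heavy u≤5 e)) ]′ (ℕ.m≤n⇒m<n∨m≡n (u≤5 x))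

    us-four : ∀ L → us L ≡ 4 ∷ 4 ∷ 4 ∷ 4 ∷ 4 ∷ []
    us-four L = tabulate-cong {f = u ∘ pt L} {g = λ _ → 4} (λ j → all-four (pt L j))

    all-64 : ∀ L → C L ≡ 64
    all-64 = ∑-tight {f = C} {g = λ _ → 64} (λ L → one-off L {4} (↭-reflexive (us-four L)))
      (ℕ.≤-trans (ℕ.≤-reflexive (∑-const 21 64)) (subst (1344 ≤_) (sym sum-C) (ℕ.m≤m+n 1344 (3 * ∑ (deviates ∘ u)))))

-- Segment counts of an arc and the identity for Σ C(L).

module NeighbourClasses where

  open Prelude
  open Sums
  open AffinePlane
  open Moments
  open Search using (sumSquares)
  open LineClasses
  open ProjectivePlane
  open Balance
  open FourPoints
  import Data.Nat.Base as ℕ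
  import Data.Nat.Properties as ℕ
  open import Data.Nat.Tactic.RingSolver using (solve-∀)
  open import Data.Nat.ListAction using () renaming (sum to listSum)
  import Data.Fin.Properties as Fin
  open import Data.List.Base as List using ([]; _∷_; tabulate)
  open import Data.List.Properties using (map-tabulate; tabulate-cong)
  open import Data.List.Relation.Binary.Permutation.Propositional using (_↭_; ↭-reflexive)

  maximum : (F → ℕ) → ℕ
  maximum r = r 0F ⊔ (r 1F ⊔ (r 2F ⊔ r 3F))

  ≤-maximum : ∀ r s → r s ≤ maximum r
  ≤-maximum r 0F = ℕ.m≤m⊔n _ _
  ≤-maximum r 1F = ℕ.≤-trans (ℕ.m≤m⊔n _ _) (ℕ.m≤n⊔m (r 0F) _)
  ≤-maximum r 2F = ℕ.≤-trans (ℕ.≤-trans (ℕ.m≤m⊔n _ _) (ℕ.m≤n⊔m (r 1F) _)) (ℕ.m≤n⊔m (r 0F) _)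
  ≤-maximum r 3F = ℕ.≤-trans (ℕ.≤-trans (ℕ.m≤n⊔m (r 2F) _) (ℕ.m≤n⊔m (r 1F) _)) (ℕ.m≤n⊔m (r 0F) _)

  maximum-attained : ∀ r → ∃ λ s → maximum r ≡ r s
  maximum-attained r with ℕ.⊔-sel (r 0F) (r 1F ⊔ (r 2F ⊔ r 3F)) | ℕ.⊔-sel (r 1F) (r 2F ⊔ r 3F) | ℕ.⊔-sel (r 2F) (r 3F)
  ... | inj₁ a | _      | _      = 0F , a
  ... | inj₂ a | inj₁ b | _      = 1F , trans a b
  ... | inj₂ a | inj₂ b | inj₁ c = 2F , trans a (trans b c)
  ... | inj₂ a | inj₂ b | inj₂ c = 3F , trans a (trans b c)

  squares≤ : ∀ r → squares r ≤ maximum r * ∑ r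
  squares≤ r = ℕ.≤-trans (∑-mono λ s → ℕ.*-monoˡ-≤ (r s) (≤-maximum r s)) (ℕ.≤-reflexive (∑-*ˡ (maximum r) r))

  sum≤ : ∀ r → ∑ r ≤ 4 * maximum r
  sum≤ r = ℕ.≤-trans (∑-mono (≤-maximum r)) (ℕ.≤-reflexive (∑-const 4 (maximum r)))

  -- A sum of four numbers from {0, 1, 2} that is odd has an odd summand.
  squares-five : ∀ r → (∀ s → r s ≤ 2) → ∑ r ≡ 5 → squares r ≤ 9
  squares-five r h e = ℕ.≤-trans (ℕ.≤-reflexive (∑≡sum _)) (go (r 0F) (r 1F) (r 2F) (r 3F) (h 0F) (h 1F) (h 2F) (h 3F) (trans (sym (∑≡sum r)) e))
    where
    test : ℕ → ℕ → ℕ → ℕ → Bool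
    test a b c d = if a + (b + (c + (d + 0))) ≡ᵇ 5 then a * a + (b * b + (c * c + (d * d + 0))) ≤ᵇ 9 else true
    all-ok : upTo? 2 (λ a → upTo? 2 λ b → upTo? 2 λ c → upTo? 2 λ d → test a b c d) ≡ true
    all-ok = refl
    go : ∀ a b c d → a ≤ 2 → b ≤ 2 → c ≤ 2 → d ≤ 2 → a + (b + (c + (d + 0))) ≡ 5 → a * a + (b * b + (c * c + (d * d + 0))) ≤ 9
    go a b c d a≤ b≤ c≤ d≤ e = ≤ᵇ-sound _ 9 (trans (sym (cong (λ n → if n ≡ᵇ 5 then a * a + (b * b + (c * c + (d * d + 0))) ≤ᵇ 9 else true) e))
      (upTo?-sound 2 (test a b c) (upTo?-sound 2 (λ c → upTo? 2 (test a b c)) (upTo?-sound 2 (λ b → upTo? 2 λ c → upTo? 2 (test a b c))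
        (upTo?-sound 2 (λ a → upTo? 2 λ b → upTo? 2 λ c → upTo? 2 (test a b c)) all-ok a a≤) b b≤) c c≤) d d≤))

  -- Elimination of q = Σ u(x)² from the two counts that enter `sum-C`.
  eliminate : ∀ c d q a b e f g h → c + a + 5 * q ≡ 4 * (q + b) + (e + 4 * q) + f → d + g ≡ q + b →
    b + e + f + 3 * g ≡ h + a → c ≡ h + 3 * d
  eliminate c d q a b e f g h p p′ p″ = ℕ.+-cancelʳ-≡ (a + 5 * q + 3 * g) c (h + 3 * d) (begin
    c + (a + 5 * q + 3 * g) ≡⟨ left c a q g ⟩
    c + a + 5 * q + 3 * g ≡⟨ cong (_+ 3 * g) p ⟩
    4 * (q + b) + (e + 4 * q) + f + 3 * g ≡⟨ middle q b e f g ⟩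
    8 * q + 3 * b + (b + e + f + 3 * g) ≡⟨ cong (8 * q + 3 * b +_) p″ ⟩
    8 * q + 3 * b + (h + a) ≡⟨ right q b h a ⟩
    3 * (q + b) + (h + (a + 5 * q)) ≡⟨ cong (λ n → 3 * n + (h + (a + 5 * q))) (sym p′) ⟩
    3 * (d + g) + (h + (a + 5 * q)) ≡⟨ last d g h a q ⟩
    h + 3 * d + (a + 5 * q + 3 * g) ∎)
    where
    open ≡-Reasoning
    left : ∀ c a q g → c + (a + 5 * q + 3 * g) ≡ c + a + 5 * q + 3 * g
    left = solve-∀
    middle : ∀ q b e f g → 4 * (q + b) + (e + 4 * q) + f + 3 * g ≡ 8 * q + 3 * b + (b + e + f + 3 * g)
    middle = solve-∀
    right : ∀ q b h a → 8 * q + 3 * b + (h + a) ≡ 3 * (q + b) + (h + (a + 5 * q))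
    right = solve-∀
    last : ∀ d g h a q → 3 * (d + g) + (h + (a + 5 * q)) ≡ h + 3 * d + (a + 5 * q + 3 * g)
    last = solve-∀

  -- Segments of the neighbour classes: seg L j v is the segment in the direction L of the
  -- point with affine coordinates v of the class pt L j; the line m of the class L meets
  -- the class pt L j in the segment std j m.
  module Cells
    (seg : Fin 21 → Fin 5 → Fin 16 → F)
    (affine : ∀ x v v′ → ∑ (λ i → δ (seg (pt x i) (pos x i) v) (seg (pt x i) (pos x i) v′)) ≡ 1 + 4 * δ v v′)
    {k : ℕ} (cls : Fin k → Fin 21) (cell : Fin k → Fin 16)
    (injective : ∀ {i i′} → cls i ≡ cls i′ → cell i ≡ cell i′ → i ≡ i′)
    (light : ∀ L m → ∑ (λ i → ∑ (λ j → δ (cls i) (pt L j) * δ (seg L j (cell i)) (std j m))) ≤ 6) where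

    u : Fin 21 → ℕ
    u x = ∑ λ i → δ (cls i) x

    W : Fin 21 → Weights
    W L j s = ∑ λ i → δ (cls i) (pt L j) * δ (seg L j (cell i)) s

    ∑-u : ∑ u ≡ k
    ∑-u = trans (∑-swap (λ x i → δ (cls i) x)) (trans (∑-cong λ i → ∑-δˡ (cls i)) (trans (∑-const k 1) (ℕ.*-identityʳ k)))

    ∑-W : ∀ L j → ∑ (W L j) ≡ u (pt L j)
    ∑-W L j = trans (∑-swap (λ s i → δ (cls i) (pt L j) * δ (seg L j (cell i)) s))
      (∑-cong λ i → trans (∑-*ˡ (δ (cls i) (pt L j)) (δ (seg L j (cell i))))
        (trans (cong (δ (cls i) (pt L j) *_) (∑-δˡ (seg L j (cell i)))) (ℕ.*-identityʳ _)))

    load≤6 : ∀ L m → load (W L) m ≤ 6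
    load≤6 L m = ℕ.≤-trans (ℕ.≤-reflexive (∑-swap (λ j i → δ (cls i) (pt L j) * δ (seg L j (cell i)) (std j m)))) (light L m)

    wx : Fin 21 → Fin 5 → F → ℕ
    wx x i = W (pt x i) (pos x i)

    ∑-wx : ∀ x i → ∑ (wx x i) ≡ u x
    ∑-wx x i = trans (∑-W (pt x i) (pos x i)) (cong u (pos-correct x i))

    -- Ordered pairs of points of the arc in a common segment are counted over the five directions:
    -- two distinct points share one segment, a point shares five with itself, hence u(u - 1) + 5u.
    ∑-squares : ∀ x → ∑ (λ i → squares (wx x i)) ≡ u x * u x + 4 * u x
    ∑-squares x = begin
      ∑ (λ i → squares (wx x i))
        ≡⟨ ∑-cong (λ i → trans (∑-cong λ s → cong₂ _*_ (entry i s) (entry i s)) (∑-gram (a i) (a i) f f)) ⟩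
      ∑ (λ i → ∑ (λ p → ∑ (λ q → ∑ (λ s → a i s p * a i s q) * (f p * f q))))
        ≡⟨ trans (∑-swap _) (∑-cong λ p → ∑-swap _) ⟩
      ∑ (λ p → ∑ (λ q → ∑ (λ i → ∑ (λ s → a i s p * a i s q) * (f p * f q))))
        ≡⟨ ∑-cong₂ (λ p q → trans (∑-*ʳ (f p * f q) (λ i → ∑ (λ s → a i s p * a i s q)))
             (cong (_* (f p * f q)) (trans (∑-cong λ i → trans (∑-δ (segx i (cell p)) (δ (segx i (cell q)))) (δ-sym (segx i (cell q)) (segx i (cell p)))) (affine x (cell p) (cell q))))) ⟩
      ∑ (λ p → ∑ (λ q → (1 + 4 * δ (cell p) (cell q)) * (f p * f q)))
        ≡⟨ ∑-cong₂ (λ p q → trans (shuffle (δ (cell p) (cell q)) (f p) (f q)) (cong (λ d → f p * f q + 4 * d) (same p q))) ⟩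
      ∑ (λ p → ∑ (λ q → f p * f q + 4 * (δ p q * f q)))
        ≡⟨ ∑-cong (λ p → trans (∑-+ (λ q → f p * f q) (λ q → 4 * (δ p q * f q)))
             (cong (∑ (λ q → f p * f q) +_) (trans (∑-*ˡ 4 (λ q → δ p q * f q)) (cong (4 *_) (∑-δ p f))))) ⟩
      ∑ (λ p → ∑ (λ q → f p * f q) + 4 * f p)
        ≡⟨ trans (∑-+ (λ p → ∑ (λ q → f p * f q)) (λ p → 4 * f p)) (cong₂ _+_ (sym (∑-product f f)) (∑-*ˡ 4 f)) ⟩
      u x * u x + 4 * u x ∎
      where
      open ≡-Reasoning
      f : Fin k → ℕ
      f p = δ (cls p) x
      segx : Fin 5 → Fin 16 → F
      segx i = seg (pt x i) (pos x i)
      a : Fin 5 → F → Fin k → ℕ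
      a i s p = δ (segx i (cell p)) s
      entry : ∀ i s → wx x i s ≡ ∑ (λ p → a i s p * f p)
      entry i s = ∑-cong λ p → trans (cong (λ y → δ (cls p) y * a i s p) (pos-correct x i)) (ℕ.*-comm (f p) (a i s p))
      shuffle : ∀ d b c → (1 + 4 * d) * (b * c) ≡ b * c + 4 * (d * (b * c))
      shuffle = solve-∀
      same : ∀ p q → δ (cell p) (cell q) * (f p * f q) ≡ δ p q * f q
      same p q = go (cls p Fin.≟ x) (cls q Fin.≟ x) (cell p Fin.≟ cell q)
        where
        δ≢ : f q ≡ 0 → δ (cell p) (cell q) * (f p * f q) ≡ δ p q * f q
        δ≢ z = trans (cong (λ n → δ (cell p) (cell q) * (f p * n)) z) (trans (cong (δ (cell p) (cell q) *_) (ℕ.*-zeroʳ (f p)))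
          (trans (ℕ.*-zeroʳ (δ (cell p) (cell q))) (trans (sym (ℕ.*-zeroʳ (δ p q))) (cong (δ p q *_) (sym z)))))
        go : Dec (cls p ≡ x) → Dec (cls q ≡ x) → Dec (cell p ≡ cell q) → δ (cell p) (cell q) * (f p * f q) ≡ δ p q * f q
        go _ (no h) _ = δ≢ (δ-≢ h)
        go (no h) (yes e) _ = trans (trans (cong (λ n → δ (cell p) (cell q) * (n * f q)) (δ-≢ h)) (ℕ.*-zeroʳ (δ (cell p) (cell q))))
          (cong (_* f q) (sym (δ-≢ {i = p} {q} (λ p≡q → h (trans (cong cls p≡q) e)))))
        go (yes e) (yes e′) (no h) = trans (cong (_* (f p * f q)) (δ-≢ h)) (cong (_* f q) (sym (δ-≢ {i = p} {q} (λ p≡q → h (cong cell p≡q)))))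
        go (yes e) (yes e′) (yes c) = diagonal (injective (trans e (sym e′)) c)
          where
          diagonal : p ≡ q → δ (cell p) (cell q) * (f p * f q) ≡ δ p q * f q
          diagonal refl = cong₂ _*_ (trans (δ-refl (cell p)) (sym (δ-refl p))) (trans (cong (_* f p) (trans (cong (λ y → δ y x) e) (δ-refl x))) (ℕ.*-identityˡ (f p)))

    U≡ : ∀ L → U (W L) ≡ lineSum u L
    U≡ L = ∑-cong (∑-W L)

    module Eighty-four (k≡84 : k ≡ 84) where

      sum-u : ∑ u ≡ 84
      sum-u = trans ∑-u k≡84

      top : Fin 21 → Fin 5 → ℕ
      top x i = maximum (wx x i)

      top-bound : ∀ x i → 4 * top x i + lineSum u (pt x i) ≤ 24 + u x
      top-bound x i = go (maximum-attained (wx x i))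
        where
        go : (∃ λ s → top x i ≡ wx x i s) → 4 * top x i + lineSum u (pt x i) ≤ 24 + u x
        go (s , eq) = subst₂ _≤_ (cong₂ (λ a b → 4 * a + b) (sym eq) (U≡ (pt x i))) (cong (24 +_) (∑-wx x i))
          (segment-bound (W (pt x i)) (load≤6 (pt x i)) (pos x i) s)

      ∑-top : ∀ x → 4 * ∑ (top x) ≤ 36 + u x
      ∑-top x = ℕ.+-cancelʳ-≤ (84 + 4 * u x) (4 * ∑ (top x)) (36 + u x) (begin
        4 * ∑ (top x) + (84 + 4 * u x)
          ≡⟨ cong₂ _+_ (sym (∑-*ˡ 4 (top x))) (sym (trans (∑-through u x) (cong (_+ 4 * u x) {x = ∑ u} {y = 84} sum-u))) ⟩
        ∑ (λ i → 4 * top x i) + ∑ (λ i → lineSum u (pt x i))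
          ≡⟨ sym (∑-+ (λ i → 4 * top x i) (λ i → lineSum u (pt x i))) ⟩
        ∑ (λ i → 4 * top x i + lineSum u (pt x i))
          ≤⟨ ∑-mono (top-bound x) ⟩
        ∑ {5} (λ _ → 24 + u x)
          ≡⟨ ∑-const 5 (24 + u x) ⟩
        5 * (24 + u x)
          ≡⟨ shuffle (u x) ⟩
        36 + u x + (84 + 4 * u x) ∎)
        where
        open ℕ.≤-Reasoning
        shuffle : ∀ a → 5 * (24 + a) ≡ 36 + a + (84 + 4 * a)
        shuffle = solve-∀

      squares-top : ∀ x → u x * u x + 4 * u x ≤ ∑ (top x) * u x
      squares-top x = begin
        u x * u x + 4 * u x ≡⟨ sym (∑-squares x) ⟩
        ∑ (λ i → squares (wx x i)) ≤⟨ ∑-mono (λ i → ℕ.≤-trans (squares≤ (wx x i)) (ℕ.≤-reflexive (cong (top x i *_) (∑-wx x i)))) ⟩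
        ∑ (λ i → top x i * u x) ≡⟨ ∑-*ʳ (u x) (top x) ⟩
        ∑ (top x) * u x ∎
        where open ℕ.≤-Reasoning

      -- For u > 0, `squares-top` gives u + 4 ≤ Σ top and `∑-top` gives 4 Σ top ≤ 36 + u. Hence 3u ≤
      -- 20.
      u≤6 : ∀ x → u x ≤ 6
      u≤6 x = go (u x) (∑ (top x)) (∑-top x) (squares-top x)
        where
        go : ∀ v t → 4 * t ≤ 36 + v → v * v + 4 * v ≤ t * v → v ≤ 6
        go zero    t h s = z≤n
        go (suc v) t h s = ℕ.≮⇒≥ λ v≥7 → ℕ.<⇒≱ (ℕ.≤-refl {53}) (ℕ.+-cancelʳ-≤ (suc v) 53 52 (begin
          53 + suc v ≤⟨ ℕ.+-monoˡ-≤ (suc v) (≤ᵇ-sound 53 (16 + 21 + 16) refl) ⟩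
          16 + 21 + 16 + suc v ≤⟨ ℕ.+-monoˡ-≤ (suc v) (ℕ.+-monoˡ-≤ 16 (ℕ.+-monoʳ-≤ 16 (ℕ.*-monoʳ-≤ 3 v≥7))) ⟩
          16 + 3 * suc v + 16 + suc v ≡⟨ shuffle (suc v) ⟩
          4 * (suc v + 4) + 16 ≤⟨ ℕ.+-monoˡ-≤ 16 (ℕ.*-monoʳ-≤ 4 (ℕ.*-cancelʳ-≤ (suc v + 4) t (suc v) (ℕ.≤-trans (ℕ.≤-reflexive (ℕ.*-distribʳ-+ (suc v) (suc v) 4)) s))) ⟩
          4 * t + 16 ≤⟨ ℕ.+-monoˡ-≤ 16 h ⟩
          36 + suc v + 16 ≡⟨ shuffle′ (suc v) ⟩
          52 + suc v ∎))
          where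
          open ℕ.≤-Reasoning
          shuffle : ∀ a → 16 + 3 * a + 16 + a ≡ 4 * (a + 4) + 16
          shuffle = solve-∀
          shuffle′ : ∀ a → 36 + a + 16 ≡ 52 + a
          shuffle′ = solve-∀

      module _ {x} (5≤u : 5 ≤ u x) where

        2≤top : ∀ i → 2 ≤ top x i
        2≤top i = ℕ.≮⇒≥ λ top≤1 → ℕ.<⇒≱ (ℕ.≤-refl {5}) (ℕ.≤-trans 5≤u (ℕ.≤-trans (ℕ.≤-reflexive (sym (∑-wx x i)))
          (ℕ.≤-trans (sum≤ (wx x i)) (ℕ.*-monoʳ-≤ 4 {top x i} {1} (ℕ.s≤s⁻¹ top≤1)))))

        ∑-top≤10 : ∑ (top x) ≤ 10
        ∑-top≤10 = ℕ.≮⇒≥ λ h → ℕ.<⇒≱ (≤ᵇ-sound 43 44 refl) (ℕ.≤-trans (ℕ.*-monoʳ-≤ 4 h)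
          (ℕ.≤-trans (∑-top x) (ℕ.+-monoʳ-≤ 36 (u≤6 x))))

        -- Five points on four parallel segments put two on one of them, in each of the five
        -- directions; by `∑-top≤10` there is no room for more.
        top≡2 : ∀ i → top x i ≡ 2
        top≡2 i = sym (∑-tight {f = λ _ → 2} {g = top x} 2≤top (ℕ.≤-trans ∑-top≤10 (ℕ.≤-reflexive (sym (∑-const 5 2)))) i)

        wx≤2 : ∀ i s → wx x i s ≤ 2
        wx≤2 i s = subst (wx x i s ≤_) (top≡2 i) (≤-maximum (wx x i) s)

        -- For v = 5 and v = 6 the total is 45 = 5 · 9 and 60 = 5 · 12, so every direction attains
        -- the greatest sum of squares.
        squares≡ : ∀ v → u x ≡ v → ∀ q → (∀ i → squares (wx x i) ≤ q) → 5 * q ≤ v * v + 4 * v → ∀ i → squares (wx x i) ≡ q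
        squares≡ v e q h total = ∑-tight {f = λ i → squares (wx x i)} {g = λ _ → q} h
          (ℕ.≤-trans (ℕ.≤-reflexive (∑-const 5 q)) (ℕ.≤-trans total (ℕ.≤-reflexive (sym (trans (∑-squares x) (cong (λ v → v * v + 4 * v) e))))))

        heavy : ∀ i → lineSum u (pt x i) ≤ u x + 16
        heavy i = ℕ.+-cancelˡ-≤ 8 (lineSum u (pt x i)) (u x + 16) (begin
          8 + lineSum u (pt x i) ≡⟨ cong (λ m → 4 * m + lineSum u (pt x i)) (sym (top≡2 i)) ⟩
          4 * top x i + lineSum u (pt x i) ≤⟨ top-bound x i ⟩
          24 + u x ≡⟨ ℕ.+-comm 24 (u x) ⟩
          u x + 24 ≡⟨ shuffle (u x) ⟩
          8 + (u x + 16) ∎)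
          where
          open ℕ.≤-Reasoning
          shuffle : ∀ a → a + 24 ≡ 8 + (a + 16)
          shuffle = solve-∀

      regular-wx : ∀ x i → Regular (wx x i)
      regular-wx x i = record
        { ≤2   = λ h → wx≤2 (subst (5 ≤_) (∑-wx x i) h) i
        ; five = λ e → let e′ = trans (sym (∑-wx x i)) e ; h = ℕ.≤-reflexive (sym e′) in
            squares≡ h 5 e′ 9 (λ i → squares-five (wx x i) (wx≤2 h i) (trans (∑-wx x i) e′)) ℕ.≤-refl i
        ; six  = λ e → let e′ = trans (sym (∑-wx x i)) e ; h = subst (5 ≤_) (sym e′) (ℕ.n≤1+n 5) in
            squares≡ h 6 e′ 12 (λ i → ℕ.≤-trans (squares≤ (wx x i)) (ℕ.≤-reflexive (cong₂ _*_ (top≡2 h i) (trans (∑-wx x i) e′)))) ℕ.≤-refl i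
        }

      regular : ∀ L j → Regular (W L j)
      regular L j = subst₂ (λ L j → Regular (W L j)) (pos-correct L j) (pos-pos L j) (regular-wx (pt L j) (pos L j))

      C : Fin 21 → ℕ
      C L = deviation (W L)

      arrangement : ∀ L t m → load (W L) m ≤ t → Arrangement t (tabulate (u ∘ pt L)) (∑ λ j → squares (W L j))
      arrangement L t m h = record
        { W = W L ; sizes = tabulate-cong (∑-W L) ; load≤6 = load≤6 L ; regular = regular L ; total = refl ; line = m ; load≤t = h }

      sparse? : ∀ L → (∃ λ m → load (W L) m ≤ 1) ⊎ (∀ m → 2 ≤ load (W L) m)
      sparse? L with Fin.any? (λ m → load (W L) m ℕ.≤? 1)
      ... | yes p = inj₁ p
      ... | no ¬p = inj₂ λ m → ℕ.≰⇒> (λ h → ¬p (m , h))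

      deviates≤4 : ∀ g → 2 ≤ g → g ≤ 6 → deviates g ≤ 4
      deviates≤4 2 _ _ = ℕ.≤-refl
      deviates≤4 3 _ _ = ≤ᵇ-sound 1 4 refl
      deviates≤4 4 _ _ = z≤n
      deviates≤4 5 _ _ = ≤ᵇ-sound 1 4 refl
      deviates≤4 6 _ _ = ℕ.≤-refl
      deviates≤4 0 () _
      deviates≤4 1 (s≤s ()) _
      deviates≤4 (suc (suc (suc (suc (suc (suc (suc g))))))) _ (s≤s (s≤s (s≤s (s≤s (s≤s (s≤s ()))))))

      line : ∀ L → LineClass (tabulate (u ∘ pt L)) (C L)
      line L = record
        { arrangement = arrangement L 6 0F (load≤6 L 0F)
        ; law = trans (cong₂ (λ a b → C L + 32 * a + b) (sym U-list) (sym squares-list))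
            (trans (deviation-identity (W L)) (cong (λ a → 4 * (∑ λ j → squares (W L j)) + a * a + 256) U-list))
        ; near = [ (λ (m , h) → inj₂ (arrangement L 1 m h)) , (λ h → inj₁ (ℕ.≤-trans (∑-mono λ m → deviates≤4 (load (W L) m) (h m) (load≤6 L m)) (ℕ.≤-reflexive (∑-const 16 4)))) ]′ (sparse? L)
        }
        where
        U-list : U (W L) ≡ listSum (tabulate (u ∘ pt L))
        U-list = trans (U≡ L) (∑-list (u ∘ pt L))
        squares-list : ∑ (λ j → ∑ (W L j) * ∑ (W L j)) ≡ sumSquares (tabulate (u ∘ pt L))
        squares-list = trans (∑-cong λ j → cong (λ n → n * n) (∑-W L j))
          (trans (∑-list (λ j → u (pt L j) * u (pt L j))) (cong listSum (sym (map-tabulate (u ∘ pt L) (λ n → n * n)))))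

      Q D : ℕ
      Q = ∑ λ x → u x * u x
      D = ∑ (deviates ∘ u)

      ∑-deviates : D + 8 * ∑ u ≡ Q + 336
      ∑-deviates = begin
        D + 8 * ∑ u ≡⟨ cong (D +_) (sym (∑-*ˡ 8 u)) ⟩
        D + ∑ (λ x → 8 * u x) ≡⟨ sym (∑-+ (deviates ∘ u) (λ x → 8 * u x)) ⟩
        ∑ (λ x → deviates (u x) + 8 * u x) ≡⟨ ∑-cong (λ x → deviates-square (u x)) ⟩
        ∑ (λ x → u x * u x + 16) ≡⟨ ∑-+ (λ x → u x * u x) (λ _ → 16) ⟩
        Q + ∑ {21} (λ _ → 16) ≡⟨ cong (Q +_) (∑-const 21 16) ⟩
        Q + 336 ∎
        where open ≡-Reasoning

      ∑-S : ∑ (λ L → ∑ (λ j → squares (W L j))) ≡ Q + 4 * ∑ u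
      ∑-S = begin
        ∑ (λ L → ∑ (λ j → squares (W L j))) ≡⟨ ∑-flags² (λ L j → squares (W L j)) ⟩
        ∑ (λ x → ∑ (λ i → squares (wx x i))) ≡⟨ ∑-cong ∑-squares ⟩
        ∑ (λ x → u x * u x + 4 * u x) ≡⟨ ∑-+ (λ x → u x * u x) (λ x → 4 * u x) ⟩
        Q + ∑ (λ x → 4 * u x) ≡⟨ cong (Q +_) (∑-*ˡ 4 u) ⟩
        Q + 4 * ∑ u ∎
        where open ≡-Reasoning

      ∑-identity : ∑ C + 32 * (5 * ∑ u) + 5 * Q ≡ 4 * (Q + 4 * ∑ u) + (∑ u * ∑ u + 4 * Q) + 5376
      ∑-identity = begin
        ∑ C + 32 * (5 * ∑ u) + 5 * Q
          ≡⟨ cong₂ (λ a b → ∑ C + a + b) (trans (cong (32 *_) (sym (∑-lineSum u))) (sym (∑-*ˡ 32 (lineSum u))))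
               (sym (∑-lineSum (λ x → u x * u x))) ⟩
        ∑ C + ∑ (λ L → 32 * lineSum u L) + ∑ (lineSum (λ x → u x * u x))
          ≡⟨ sym (trans (∑-+ (λ L → C L + 32 * lineSum u L) (lineSum (λ x → u x * u x))) (cong (_+ ∑ (lineSum (λ x → u x * u x))) (∑-+ C (λ L → 32 * lineSum u L)))) ⟩
        ∑ (λ L → C L + 32 * lineSum u L + lineSum (λ x → u x * u x) L)
          ≡⟨ ∑-cong per-line ⟩
        ∑ (λ L → 4 * S L + lineSum u L * lineSum u L + 256)
          ≡⟨ trans (∑-+ (λ L → 4 * S L + lineSum u L * lineSum u L) (λ _ → 256)) (cong₂ _+_ (∑-+ (λ L → 4 * S L) (λ L → lineSum u L * lineSum u L)) (∑-const 21 256)) ⟩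
        ∑ (λ L → 4 * S L) + ∑ (λ L → lineSum u L * lineSum u L) + 5376
          ≡⟨ cong (_+ 5376) (cong₂ _+_ (trans (∑-*ˡ 4 S) (cong (4 *_) ∑-S)) (∑-lineSum-product u u)) ⟩
        4 * (Q + 4 * ∑ u) + (∑ u * ∑ u + 4 * Q) + 5376 ∎
        where
        open ≡-Reasoning
        S : Fin 21 → ℕ
        S L = ∑ λ j → squares (W L j)
        per-line : ∀ L → C L + 32 * lineSum u L + lineSum (λ x → u x * u x) L ≡ 4 * S L + lineSum u L * lineSum u L + 256
        per-line L = trans (cong₂ (λ a b → C L + 32 * a + b) (sym (U≡ L)) (sym (∑-cong λ j → cong (λ n → n * n) (∑-W L j))))
          (trans (deviation-identity (W L)) (cong (λ a → 4 * S L + a * a + 256) (U≡ L)))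

      sum-C : ∑ C ≡ 1344 + 3 * D
      -- 13440 = 32 · 5 · 84, 7056 = 84², 5376 = 21 · 256 and 672 = 8 · 84, while 336 is both 4 · 84
      -- and 21 · 16.
      sum-C = eliminate (∑ C) D Q 13440 336 7056 5376 672 1344
        (subst (λ n → ∑ C + 32 * (5 * n) + 5 * Q ≡ 4 * (Q + 4 * n) + (n * n + 4 * Q) + 5376) sum-u ∑-identity)
        (subst (λ n → D + 8 * n ≡ Q + 336) sum-u ∑-deviates) refl

      open Conclusion u C line sum-u sum-C u≤6 (λ x i h → heavy h i) public

      not-sparse : ∀ L m → ¬ (load (W L) m ≤ 1)
      not-sparse L m h = ℕ.<⇒≱ (ℕ.≤-refl {64}) (subst (_≤ 63) (all-64 L)
        (bounded-sound 1 63 (4 ∷ 4 ∷ 4 ∷ 4 ∷ 4 ∷ []) (resp-↭ perm (line L)) regular-line (rearrange perm (arrangement L 1 m h))))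
        where
        perm : tabulate (u ∘ pt L) ↭ 4 ∷ 4 ∷ 4 ∷ 4 ∷ 4 ∷ []
        perm = ↭-reflexive (us-four L)

      two-or-six : ∀ L m → load (W L) m ≡ 2 ⊎ load (W L) m ≡ 6
      two-or-six L m = go (load (W L) m) (∑-tight {f = λ m → deviates (load (W L) m)} {g = λ _ → 4}
          (λ m → deviates≤4 (load (W L) m) (≥2 m) (load≤6 L m)) (ℕ.≤-reflexive (trans (∑-const 16 4) (sym (all-64 L)))) m)
        (≥2 m) (load≤6 L m)
        where
        ≥2 : ∀ m → 2 ≤ load (W L) m
        ≥2 m = ℕ.≰⇒> (not-sparse L m)
        go : ∀ g → deviates g ≡ 4 → 2 ≤ g → g ≤ 6 → g ≡ 2 ⊎ g ≡ 6
        go 2 _ _ _ = inj₁ refl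
        go 6 _ _ _ = inj₂ refl
        go 3 () _ _
        go 4 () _ _
        go 5 () _ _
        go 0 _ () _
        go 1 _ (s≤s ()) _
        go (suc (suc (suc (suc (suc (suc (suc g))))))) _ _ (s≤s (s≤s (s≤s (s≤s (s≤s (s≤s ()))))))

-- A common coordinate model of the three rings and of their planes.

module ChainRings where

  open Prelude
  open Sums
  open AffinePlane
  open Search using (≡ᵇ-complete)
  open LineClasses using (⇒-sound)
  open ProjectivePlane
  import Data.Nat.Properties as ℕ
  open import Data.Fin.Base using (splitAt)
  open import Data.Vec.Base as Vec using (Vec; lookup)
  open import Data.Vec.Properties using (lookup∘tabulate)
  open import Algebra.Properties.Semiring.Sum ℕ.+-*-semiring using (sum)

  -- Normalised homogeneous coordinates (1 : b : c), (0 : 1 : c) or (0 : 0 : 1).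
  data Form : Set where
    first  : (b c : F) → Form
    second : (c : F) → Form
    third  : Form

  coords : Fin 21 → Form
  coords x = [ (λ m → first (pt₁ m) (pt₂ m)) , rest ]′ (splitAt 16 x)
    where
    rest : Fin 5 → Form
    rest 0F = second 0F
    rest 1F = second 1F
    rest 2F = second 2F
    rest 3F = second 3F
    rest 4F = third

  Elem Triple : Set
  Elem   = F × F
  Triple = Elem × Elem × Elem

  lift : Form → F → F → Triple
  lift (first b c) s t = (1F , 0F) , (b , s) , (c , t)
  lift (second c)  s t = (0F , s) , (1F , 0F) , (c , t)
  lift third       s t = (0F , s) , (0F , t) , (1F , 0F)

  ==-complete : ∀ {n} {i j : Fin n} → i ≡ j → (i == j) ≡ true
  ==-complete {i = i} refl = ≡ᵇ-complete (δ-refl i)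

  -- A chain ring of length 2 with residue field 𝔽₄ on pairs (a , b), standing for
  -- a + bX with X in the radical: κ is the carry of the addition of residues and
  -- σ is the automorphism with Xa = σ(a)X.  For 𝔾₄ take X = 2 and a, b
  -- Teichmüller representatives, whose sums carry √(ac).
  module Model (κ : F → F → F) (σ : F → F) where

    infixl 6 _⊞_
    infixl 7 _⊠_

    _⊞_ _⊠_ : Elem → Elem → Elem
    (a , b) ⊞ (c , d) = a ⊕ c , (b ⊕ d) ⊕ κ a c
    (a , b) ⊠ (c , d) = a ⊗ c , a ⊗ d ⊕ b ⊗ σ c

    dot : Triple → Triple → Elem
    dot (a , b , c) (x , y , z) = a ⊠ x ⊞ (b ⊠ y ⊞ c ⊠ z)

    vec : Fin 21 → Fin 16 → Triple
    vec x v = lift (coords x) (pt₁ v) (pt₂ v)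

    -- The offset carries σ because Xp = σ(p)X: applied to a residue vector p, the part σ(m)X of the
    -- form gives σ(m·p)X. So the same map `std` describes the segments whether or not X is central.
    form-of : Fin 21 → Fin 16 → Triple
    form-of L m = lift (coords L) (σ (pt₁ m)) (σ (pt₂ m))

    -- The residue coordinates of a point on L, apart from the one eliminated by L.
    residues : Form → Triple → F × F
    residues (first _ _) ((a , _) , (b , _) , (c , _)) = b , c
    residues (second _)  ((a , _) , (b , _) , (c , _)) = a , c
    residues third       ((a , _) , (b , _) , (c , _)) = a , b

    -- The directions in `form` are (1 , t) and (0 , 1), so the first nonzero entry is the factor λ.
    leading : F × F → F
    leading (0F , t) = t
    leading (s  , t) = s

    -- With p = λ·(s , t) for the j-th direction (s , t), the point p + vX lies on ℓ + σ(m)X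
    -- if and only if ℓ(p + vX) = σ(λ)σ(std j m)X.
    seg : Fin 21 → Fin 5 → Fin 16 → F
    seg L j v = frob (leading (residues (coords L) p)) ⊗ σ (proj₂ (dot (lift (coords L) 0F 0F) p))
      where p = vec (pt L j) v

    segx : Fin 21 → Fin 5 → Fin 16 → F
    segx x i = seg (pt x i) (pos x i)

    zero? : Elem → Bool
    zero? (a , b) = if a == 0F then b == 0F else false

    -- The tables are passed as arguments so that they are evaluated only once.
    meets? : F → Triple → Fin 21 → Fin 5 → Bool
    meets? s p L j = allF λ m → if s == std j m then zero? (dot (form-of L m) p) else true

    Incident : Set
    Incident = Check₃ (λ L j v → meets? (seg L j v) (vec (pt L j) v) L j)

    transversal? : Vec (Vec F 16) 5 → Fin 16 → Fin 16 → Bool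
    transversal? T v v′ = sum (λ i → δ (lookup (lookup T i) v) (lookup (lookup T i) v′)) ≡ᵇ 1 + 4 * δ v v′

    segments : Fin 21 → Vec (Vec F 16) 5
    segments x = Vec.tabulate λ i → Vec.tabulate (segx x i)

    affine? : Vec (Vec F 16) 5 → Bool
    affine? T = allF λ v → allF (transversal? T v)

    Affine : Set
    Affine = Check₁ (affine? ∘ segments)

    -- The lines with m = 0 through a point: one or, in the subplane over 𝔽₄, five.
    degree : Fin 21 → Fin 16 → ℕ
    degree x v = sum λ i → δ (segx x i v) (std (pos x i) 0F)

    -- With the carry `none` the pairs (a , 0) form a copy of 𝔽₄. With `witt` they are not closed
    -- under addition, as (1 , 0) ⊞ (1 , 0) = (0 , 1).
    Subplane : Set
    Subplane = Check₂ (λ x v → degree x v ≡ᵇ 1 + 4 * (if degree x v ≡ᵇ 5 then 1 else 0))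

    incident : Incident → ∀ L j v m → seg L j v ≡ std j m → dot (form-of L m) (vec (pt L j) v) ≡ (0F , 0F)
    incident h L j v m eq = zero?-sound (dot (form-of L m) (vec (pt L j) v))
      (⇒-sound (seg L j v == std j m) _ (allF-sound (λ m → if seg L j v == std j m then zero? (dot (form-of L m) (vec (pt L j) v)) else true) (check₃ h L j v) m) (==-complete eq))
      where
      zero?-sound : ∀ e → zero? e ≡ true → e ≡ (0F , 0F)
      zero?-sound (0F , 0F) _ = refl

    affine : Affine → ∀ x v v′ → ∑ (λ i → δ (segx x i v) (segx x i v′)) ≡ 1 + 4 * δ v v′
    affine h x v v′ = begin
      ∑ (λ i → δ (segx x i v) (segx x i v′))
        ≡⟨ ∑-cong (λ i → cong₂ δ (sym (entry i v)) (sym (entry i v′))) ⟩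
      ∑ (λ i → δ (lookup (lookup (segments x) i) v) (lookup (lookup (segments x) i) v′))
        ≡⟨ ∑≡sum _ ⟩
      sum (λ i → δ (lookup (lookup (segments x) i) v) (lookup (lookup (segments x) i) v′))
        ≡⟨ ≡ᵇ-sound _ _ (allF-sound (transversal? (segments x) v) (allF-sound (λ v → allF (transversal? (segments x) v)) (check₁ h x) v) v′) ⟩
      1 + 4 * δ v v′ ∎
      where
      open ≡-Reasoning
      entry : ∀ i v → lookup (lookup (segments x) i) v ≡ segx x i v
      entry i v = trans (cong (λ T → lookup T v) (lookup∘tabulate (λ i → Vec.tabulate (segx x i)) i)) (lookup∘tabulate (segx x i) v)

  witt none : F → F → F
  witt a c = frob (a ⊗ c)
  none a c = 0F

  module 𝔾 = Model witt id
  module 𝕊 = Model none id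
  module 𝕋 = Model none frob

  opaque
    unfolding pt pos

    incident-𝔾 : 𝔾.Incident
    incident-𝔾 = by refl

    affine-𝔾 : 𝔾.Affine
    affine-𝔾 = by refl

    incident-𝕊 : 𝕊.Incident
    incident-𝕊 = by refl

    affine-𝕊 : 𝕊.Affine
    affine-𝕊 = by refl

    incident-𝕋 : 𝕋.Incident
    incident-𝕋 = by refl

    affine-𝕋 : 𝕋.Affine
    affine-𝕋 = by refl

    subplane-𝕊 : 𝕊.Subplane
    subplane-𝕊 = by refl

    subplane-𝕋 : 𝕋.Subplane
    subplane-𝕋 = by refl

-- Points and lines of PHG(2,R) in normalised coordinates.

module CoordinateVectors where

  open Sums
  open AffinePlane
  open ProjectivePlane
  open ChainRings
  open import Defs
  open import Algebra.Bundles using (Ring)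
  open import Algebra.Module.Bundles using (RightModule)
  import Algebra.Properties.Ring as RingProperties
  open import Data.Bool.Base using (Bool; true; false; if_then_else_; _∧_)
  open import Data.Nat.Base as ℕ using (zero; suc)
  open import Data.Fin.Base using (Fin; zero; suc; combine; _↑ˡ_; _↑ʳ_; inject₁)
  open import Data.Fin.Patterns
  import Data.Fin.Properties as Fin
  open import Data.Product.Base using (_×_; _,_; proj₁; proj₂; ∃)
  open import Data.Sum.Base using (_⊎_; inj₁; inj₂; [_,_]′)
  open import Data.Empty using (⊥-elim)
  open import Function.Base using (id)
  open import Function.Bundles using (Inverse)
  open import Relation.Nullary using (¬_)
  open import Relation.Binary.PropositionalEquality as ≡ using (_≡_; _≢_; refl)
  import Relation.Binary.Reasoning.Setoid as SetoidReasoning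

  elem : Fin 16 → Elem
  elem m = pt₁ m , pt₂ m

  pt₁-combine : ∀ a b → pt₁ (combine a b) ≡ a
  pt₁-combine a b = ≡.cong proj₁ (Fin.remQuot-combine {4} {4} a b)

  pt₂-combine : ∀ a b → pt₂ (combine {4} {4} a b) ≡ b
  pt₂-combine a b = ≡.cong proj₂ (Fin.remQuot-combine {4} {4} a b)

  class-first : F → F → Fin 21
  class-first b c = combine b c ↑ˡ 5

  class-second : F → Fin 21
  class-second c = 16 ↑ʳ inject₁ c

  coords-first : ∀ b c → coords (class-first b c) ≡ first b c
  coords-first b c = ≡.trans (≡.cong [ _ , _ ]′ (Fin.splitAt-↑ˡ 16 (combine b c) 5)) (≡.cong₂ first (pt₁-combine b c) (pt₂-combine b c))

  coords-second : ∀ c → coords (class-second c) ≡ second c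
  coords-second 0F = refl
  coords-second 1F = refl
  coords-second 2F = refl
  coords-second 3F = refl

  module Coordinates (R : FiniteRing) (κ : F → F → F) (σ : F → F)
    (decode : Elem → Ring.Carrier (FiniteRing.ring R)) where

    open FiniteRing R
    open Ring ring hiding (zero) renaming (refl to ≈-refl)
    open Model κ σ
    open PHG ring
    module V = RightModule R³
    open Inverse (proj₂ finite) using (to; from-cong; strictlyInverseʳ)

    to-injective : ∀ {a b} → to a ≡ to b → a ≈ b
    to-injective eq = trans (sym (strictlyInverseʳ _)) (trans (from-cong eq) (strictlyInverseʳ _))

    same : Carrier → Carrier → Bool
    same a b = to a == to b

    same-sound : ∀ {a b} → same a b ≡ true → a ≈ b
    same-sound eq = to-injective (==-sound eq)

    isOne : Elem → Bool
    isOne (a , b) = if a == 1F then b == 0F else false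

    inverse : Elem → Elem
    inverse e = elem (locate (λ m → isOne (e ⊠ elem m)))

    index : Fin (proj₁ finite) → Elem
    index c = elem (locate (λ m → to (decode (elem m)) == c))

    record IsCoordinates : Set where
      field
        homo-+    : Check₄ (λ a b c d → same (decode (a , b) + decode (c , d)) (decode ((a , b) ⊞ (c , d))))
        homo-*    : Check₄ (λ a b c d → same (decode (a , b) * decode (c , d)) (decode ((a , b) ⊠ (c , d))))
        homo-0    : same (decode (0F , 0F)) 0# ≡ true
        homo-1    : same (decode (1F , 0F)) 1# ≡ true
        proper    : same (decode (0F , 1F)) 0# ≡ false
        onto      : Check₁ (λ c → to (decode (index c)) == c)
        units     : Check₂ (λ a b → if a == 0F then true else
                      (isOne ((a , b) ⊠ inverse (a , b)) ∧ isOne (inverse (a , b) ⊠ (a , b))))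
        σ-zero    : σ 0F ≡ 0F

    module Geometry (coordinates : IsCoordinates) where

      open IsCoordinates coordinates
      open RingProperties ring using (-‿distribˡ-*)
      open import Algebra.Properties.AbelianGroup +-abelianGroup using (⁻¹-∙-comm; inverseˡ-unique)
      open import Data.Fin.Subset using (Subset)

      private
        module ≈-Reasoning = SetoidReasoning setoid
        module ≈ᴹ-Reasoning = SetoidReasoning V.≈ᴹ-setoid

      decode-+ : ∀ x y → decode x + decode y ≈ decode (x ⊞ y)
      decode-+ (a , b) (c , d) = same-sound (check₄ homo-+ a b c d)

      decode-* : ∀ x y → decode x * decode y ≈ decode (x ⊠ y)
      decode-* (a , b) (c , d) = same-sound (check₄ homo-* a b c d)

      decode-0 : decode (0F , 0F) ≈ 0#
      decode-0 = same-sound homo-0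

      decode-1 : decode (1F , 0F) ≈ 1#
      decode-1 = same-sound homo-1

      θ : Carrier
      θ = decode (0F , 1F)

      θ≉0 : ¬ (θ ≈ 0#)
      θ≉0 eq with ≡.trans (≡.sym proper) (==-complete (Inverse.to-cong (proj₂ finite) eq))
      ... | ()

      encode : Carrier → Elem
      encode a = index (to a)

      decode-encode : ∀ a → decode (encode a) ≈ a
      decode-encode a = to-injective (==-sound (check₁ onto (to a)))

      isOne-sound : ∀ e → isOne e ≡ true → decode e ≈ 1#
      isOne-sound (1F , 0F) _ = decode-1

      ∧-sound : ∀ a b → a ∧ b ≡ true → a ≡ true × b ≡ true
      ∧-sound true true _ = refl , refl

      unit : ∀ a b → a ≢ 0F → decode (a , b) * decode (inverse (a , b)) ≈ 1# × decode (inverse (a , b)) * decode (a , b) ≈ 1#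
      unit a b a≢0 = trans (decode-* (a , b) (inverse (a , b))) (isOne-sound _ (proj₁ both)) ,
                     trans (decode-* (inverse (a , b)) (a , b)) (isOne-sound _ (proj₂ both))
        where
        both : isOne ((a , b) ⊠ inverse (a , b)) ≡ true × isOne (inverse (a , b) ⊠ (a , b)) ≡ true
        both = ∧-sound _ _ (nonzero a a≢0 _ (check₂ units a b))
          where
          nonzero : ∀ (a : F) → a ≢ 0F → ∀ t → (if a == 0F then true else t) ≡ true → t ≡ true
          nonzero 0F h t _ = ⊥-elim (h refl)
          nonzero 1F h t eq = eq
          nonzero 2F h t eq = eq
          nonzero 3F h t eq = eq

      radical-θ : ∀ b → decode (0F , b) * θ ≈ 0#
      radical-θ b = trans (decode-* (0F , b) (0F , 1F)) (≡.subst (λ e → decode e ≈ 0#) (≡.sym product) decode-0)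
        where
        annihilated : ∀ c → c ⊗ 0F ≡ 0F
        annihilated 0F = refl
        annihilated 1F = refl
        annihilated 2F = refl
        annihilated 3F = refl
        product : (0F , b) ⊠ (0F , 1F) ≡ (0F , 0F)
        product = ≡.cong (0F ,_) (≡.trans (≡.cong (b ⊗_) σ-zero) (annihilated b))

      decode³ : Triple → V.Carrierᴹ
      decode³ (a , b , c) = decode a , decode b , decode c

      vector : Fin 21 → Fin 16 → V.Carrierᴹ
      vector x v = decode³ (vec x v)

      vec-class : ∀ x f → coords x ≡ f → ∀ s t → vec x (combine s t) ≡ lift f s t
      vec-class x f eq s t = ≡.trans (≡.cong (λ f → lift f (pt₁ (combine s t)) (pt₂ (combine s t))) eq)
        (≡.cong₂ (lift f) (pt₁-combine s t) (pt₂-combine s t))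

      Normal : V.Carrierᴹ → Set
      Normal g = ∃ λ x → ∃ λ v → ∃ λ μ → ∃ λ μ′ → (g V.*ᵣ μ V.≈ᴹ vector x v) × (μ * μ′ ≈ 1#)

      normal : ∀ g x v t → vec x v ≡ t → ∀ μ μ′ → g V.*ᵣ μ V.≈ᴹ decode³ t → μ * μ′ ≈ 1# → Normal g
      normal g x v t refl μ μ′ p q = x , v , μ , μ′ , p , q

      -- The first unit among the coordinates is scaled to 1 from the right. Without a unit all
      -- coordinates lie in the radical and are annihilated by θ ≠ 0, so that g is not independent.
      normalise : ∀ g → Normal g ⊎ (g V.*ᵣ θ V.≈ᴹ V.0ᴹ)
      normalise (a , b , c) = go (encode a) (encode b) (encode c) (decode-encode a) (decode-encode b) (decode-encode c)
        where
        scaled : ∀ d e → decode e ≈ d → ∀ m → d * decode m ≈ decode (e ⊠ m)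
        scaled d e p m = trans (*-congʳ (sym p)) (decode-* e m)
        one : ∀ d e₁ e₂ → decode (e₁ , e₂) ≈ d → e₁ ≢ 0F → d * decode (inverse (e₁ , e₂)) ≈ decode (1F , 0F)
        one d e₁ e₂ p h = trans (*-congʳ (sym p)) (trans (proj₁ (unit e₁ e₂ h)) (sym decode-1))
        go : ∀ a′ b′ c′ → decode a′ ≈ a → decode b′ ≈ b → decode c′ ≈ c →
          Normal (a , b , c) ⊎ ((a , b , c) V.*ᵣ θ V.≈ᴹ V.0ᴹ)
        go (0F , a₂) (0F , b₂) (0F , c₂) p q r = inj₂
          ( trans (*-congʳ (sym p)) (radical-θ a₂) , trans (*-congʳ (sym q)) (radical-θ b₂) , trans (*-congʳ (sym r)) (radical-θ c₂) )
        go (0F , a₂) (0F , b₂) (suc c₁ , c₂) p q r = inj₁ (normal (a , b , c) (16 ↑ʳ 4F) (combine (proj₂ ea) (proj₂ eb))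
            ((0F , proj₂ ea) , (0F , proj₂ eb) , (1F , 0F))
            (vec-class (16 ↑ʳ 4F) third refl (proj₂ ea) (proj₂ eb))
            (decode μ) (decode (suc c₁ , c₂))
            (scaled a (0F , a₂) p μ , scaled b (0F , b₂) q μ , one c (suc c₁) c₂ r (λ ()))
            (proj₂ (unit (suc c₁) c₂ (λ ()))))
          where
          μ  = inverse (suc c₁ , c₂)
          ea = (0F , a₂) ⊠ μ
          eb = (0F , b₂) ⊠ μ
        go (0F , a₂) (suc b₁ , b₂) c′ p q r = inj₁ (normal (a , b , c) (class-second (proj₁ ec)) (combine (proj₂ ea) (proj₂ ec))
            ((0F , proj₂ ea) , (1F , 0F) , ec)
            (vec-class (class-second (proj₁ ec)) (second (proj₁ ec)) (coords-second (proj₁ ec)) (proj₂ ea) (proj₂ ec))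
            (decode μ) (decode (suc b₁ , b₂))
            (scaled a (0F , a₂) p μ , one b (suc b₁) b₂ q (λ ()) , scaled c c′ r μ)
            (proj₂ (unit (suc b₁) b₂ (λ ()))))
          where
          μ  = inverse (suc b₁ , b₂)
          ea = (0F , a₂) ⊠ μ
          ec = c′ ⊠ μ
        go (suc a₁ , a₂) b′ c′ p q r = inj₁ (normal (a , b , c) (class-first (proj₁ eb) (proj₁ ec)) (combine (proj₂ eb) (proj₂ ec))
            ((1F , 0F) , eb , ec)
            (vec-class (class-first (proj₁ eb) (proj₁ ec)) (first (proj₁ eb) (proj₁ ec)) (coords-first (proj₁ eb) (proj₁ ec)) (proj₂ eb) (proj₂ ec))
            (decode μ) (decode (suc a₁ , a₂))
            (one a (suc a₁) a₂ p (λ ()) , scaled b b′ q μ , scaled c c′ r μ)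
            (proj₂ (unit (suc a₁) a₂ (λ ()))))
          where
          μ  = inverse (suc a₁ , a₂)
          eb = b′ ⊠ μ
          ec = c′ ⊠ μ

      record OnCell (P : Point) : Set where
        field
          cls  : Fin 21
          cell : Fin 16
          ⊆vector : ∀ {w} → Point.members P w → ∃ λ r → w V.≈ᴹ vector cls cell V.*ᵣ r
          vector⊆ : ∀ r → Point.members P (vector cls cell V.*ᵣ r)

      onCell : ∀ P → OnCell P
      onCell P = [ at , (λ g*θ≈0 → ⊥-elim (θ≉0 (independent (λ _ → θ) (V.≈ᴹ-trans (V.+ᴹ-identityʳ (g V.*ᵣ θ)) g*θ≈0) zero))) ]′ (normalise g)
        where
        module P = Point P
        b = proj₁ P.free
        g = b zero
        independent = proj₁ (proj₂ P.free)
        at : Normal g → OnCell P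
        at (x , v , μ , μ′ , gμ , μμ′) = record
          { cls = x ; cell = v
          ; ⊆vector = λ {w} m → let (c , eq) = proj₁ (proj₂ (proj₂ P.free)) m in μ′ * c zero , (begin
              w ≈⟨ eq ⟩
              g V.*ᵣ c zero V.+ᴹ V.0ᴹ ≈⟨ V.+ᴹ-identityʳ (g V.*ᵣ c zero) ⟩
              g V.*ᵣ c zero ≈⟨ V.*ᵣ-congˡ (sym (trans (*-congʳ μμ′) (*-identityˡ (c zero)))) ⟩
              g V.*ᵣ (μ * μ′ * c zero) ≈⟨ V.*ᵣ-congˡ (*-assoc μ μ′ (c zero)) ⟩
              g V.*ᵣ (μ * (μ′ * c zero)) ≈⟨ V.≈ᴹ-sym (V.*ᵣ-assoc g μ (μ′ * c zero)) ⟩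
              g V.*ᵣ μ V.*ᵣ (μ′ * c zero) ≈⟨ V.*ᵣ-congʳ gμ ⟩
              vector x v V.*ᵣ (μ′ * c zero) ∎)
          ; vector⊆ = λ r → P.*-closed (P.resp-≈ᴹ gμ (P.*-closed (proj₂ (proj₂ (proj₂ P.free))
              ((λ _ → 1#) , V.≈ᴹ-sym (V.≈ᴹ-trans (V.+ᴹ-identityʳ (g V.*ᵣ 1#)) (V.*ᵣ-identityʳ g)))) μ)) r
          }
          where open ≈ᴹ-Reasoning

      functional : V.Carrierᴹ → V.Carrierᴹ → Carrier
      functional (a , b , c) (x , y , z) = a * x + (b * y + c * z)

      record Kernel (ℓ : V.Carrierᴹ) : Set where
        field
          basis       : Fin 2 → V.Carrierᴹ
          independent : Independent R³ basis
          spanning    : ∀ w → functional ℓ w ≈ 0# → Span R³ basis w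

      pair : V.Carrierᴹ → V.Carrierᴹ → Fin 2 → V.Carrierᴹ
      pair p q 0F = p
      pair p q 1F = q

      scalars : Carrier → Carrier → Fin 2 → Carrier
      scalars r s 0F = r
      scalars r s 1F = s

      left-coordinate : ∀ r s → 1# * r + (0# * s + 0#) ≈ r
      left-coordinate r s = trans (+-cong (*-identityˡ r) (trans (+-identityʳ (0# * s)) (zeroˡ s))) (+-identityʳ r)

      right-coordinate : ∀ r s → 0# * r + (1# * s + 0#) ≈ s
      right-coordinate r s = trans (+-cong (zeroˡ r) (trans (+-identityʳ (1# * s)) (*-identityˡ s))) (+-identityˡ s)

      solved : ∀ p q r s t → t + (p * r + q * s) ≈ 0# → t ≈ (- p) * r + ((- q) * s + 0#)
      solved p q r s t eq = begin
        t ≈⟨ inverseˡ-unique t (p * r + q * s) eq ⟩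
        - (p * r + q * s) ≈⟨ sym (⁻¹-∙-comm (p * r) (q * s)) ⟩
        - (p * r) + - (q * s) ≈⟨ +-cong (-‿distribˡ-* p r) (-‿distribˡ-* q s) ⟩
        (- p) * r + (- q) * s ≈⟨ +-congˡ (sym (+-identityʳ ((- q) * s))) ⟩
        (- p) * r + ((- q) * s + 0#) ∎
        where open ≈-Reasoning

      -- Coefficients act from the left and scalars from the right, so the form is linear. On its
      -- kernel the coordinate with coefficient 1 is determined by the other two, which can be
      -- chosen freely.
      kernel-basis : ∀ f s t → Kernel (decode³ (lift f s t))
      kernel-basis (first b c) s t = record
        { basis       = pair (- β , 1# , 0#) (- γ , 0# , 1#)
        ; independent = λ { k (_ , p , q) 0F → trans (sym (left-coordinate (k 0F) (k 1F))) p
                          ; k (_ , p , q) 1F → trans (sym (right-coordinate (k 0F) (k 1F))) q }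
        ; spanning    = λ (x , y , z) eq → scalars y z ,
            solved β γ y z x (trans (+-congʳ (sym (trans (*-congʳ decode-1) (*-identityˡ x)))) eq) ,
            sym (left-coordinate y z) , sym (right-coordinate y z)
        }
        where
        β = decode (b , s)
        γ = decode (c , t)
      kernel-basis (second c) s t = record
        { basis       = pair (1# , - ε , 0#) (0# , - γ , 1#)
        ; independent = λ { k (p , _ , q) 0F → trans (sym (left-coordinate (k 0F) (k 1F))) p
                          ; k (p , _ , q) 1F → trans (sym (right-coordinate (k 0F) (k 1F))) q }
        ; spanning    = λ (x , y , z) eq → scalars x z ,
            sym (left-coordinate x z) ,
            solved ε γ x z y (trans (rotate y (ε * x) (γ * z) (trans (*-congʳ decode-1) (*-identityˡ y))) eq) ,
            sym (right-coordinate x z)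
        }
        where
        ε = decode (0F , s)
        γ = decode (c , t)
        rotate : ∀ y p q {y′} → y′ ≈ y → y + (p + q) ≈ p + (y′ + q)
        rotate y p q eq = trans (sym (+-assoc y p q)) (trans (+-congʳ (+-comm y p)) (trans (+-assoc p y q) (+-congˡ (+-congʳ (sym eq)))))
      kernel-basis third s t = record
        { basis       = pair (1# , 0# , - ε) (0# , 1# , - φ)
        ; independent = λ { k (p , q , _) 0F → trans (sym (left-coordinate (k 0F) (k 1F))) p
                          ; k (p , q , _) 1F → trans (sym (right-coordinate (k 0F) (k 1F))) q }
        ; spanning    = λ (x , y , z) eq → scalars x y ,
            sym (left-coordinate x y) , sym (right-coordinate x y) ,
            solved ε φ x y z (trans (rotate z (ε * x) (φ * y) (trans (*-congʳ decode-1) (*-identityˡ z))) eq)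
        }
        where
        ε = decode (0F , s)
        φ = decode (0F , t)
        rotate : ∀ z p q {z′} → z′ ≈ z → z + (p + q) ≈ p + (q + z′)
        rotate z p q eq = trans (+-comm z (p + q)) (trans (+-assoc p q z) (+-congˡ (+-congˡ (sym eq))))

      functional-decode : ∀ ℓ p → functional (decode³ ℓ) (decode³ p) ≈ decode (dot ℓ p)
      functional-decode (a , b , c) (x , y , z) = trans
        (+-cong (decode-* a x) (trans (+-cong (decode-* b y) (decode-* c z)) (decode-+ (b ⊠ y) (c ⊠ z))))
        (decode-+ (a ⊠ x) (b ⊠ y ⊞ c ⊠ z))

      module _ (L : Fin 21) (m : Fin 16) where

        private
          open module K = Kernel (kernel-basis (coords L) (σ (pt₁ m)) (σ (pt₂ m)))

        lineAt : Line
        lineAt = record { submodule = span R³ basis ; free = basis , independent , id , id }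

        vector-on-line : ∀ x v → dot (form-of L m) (vec x v) ≡ (0F , 0F) → Line.members lineAt (vector x v)
        vector-on-line x v eq = spanning (vector x v)
          (trans (functional-decode (form-of L m) (vec x v)) (≡.subst (λ e → decode e ≈ 0#) (≡.sym eq) decode-0))

        on-line : ∀ {P} (c : OnCell P) → dot (form-of L m) (vec (OnCell.cls c) (OnCell.cell c)) ≡ (0F , 0F) → P on lineAt
        on-line c eq member = let (r , w≈) = OnCell.⊆vector c member in
          Line.resp-≈ᴹ lineAt (V.≈ᴹ-sym w≈) (Line.*-closed lineAt (vector-on-line (OnCell.cls c) (OnCell.cell c) eq) r)

      same-cell : ∀ {P Q} (c : OnCell P) (d : OnCell Q) → OnCell.cls c ≡ OnCell.cls d → OnCell.cell c ≡ OnCell.cell d → P ≈ₚ Q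
      same-cell c d p q = inclusion c d p q , inclusion d c (≡.sym p) (≡.sym q)
        where
        inclusion : ∀ {P Q} (c : OnCell P) (d : OnCell Q) → OnCell.cls c ≡ OnCell.cls d → OnCell.cell c ≡ OnCell.cell d →
          ∀ {w} → Point.members P w → Point.members Q w
        inclusion {P} {Q} c d p q member = let (r , w≈) = OnCell.⊆vector c member in
          Point.resp-≈ᴹ Q (V.≈ᴹ-sym (V.≈ᴹ-trans w≈ (V.*ᵣ-congʳ (V.≈ᴹ-reflexive (≡.cong₂ vector p q))))) (OnCell.vector⊆ d r)

-- From arcs to incidence tables; deletion of points and the count modulo 4.

module ArcBounds where

  open Prelude
  open Sums
  open AffinePlane
  open ProjectivePlane
  open Balance using (∑-positive; ∑-punchIn)
  open NeighbourClasses using (module Cells)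
  open ChainRings
  open CoordinateVectors
  open import Defs
  open import Algebra.Bundles using (Ring)
  import Data.Nat.Base as ℕ
  import Data.Nat.Properties as ℕ
  open import Data.Nat.Divisibility using (_∣_; _∣?_; divides; ∣m+n∣m⇒∣n; ∣m∣n⇒∣m+n)
  import Data.Fin.Properties as Fin
  open import Data.Fin.Subset using (_∈_; ∣_∣)
  import Data.Vec.Base as Vec
  open import Data.Vec.Properties using (lookup∘tabulate; []=⇒lookup)
  open import Relation.Nullary.Decidable using (decidable-stable; from-no)

  if01 : Bool → ℕ
  if01 b = if b then 1 else 0

  ∣tabulate∣ : ∀ {n} (p : Fin n → Bool) → ∑ (if01 ∘ p) ≡ ∣ Vec.tabulate p ∣
  ∣tabulate∣ {zero}  p = ∑-zero {f = if01 ∘ p} λ ()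
  ∣tabulate∣ {suc n} p = trans (∑-suc (if01 ∘ p)) (trans (cong (if01 (p zero) +_) (∣tabulate∣ (p ∘ suc))) (step (p zero)))
    where
    step : ∀ b → if01 b + ∣ Vec.tabulate (p ∘ suc) ∣ ≡ ∣ b Vec.∷ Vec.tabulate (p ∘ suc) ∣
    step true  = refl
    step false = refl

  record Segments : Set where
    field
      seg    : Fin 21 → Fin 5 → Fin 16 → F
      affine : ∀ x v v′ → ∑ (λ i → δ (seg (pt x i) (pos x i) v) (seg (pt x i) (pos x i) v′)) ≡ 1 + 4 * δ v v′

  module CellArcs (segments : Segments) where

    open Segments segments

    -- The incidence, 0 or 1, of the line m of the class L with the point v of the class x.
    hits : Fin 21 → Fin 16 → Fin 21 → Fin 16 → ℕ
    hits L m x v = ∑ λ j → δ x (pt L j) * δ (seg L j v) (std j m)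

    record CellArc (k : ℕ) : Set where
      field
        cls       : Fin k → Fin 21
        cell      : Fin k → Fin 16
        injective : ∀ {i i′} → cls i ≡ cls i′ → cell i ≡ cell i′ → i ≡ i′
        light     : ∀ L m → ∑ (λ i → hits L m (cls i) (cell i)) ≤ 6

    open CellArc

    delete : ∀ {k} → CellArc (suc k) → Fin (suc k) → CellArc k
    delete A i = record
      { cls       = cls A ∘ punchIn i
      ; cell      = cell A ∘ punchIn i
      ; injective = λ p q → Fin.punchIn-injective i _ _ (injective A p q)
      ; light     = λ L m → ℕ.≤-trans (ℕ.≤-trans (ℕ.m≤n+m _ (hits L m (cls A i) (cell A i)))
          (ℕ.≤-reflexive (sym (∑-punchIn (λ i → hits L m (cls A i) (cell A i)) i)))) (light A L m)
      }

    module At {k} (A : CellArc k) = Cells seg affine (cls A) (cell A) (injective A) (light A)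

    u : ∀ {k} → CellArc k → Fin 21 → ℕ
    u A x = ∑ λ i → δ (cls A i) x

    four : (A : CellArc 84) → ∀ x → u A x ≡ 4
    four A = At.Eighty-four.all-four A refl

    -- Deleting the point i leaves four points in every class, so before the deletion only the class
    -- of i had five. This holds for every i, so all 85 points lie in one class, which has only
    -- five.
    no-85 : ¬ CellArc 85
    no-85 A = 85≢5 (trans (sym (trans (∑-cong all-equal) (∑-const 85 1))) (trans (u≡ 0F x₀) (cong (_+ 4) (δ-refl x₀))))
      where
      85≢5 : 85 ≢ 5
      85≢5 ()
      x₀ : Fin 21
      x₀ = cls A 0F
      u≡ : ∀ i x → u A x ≡ δ (cls A i) x + 4
      u≡ i x = trans (∑-punchIn (λ i → δ (cls A i) x) i) (cong (δ (cls A i) x +_) (four (delete A i) x))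
      all-equal : ∀ i → δ (cls A i) x₀ ≡ 1
      all-equal i = trans (ℕ.+-cancelʳ-≡ 4 (δ (cls A i) x₀) (δ x₀ x₀) (trans (sym (u≡ i x₀)) (u≡ 0F x₀))) (δ-refl x₀)

    bound : ∀ {k} → CellArc k → k ≤ 84
    bound {k} A = ℕ.≮⇒≥ λ 85≤k → descend (k ∸ 85) (subst CellArc (sym (ℕ.m∸n+n≡m 85≤k)) A)
      where
      descend : ∀ r → CellArc (r + 85) → ⊥
      descend zero    A = no-85 A
      descend (suc r) A = descend r (delete A zero)

    module _ (degree : Fin 21 → Fin 16 → ℕ)
      (degree≡ : ∀ x v → ∑ (λ i → δ (seg (pt x i) (pos x i) v) (std (pos x i) 0F)) ≡ 1 + 4 * degree x v) where

      -- The 21 lines m = 0 carry 84 + 4e points, and each of them carries 2 or 6.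
      no-84 : ¬ CellArc 84
      no-84 A = from-no (4 ∣? 42) (∣m+n∣m⇒∣n 4∣right (divides b (ℕ.*-comm 4 b)))
        where
        open At A using (module Eighty-four; load≤6; W)
        load₀ : Fin 21 → ℕ
        load₀ L = load (W L) 0F
        half : ∀ L → ∃ λ c → load₀ L ≡ 4 * c + 2
        half L = [ (λ eq → 0 , eq) , (λ eq → 1 , eq) ]′ (Eighty-four.two-or-six refl L 0F)
        b e : ℕ
        b = ∑ (λ L → proj₁ (half L))
        e = ∑ (λ i → degree (cls A i) (cell A i))
        left : ∑ load₀ ≡ 84 + 4 * e
        left = begin
          ∑ load₀
            ≡⟨ ∑-cong (λ L → ∑-swap (λ j i → δ (cls A i) (pt L j) * δ (seg L j (cell A i)) (std j 0F))) ⟩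
          ∑ (λ L → ∑ (λ i → hits L 0F (cls A i) (cell A i)))
            ≡⟨ ∑-swap (λ L i → hits L 0F (cls A i) (cell A i)) ⟩
          ∑ (λ i → ∑ (λ L → hits L 0F (cls A i) (cell A i)))
            ≡⟨ ∑-cong (λ i → trans (∑-flags-at (cls A i) (λ L j → δ (seg L j (cell A i)) (std j 0F))) (degree≡ (cls A i) (cell A i))) ⟩
          ∑ (λ i → 1 + 4 * degree (cls A i) (cell A i))
            ≡⟨ trans (∑-+ (λ _ → 1) (λ i → 4 * degree (cls A i) (cell A i))) (cong₂ _+_ (∑-const 84 1) (∑-*ˡ 4 (λ i → degree (cls A i) (cell A i)))) ⟩
          84 + 4 * e ∎
          where open ≡-Reasoning
        right : ∑ load₀ ≡ 4 * b + 42
        right = trans (∑-cong (λ L → proj₂ (half L))) (trans (∑-+ (λ L → 4 * proj₁ (half L)) (λ _ → 2)) (cong₂ _+_ (∑-*ˡ 4 (λ L → proj₁ (half L))) (∑-const 21 2)))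
        4∣right : 4 ∣ 4 * b + 42
        4∣right = subst (4 ∣_) (trans (sym left) right) (∣m∣n⇒∣m+n (divides 21 refl) (divides e (ℕ.*-comm 4 e)))

  module Arcs (R : FiniteRing) (κ : F → F → F) (σ : F → F) (decode : Elem → Ring.Carrier (FiniteRing.ring R))
    (coordinates : Coordinates.IsCoordinates R κ σ decode)
    (is-incident : Model.Incident κ σ) (is-affine : Model.Affine κ σ) where

    open Model κ σ
    open Coordinates R κ σ decode
    open Geometry coordinates
    open PHG (FiniteRing.ring R)

    segments₀ : Segments
    segments₀ = record { seg = seg ; affine = affine is-affine }

    open CellArcs segments₀ using (CellArc; hits)

    cellArc : ∀ {k} → Arc k 6 → CellArc k
    cellArc {k} A = record { cls = cls ; cell = cell ; injective = injective ; light = light }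
      where
      open Arc A
      place : ∀ i → OnCell (point i)
      place i = onCell (point i)
      cls : Fin k → Fin 21
      cls i = OnCell.cls (place i)
      cell : Fin k → Fin 16
      cell i = OnCell.cell (place i)
      injective : ∀ {i i′} → cls i ≡ cls i′ → cell i ≡ cell i′ → i ≡ i′
      injective {i} {i′} p q = decidable-stable (i Fin.≟ i′) λ i≢i′ → distinct i≢i′ (same-cell (place i) (place i′) p q)
      light : ∀ L m → ∑ (λ i → hits L m (cls i) (cell i)) ≤ 6
      light L m = begin
        ∑ h ≤⟨ ∑-mono (λ i → at-most (h i) (h≤1 i)) ⟩
        ∑ (λ i → if01 (1 ≤ᵇ h i)) ≡⟨ ∣tabulate∣ (λ i → 1 ≤ᵇ h i) ⟩
        ∣ Vec.tabulate (λ i → 1 ≤ᵇ h i) ∣ ≤⟨ bounded (lineAt L m) (Vec.tabulate (λ i → 1 ≤ᵇ h i)) (λ {i} i∈ → incident-at i (member i i∈)) ⟩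
        6 ∎
        where
        open ℕ.≤-Reasoning
        h : Fin k → ℕ
        h i = hits L m (cls i) (cell i)
        h≤1 : ∀ i → h i ≤ 1
        h≤1 i = ℕ.≤-trans (∑-mono λ j → ℕ.≤-trans (ℕ.*-monoʳ-≤ (δ (cls i) (pt L j)) (δ≤1 (seg L j (cell i)) (std j m))) (ℕ.≤-reflexive (ℕ.*-identityʳ _)))
          (incidence≤1 L (cls i))
        at-most : ∀ n → n ≤ 1 → n ≤ if01 (1 ≤ᵇ n)
        at-most 0 _ = z≤n
        at-most 1 _ = s≤s z≤n
        at-most (suc (suc n)) (s≤s ())
        member : ∀ i → i ∈ Vec.tabulate (λ i → 1 ≤ᵇ h i) → 1 ≤ h i
        member i i∈ = ≤ᵇ-sound 1 (h i) (trans (sym (lookup∘tabulate (λ i → 1 ≤ᵇ h i) i)) ([]=⇒lookup i∈))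
        incident-at : ∀ i → 1 ≤ h i → point i on lineAt L m
        incident-at i 1≤h = go (∑-positive (λ j → δ (cls i) (pt L j) * δ (seg L j (cell i)) (std j m)) (λ z → ℕ.1+n≰n (subst (1 ≤_) z 1≤h)))
          where
          go : (∃ λ j → 1 ≤ δ (cls i) (pt L j) * δ (seg L j (cell i)) (std j m)) → point i on lineAt L m
          go (j , 1≤) = on-line L m (place i) (subst (λ x → dot (form-of L m) (vec x (cell i)) ≡ (0F , 0F))
              (sym (δ-true (cls i) (pt L j) (ℕ.n≢0⇒n>0 λ z → ℕ.1+n≰n (subst (1 ≤_) (cong (_* δ (seg L j (cell i)) (std j m)) z) 1≤))))
              (incident is-incident L j (cell i) m (δ-true (seg L j (cell i)) (std j m)
                (ℕ.n≢0⇒n>0 λ z → ℕ.1+n≰n (subst (1 ≤_) (trans (cong (δ (cls i) (pt L j) *_) z) (ℕ.*-zeroʳ (δ (cls i) (pt L j)))) 1≤)))))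

    m≤84 : m R 6 ≤ 84
    m≤84 = CellArcs.bound segments₀ (cellArc (proj₁ (m-isLargest R 6)))

    m<84 : Model.Subplane κ σ → m R 6 < 84
    m<84 subplane = ℕ.≤∧≢⇒< m≤84 λ eq → CellArcs.no-84 segments₀ five degree≡ (subst CellArc eq (cellArc (proj₁ (m-isLargest R 6))))
      where
      five : Fin 21 → Fin 16 → ℕ
      five x v = if degree x v ≡ᵇ 5 then 1 else 0
      degree≡ : ∀ x v → ∑ (λ i → δ (segx x i v) (std (pos x i) 0F)) ≡ 1 + 4 * five x v
      degree≡ x v = trans (∑≡sum _) (≡ᵇ-sound _ _ (check₂ subplane x v))

-- Verification of the coordinates for the three rings.

module Rings where

  open Sums
  open AffinePlane
  open ChainRings
  open CoordinateVectors
  open import Defs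
  open import Data.Fin.Base using (Fin)
  open import Data.Fin.Patterns
  open import Data.Product.Base using (_×_; _,_)
  open import Relation.Binary.PropositionalEquality using (refl)
  open import Function.Base using (id)

  field₄ : F → Fin 2 × Fin 2
  field₄ 0F = 0F , 0F
  field₄ 1F = 1F , 0F
  field₄ 2F = 0F , 1F
  field₄ 3F = 1F , 1F

  -- a + 2b with the Teichmüller representatives 0, 1, ξ and ξ² = 3 + 3ξ, where ξ is the class of
  -- the polynomial variable.
  galois : Elem → Fin 4 × Fin 4
  galois (a , b) = add (teich a) (add (teich b) (teich b))
    where
    open import Algebra.Bundles using (Ring)
    add = Ring._+_ (FiniteRing.ring 𝔾₄)
    teich : F → Fin 4 × Fin 4
    teich 0F = 0F , 0F
    teich 1F = 1F , 0F
    teich 2F = 0F , 1F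
    teich 3F = 3F , 3F

  pair₄ : Elem → (Fin 2 × Fin 2) × (Fin 2 × Fin 2)
  pair₄ (a , b) = field₄ a , field₄ b

  𝔾-coordinates : Coordinates.IsCoordinates 𝔾₄ witt id galois
  𝔾-coordinates = record
    { homo-+ = by refl ; homo-* = by refl ; homo-0 = refl ; homo-1 = refl ; proper = refl
    ; onto = by refl ; units = by refl ; σ-zero = refl }

  𝕊-coordinates : Coordinates.IsCoordinates 𝕊₄ none id pair₄
  𝕊-coordinates = record
    { homo-+ = by refl ; homo-* = by refl ; homo-0 = refl ; homo-1 = refl ; proper = refl
    ; onto = by refl ; units = by refl ; σ-zero = refl }

  𝕋-coordinates : Coordinates.IsCoordinates 𝕋₄ none frob pair₄
  𝕋-coordinates = record
    { homo-+ = by refl ; homo-* = by refl ; homo-0 = refl ; homo-1 = refl ; proper = refl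
    ; onto = by refl ; units = by refl ; σ-zero = refl }

-- The bounds for 𝔾₄, 𝕊₄ and 𝕋₄.

open import Defs
open import Data.Nat.Base using (_≤_; _<_)
open import Data.Product.Base using (_×_; _,_)
open import Data.Sum.Base using (_⊎_; inj₁; inj₂)
open import Data.Empty using (⊥-elim)
open import Function.Base using (id)
open import Relation.Binary.PropositionalEquality using (_≡_; _≢_; refl)
open AffinePlane using (frob)
open ChainRings
open ArcBounds
open Rings

private
  module 𝔾₄-arcs = Arcs 𝔾₄ witt id galois 𝔾-coordinates incident-𝔾 affine-𝔾
  module 𝕊₄-arcs = Arcs 𝕊₄ none id pair₄ 𝕊-coordinates incident-𝕊 affine-𝕊
  module 𝕋₄-arcs = Arcs 𝕋₄ none frob pair₄ 𝕋-coordinates incident-𝕋 affine-𝕋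

theorem4p17 : (R : FiniteRing) → R ≡ 𝔾₄ ⊎ R ≡ 𝕊₄ ⊎ R ≡ 𝕋₄ → m R 6 ≤ 84 × (R ≢ 𝔾₄ → m R 6 < 84)
theorem4p17 R (inj₁ refl)        = 𝔾₄-arcs.m≤84 , λ R≢𝔾₄ → ⊥-elim (R≢𝔾₄ refl)
theorem4p17 R (inj₂ (inj₁ refl)) = 𝕊₄-arcs.m≤84 , λ _ → 𝕊₄-arcs.m<84 subplane-𝕊
theorem4p17 R (inj₂ (inj₂ refl)) = 𝕋₄-arcs.m≤84 , λ _ → 𝕋₄-arcs.m<84 subplane-𝕋
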